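{- For all integers $n\ge 0$ and $k\ge 0$, the space $\mathcal{D}_n^{(k)}=\bigoplus_{j=0}^{\min(k,n)} S_j\,\mathcal{D}^{(0)}_{n-j}\subseteq \mathbf{Sym}_n$ is stable under the internal product $*$. Moreover $(\mathcal{D}_n^{(k)},*)$ is a unital algebra, whose neutral element is $$P_n^{(k)}:=\sum_{i=0}^{\min(k,n)}\frac{S_1^i}{i!}\,S_{n-i}^\sharp .$$
   Context: $\mathbf{Sym}=\bigoplus_{n\ge0}\mathbf{Sym}_n$ (noncommutative symmetric functions, over $\mathbb{C}$) is the free associative unital algebra on generators $S_1,S_2,\dots$ with $\deg S_n=n$, $S_0=1$. For a composition $I=(i_1,\dots,i_r)$ of $n$, $S^I=S_{i_1}\cdots S_{i_r}$; these form a basis of $\mathbf{Sym}_n$. The internal product $*$ is the bilinear associative product on $\mathbf{Sym}$ with $F*G=0$ if $F,G$ are homogeneous of different degrees, and, for compositions $I,J$ of $n$, $S^I*S^J=\sum_M S^M$, sum over all nonnegative integer matrices $M$ with row sums $I$ and column sums $J$, where $S^M$ is the product of the $S_{m_{ij}}$ read row by row (left to right, top to bottom). $S_n$ is the unit of $(\mathbf{Sym}_n,*)$. Set $S_n^\sharp=\sum_{i=0}^n(-1)^i\frac{S_1^i}{i!}S_{n-i}$. Let $\mathcal{D}_n^{(0)}=\{F*S_n^\sharp : F\in\mathbf{Sym}_n\}$. $S_j\mathcal{D}^{(0)}_{n-j}$ denotes the set of ordinary products $S_jf$ with $f\in\mathcal{D}^{(0)}_{n-j}$. -}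

module Defs where

open import Algebra.Apartness.Bundles using (HeytingField; HeytingCommutativeRing)
open import Algebra.Bundles using (CommutativeRing; RawSemiring; Semiring)
import Algebra.Definitions.RawSemiring as RawSemiringDefs
open import Data.Fin.Base using (Fin; toℕ)
open import Data.List.Base as List
  using (List; []; _∷_; _++_; length; concatMap; filter; upTo)
import Data.List.Properties as List
open import Data.Nat.Base as ℕ using (ℕ; zero; suc; _∸_; _⊓_; _!; NonZero)
import Data.Nat.ListAction as ListAction
import Data.Nat.Properties as ℕ
open import Data.Product.Base using (_×_; _,_; proj₁; ∃)
open import Data.Vec.Base as Vec using (Vec)
import Data.Vec.Properties as Vec
open import Level using (Level; _⊔_)
open import Relation.Binary.Definitions using (DecidableEquality)
open import Relation.Binary.PropositionalEquality.Core using (_≡_; _≢_)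
open import Relation.Nullary.Decidable using (yes; no; _×-dec_)
open import Relation.Unary using (Pred; _∈_)

------------------------------------------------------------------------
-- Nonnegative integer matrices with prescribed row and column sums

Matrix : ℕ → ℕ → Set
Matrix r c = Vec (Vec ℕ c) r

rowSums : ∀ {r c} → Matrix r c → Vec ℕ r
rowSums = Vec.map Vec.sum

colSums : ∀ {r c} → Matrix r c → Vec ℕ c
colSums = Vec.foldr _ (Vec.zipWith ℕ._+_) (Vec.replicate _ 0)

-- Row by row, left to right, top to bottom.
entries : ∀ {r c} → Matrix r c → List ℕ
entries M = Vec.toList (Vec.concat M)

tuples : ∀ {a} {A : Set a} → List A → (n : ℕ) → List (Vec A n)
tuples xs zero    = Vec.[] ∷ []
tuples xs (suc n) = List.cartesianProductWith Vec._∷_ xs (tuples xs n)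

-- Every matrix with row sums I has entries at most sum I, so the
-- finite search below finds each matrix with row sums I and column
-- sums J exactly once.
matrices : (I J : List ℕ) → List (Matrix (length I) (length J))
matrices I J = filter
  (λ M → Vec.≡-dec ℕ._≟_ (rowSums M) (Vec.fromList I)
         ×-dec Vec.≡-dec ℕ._≟_ (colSums M) (Vec.fromList J))
  (tuples (tuples (upTo (suc (ListAction.sum I))) (length J)) (length I))

------------------------------------------------------------------------
-- Words in the generators S₁, S₂, …

-- The letter m stands for the generator S_{m+1}, so that words
-- correspond to compositions (see `parts`).
Word : Set
Word = List ℕ

_≟ʷ_ : DecidableEquality Word
_≟ʷ_ = List.≡-dec ℕ._≟_

parts : Word → List ℕ
parts = List.map suc

degree : Word → ℕ
degree w = ListAction.sum (parts w)

------------------------------------------------------------------------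
-- Fields of characteristic zero

CharZero : ∀ {c ℓ₁ ℓ₂} → HeytingField c ℓ₁ ℓ₂ → Set ℓ₂
CharZero K = ∀ n → .{{NonZero n}} → (n · 1#) # 0#
  where
  open HeytingField K
  open CommutativeRing (HeytingCommutativeRing.commutativeRing heytingCommutativeRing)
    using (semiring)
  open RawSemiringDefs (Semiring.rawSemiring semiring) using () renaming (_×_ to _·_)

------------------------------------------------------------------------
-- Noncommutative symmetric functions over K

module NSym {c ℓ₁ ℓ₂ : Level} (K : HeytingField c ℓ₁ ℓ₂) (char0 : CharZero K) where

  open HeytingField K
    using (Carrier; _≈_; _+_; _*_; -_; 0#; 1#; heytingCommutativeRing; #⇒invertible)
  open CommutativeRing (HeytingCommutativeRing.commutativeRing heytingCommutativeRing)
    using (semiring)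
  open RawSemiringDefs (Semiring.rawSemiring semiring) using () renaming (_^_ to _^ᴷ_)

  -- The field asserts that (x - y) is invertible when x # y; here x - y
  -- is n · 1# - 0#.
  inv : (n : ℕ) → .{{NonZero n}} → Carrier
  inv n = proj₁ (#⇒invertible (char0 n))

  invFact : ℕ → Carrier
  invFact i = inv (i !) {{i ℕ.!≢0}}

  -- The free associative unital algebra, as finite formal linear
  -- combinations of words.  A word may occur several times in the list;
  -- equality _≋_ compares the total coefficients.
  Sym : Set c
  Sym = List (Carrier × Word)

  coeff : Sym → Word → Carrier
  coeff []            w = 0#
  coeff ((a , u) ∷ F) w with u ≟ʷ w
  ... | yes _ = a + coeff F w
  ... | no  _ = coeff F w

  infix  4 _≋_
  infixl 6 _⊕_
  infixl 7 _·_ _⋆_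
  infixr 8 _•_

  _≋_ : Sym → Sym → Set ℓ₁
  F ≋ G = ∀ w → coeff F w ≈ coeff G w

  𝟘 : Sym
  𝟘 = []

  𝟙 : Sym
  𝟙 = (1# , []) ∷ []

  _⊕_ : Sym → Sym → Sym
  _⊕_ = _++_

  _•_ : Carrier → Sym → Sym
  a • F = List.map (λ (b , u) → a * b , u) F

  _·_ : Sym → Sym → Sym
  _·_ = List.cartesianProductWith (λ (a , u) (b , v) → a * b , u ++ v)

  symRawSemiring : RawSemiring c ℓ₁
  symRawSemiring = record
    { Carrier = Sym ; _≈_ = _≋_ ; _+_ = _⊕_ ; _*_ = _·_ ; 0# = 𝟘 ; 1# = 𝟙 }

  open RawSemiringDefs symRawSemiring public using (sum; _^_)

  -- S 0 = 1.
  S : ℕ → Sym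
  S zero    = 𝟙
  S (suc m) = (1# , m ∷ []) ∷ []

  S^ : List ℕ → Sym
  S^ = List.foldr (λ i F → S i · F) 𝟙

  -- F ∈ Sym[ n ] : F is homogeneous of degree n.
  Sym[_] : ℕ → Pred Sym ℓ₁
  Sym[ n ] F = ∀ w → degree w ≢ n → coeff F w ≈ 0#

  -- The internal product S^I * S^J.  If I and J have different sums then
  -- there are no such matrices and the result is 𝟘.
  S^_⋆S^_ : List ℕ → List ℕ → Sym
  S^ I ⋆S^ J = concatMap (λ M → S^ (entries M)) (matrices I J)

  -- The bilinear extension of the above.
  _⋆_ : Sym → Sym → Sym
  F ⋆ G = concatMap (λ (a , u) →
            concatMap (λ (b , v) → (a * b) • (S^ parts u ⋆S^ parts v)) G) F

  S♯ : ℕ → Sym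
  S♯ n = sum {suc n} λ i →
    ((- 1#) ^ᴷ toℕ i * invFact (toℕ i)) • (S 1 ^ toℕ i) · S (n ∸ toℕ i)

  D⁰ : ℕ → Pred Sym (c ⊔ ℓ₁)
  D⁰ n F = ∃ λ G → G ∈ Sym[ n ] × F ≋ G ⋆ S♯ n

  -- { s f | f ∈ U }
  _·ₛ_ : ∀ {p} → Sym → Pred Sym p → Pred Sym (c ⊔ ℓ₁ ⊔ p)
  (s ·ₛ U) F = ∃ λ f → f ∈ U × F ≋ s · f

  -- The sum of a finite family of subspaces, which is direct when the
  -- family is independent.
  Sum : ∀ {p m} → (Fin m → Pred Sym p) → Pred Sym (c ⊔ ℓ₁ ⊔ p)
  Sum V F = ∃ λ g → (∀ j → g j ∈ V j) × F ≋ sum g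

  Independent : ∀ {p m} → (Fin m → Pred Sym p) → Set (c ⊔ ℓ₁ ⊔ p)
  Independent V = ∀ g → (∀ j → g j ∈ V j) → sum g ≋ 𝟘 → ∀ j → g j ≋ 𝟘

  summand : (n k : ℕ) → Fin (suc (k ⊓ n)) → Pred Sym (c ⊔ ℓ₁)
  summand n k j = S (toℕ j) ·ₛ D⁰ (n ∸ toℕ j)

  D : (n k : ℕ) → Pred Sym (c ⊔ ℓ₁)
  D n k = Sum (summand n k)

  P : (n k : ℕ) → Sym
  P n k = sum {suc (k ⊓ n)} λ i →
    invFact (toℕ i) • (S 1 ^ toℕ i) · S♯ (n ∸ toℕ i)

  record IsSubspace {p} (U : Pred Sym p) : Set (c ⊔ ℓ₁ ⊔ p) where
    field
      resp     : ∀ {F G} → F ≋ G → F ∈ U → G ∈ U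
      𝟘-closed : 𝟘 ∈ U
      ⊕-closed : ∀ {F G} → F ∈ U → G ∈ U → F ⊕ G ∈ U
      •-closed : ∀ a {F} → F ∈ U → a • F ∈ U

  ⋆-Stable : ∀ {p} → Pred Sym p → Set (c ⊔ p)
  ⋆-Stable U = ∀ {F G} → F ∈ U → G ∈ U → F ⋆ G ∈ U

  -- (U , ⋆) is an associative unital K-algebra with neutral element e.
  -- Well-definedness of ⋆ with respect to _≋_ is part of the claim.
  record IsUnitalAlgebra {p} (U : Pred Sym p) (e : Sym) : Set (c ⊔ ℓ₁ ⊔ p) where
    field
      isSubspace : IsSubspace U
      ⋆-closed   : ⋆-Stable U
      ⋆-cong     : ∀ {F F′ G G′} → F ∈ U → F′ ∈ U → G ∈ U → G′ ∈ U →
                   F ≋ F′ → G ≋ G′ → F ⋆ G ≋ F′ ⋆ G′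
      ⋆-assoc    : ∀ {F G H} → F ∈ U → G ∈ U → H ∈ U → (F ⋆ G) ⋆ H ≋ F ⋆ (G ⋆ H)
      distribˡ   : ∀ {F G H} → F ∈ U → G ∈ U → H ∈ U → F ⋆ (G ⊕ H) ≋ (F ⋆ G) ⊕ (F ⋆ H)
      distribʳ   : ∀ {F G H} → F ∈ U → G ∈ U → H ∈ U → (G ⊕ H) ⋆ F ≋ (G ⋆ F) ⊕ (H ⋆ F)
      •-⋆ˡ       : ∀ a {F G} → F ∈ U → G ∈ U → (a • F) ⋆ G ≋ a • (F ⋆ G)
      •-⋆ʳ       : ∀ a {F G} → F ∈ U → G ∈ U → F ⋆ (a • G) ≋ a • (F ⋆ G)
      e∈U        : e ∈ U
      identityˡ  : ∀ {F} → F ∈ U → e ⋆ F ≋ F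
      identityʳ  : ∀ {F} → F ∈ U → F ⋆ e ≋ F

{-# OPTIONS --safe #-}
module Submission where

-- Write Eⱼ = S₁ʲ/j!, let ∂ be the derivation of Sym with ∂ Sₘ = Sₘ₋₁, and let ρ be the algebra
-- endomorphism with Sₘ ↦ S♯ₘ. As S♯ is group-like, F ⋆ S♯ₙ = ρ F for F of degree n, so that
-- D⁰ₙ = ρ(Symₙ); moreover ∂ S♯ₘ = 0, hence ∂ vanishes on D⁰. Extracting S₁ on the left gives
-- (Eⱼ F) ⋆ G = Eⱼ (F ⋆ ∂ʲ G); so S♯ₙ acts on Symₙ from the left as Σ (-1)ⁱ Eᵢ ∂ⁱ, which fixes ker ∂
-- and annihilates E_d ker ∂ for d > 0. Therefore
--   (Eᵢ ρ F) ⋆ (Eⱼ ρ G) = δᵢⱼ Eᵢ ρ (F ⋆ G).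
-- The identity Sⱼ = Σ Eₐ S♯_b (a + b = j) is triangular, so D n k = Σⱼ Eⱼ D⁰ₙ₋ⱼ, and on these
-- summands stability and the neutral element Σ Eⱼ S♯ₙ₋ⱼ can be read off. The sum is direct because
-- ∂ maps Σ Sⱼ fⱼ with fⱼ ∈ ker ∂ to the shorter sum Σ Sⱼ fⱼ₊₁.

open import Defs
open import Algebra.Apartness.Bundles using (HeytingField; HeytingCommutativeRing)
open import Algebra.Bundles using (CommutativeRing; Semiring)
import Algebra.Definitions.RawSemiring as RawSemiringDefs
import Algebra.Properties.CommutativeSemigroup as CommutativeSemigroupProperties
import Algebra.Properties.Ring as RingProperties
open import Data.Bool.Base using (true; false; if_then_else_)
open import Data.Empty using (⊥-elim)
open import Data.Fin.Base using (Fin; zero; suc; toℕ; fromℕ<)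
import Data.Fin.Properties as Fin
open import Data.List.Base as List using (List; []; _∷_; _++_; concatMap; length; upTo)
import Data.List.Properties as List
open import Data.Nat.Base as ℕ using (ℕ; zero; suc; _∸_; _⊓_; _!)
open import Data.Nat.Induction using (<-rec)
import Data.Nat.Properties as ℕ
open import Data.Product.Base using (_×_; _,_; proj₁; proj₂; ∃)
open import Data.Vec.Base as Vec using (Vec)
import Data.Vec.Properties as Vec
open import Function.Base using (_∘_; id)
open import Level using (_⊔_)
open import Relation.Binary.Bundles using (Setoid)
open import Relation.Binary.PropositionalEquality as ≡ using (_≡_; _≢_)
import Relation.Binary.Reasoning.Setoid as SetoidReasoning
open import Relation.Nullary using (Dec; does; yes; no; ¬_)
open import Relation.Nullary.Decidable using (_×-dec_)
open import Relation.Unary using (Pred; Decidable; _∈_; _⊆_)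

-- That group-likeness of S♯ gives F ⋆ S♯ₙ = ρ F rests on the splitting formula (F F′) ⋆ G = Σ (F ⋆
-- G₁)(F′ ⋆ G₂), where Σ G₁ ⊗ G₂ is the coproduct of G for which Σ Sₙ is group-like. The definition
-- by matrices hides this formula. It is recovered by choosing the first row of a matrix: the row
-- and what remains of the column sums J together form one term of the coproduct of S^J.
-- Associativity of ⋆ follows by induction on rows, because the coproduct is multiplicative for ⋆ as
-- well. The formal obstacle is that an element is a list in which words may repeat, while equality
-- compares total coefficients only, so lists cannot be compared term by term. Each F is therefore
-- treated as the functional `∫ F` on arbitrary functions of words. Products become iterated sums,
-- and an identity becomes a chain of exchanges of summation, valid for every test function.
-- Exponential identities are proved by a formal derivative and cancellation of positive integers.

-- Words and their degrees, with S₀ absorbed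

infixr 5 _▹_

-- a ▹ w is the word of S_a S^w, where S₀ = 1.
_▹_ : ℕ → Word → Word
zero  ▹ w = w
suc m ▹ w = m ∷ w

degree-▹ : ∀ a w → degree (a ▹ w) ≡ a ℕ.+ degree w
degree-▹ zero    w = ≡.refl
degree-▹ (suc a) w = ≡.refl

▹-++ : ∀ a u v → (a ▹ u) ++ v ≡ a ▹ (u ++ v)
▹-++ zero    u v = ≡.refl
▹-++ (suc a) u v = ≡.refl

compress : List ℕ → Word
compress = List.foldr _▹_ []

compress-++ : ∀ xs ys → compress (xs ++ ys) ≡ compress xs ++ compress ys
compress-++ []       ys = ≡.refl
compress-++ (x ∷ xs) ys = ≡.trans (≡.cong (x ▹_) (compress-++ xs ys)) (≡.sym (▹-++ x _ _))

compress-parts : ∀ w → compress (parts w) ≡ w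
compress-parts []      = ≡.refl
compress-parts (m ∷ w) = ≡.cong (m ∷_) (compress-parts w)

degree-++ : ∀ u v → degree (u ++ v) ≡ degree u ℕ.+ degree v
degree-++ []      v = ≡.refl
degree-++ (m ∷ u) v =
  ≡.trans (≡.cong (suc m ℕ.+_) (degree-++ u v)) (≡.sym (ℕ.+-assoc (suc m) (degree u) (degree v)))

degree-▹-+ : ∀ a b r s →
  degree (a ▹ r) ℕ.+ degree (b ▹ s) ≡ (a ℕ.+ b) ℕ.+ (degree r ℕ.+ degree s)
degree-▹-+ a b r s = ≡.trans (≡.cong₂ ℕ._+_ (degree-▹ a r) (degree-▹ b s))
                             (ℕ+.interchange a (degree r) b (degree s))
  where module ℕ+ = CommutativeSemigroupProperties ℕ.+-commutativeSemigroup

degree≡0 : ∀ {w} → degree w ≡ 0 → w ≡ []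
degree≡0 {[]} _ = ≡.refl

-- Calculus of formal sums over a commutative ring

module FormalSums {c ℓ} (R : CommutativeRing c ℓ) where

  open CommutativeRing R hiding (zero)
  open CommutativeSemigroupProperties +-commutativeSemigroup using (interchange)
  open CommutativeSemigroupProperties *-commutativeSemigroup using (x∙yz≈y∙xz)
  open RawSemiringDefs (Semiring.rawSemiring semiring) using () renaming (_×_ to _×′_)
  open SetoidReasoning setoid

  private
    variable
      A B : Set

  -- Formal finite linear combinations and their pairing with test functions

  K[_] : Set → Set c
  K[ A ] = List (Carrier × A)

  -- Keeping ∫ abstract lets unification solve for its arguments.
  abstract
    ∫ : K[ A ] → (A → Carrier) → Carrier
    ∫ []            φ = 0#
    ∫ ((a , x) ∷ F) φ = a * φ x + ∫ F φ

    ∫-[] : ∀ (φ : A → Carrier) → ∫ [] φ ≈ 0#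
    ∫-[] φ = refl

    ∫-∷ : ∀ a (x : A) F φ → ∫ ((a , x) ∷ F) φ ≈ a * φ x + ∫ F φ
    ∫-∷ a x F φ = refl

    ∫-cong : ∀ (F : K[ A ]) {φ ψ} → (∀ x → φ x ≈ ψ x) → ∫ F φ ≈ ∫ F ψ
    ∫-cong []            eq = refl
    ∫-cong ((a , x) ∷ F) eq = +-cong (*-congˡ (eq x)) (∫-cong F eq)

    ∫-0 : ∀ (F : K[ A ]) → ∫ F (λ _ → 0#) ≈ 0#
    ∫-0 []            = refl
    ∫-0 ((a , x) ∷ F) = trans (+-cong (zeroʳ a) (∫-0 F)) (+-identityˡ 0#)

    ∫-+ : ∀ (F : K[ A ]) φ ψ → ∫ F (λ x → φ x + ψ x) ≈ ∫ F φ + ∫ F ψ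
    ∫-+ []            φ ψ = sym (+-identityˡ 0#)
    ∫-+ ((a , x) ∷ F) φ ψ =
      trans (+-cong (distribˡ a (φ x) (ψ x)) (∫-+ F φ ψ)) (interchange _ _ _ _)

    ∫-*ˡ : ∀ (F : K[ A ]) a φ → ∫ F (λ x → a * φ x) ≈ a * ∫ F φ
    ∫-*ˡ []            a φ = sym (zeroʳ a)
    ∫-*ˡ ((b , x) ∷ F) a φ =
      trans (+-cong (x∙yz≈y∙xz b a (φ x)) (∫-*ˡ F a φ)) (sym (distribˡ a _ _))

    ∫-*ʳ : ∀ (F : K[ A ]) a φ → ∫ F (λ x → φ x * a) ≈ ∫ F φ * a
    ∫-*ʳ F a φ = trans (∫-cong F λ x → *-comm (φ x) a) (trans (∫-*ˡ F a φ) (*-comm a _))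

    ∫-swap : ∀ (F : K[ A ]) (G : K[ B ]) (φ : A → B → Carrier) →
             ∫ F (λ x → ∫ G λ y → φ x y) ≈ ∫ G (λ y → ∫ F λ x → φ x y)
    ∫-swap []            G φ = sym (∫-0 G)
    ∫-swap ((a , x) ∷ F) G φ = begin
      a * ∫ G (φ x) + ∫ F (λ x → ∫ G (φ x))               ≈⟨ +-cong (sym (∫-*ˡ G a (φ x))) (∫-swap F G φ) ⟩
      ∫ G (λ y → a * φ x y) + ∫ G (λ y → ∫ F λ x → φ x y) ≈⟨ ∫-+ G _ _ ⟨
      ∫ G (λ y → a * φ x y + ∫ F λ x → φ x y)             ∎

    ∫-++ : ∀ (F G : K[ A ]) φ → ∫ (F ++ G) φ ≈ ∫ F φ + ∫ G φ
    ∫-++ []            G φ = sym (+-identityˡ _)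
    ∫-++ ((a , x) ∷ F) G φ = trans (+-congˡ (∫-++ F G φ)) (sym (+-assoc _ _ _))

    ∫-map : ∀ a (f : A → B) F φ →
            ∫ (List.map (λ (b , x) → a * b , f x) F) φ ≈ a * ∫ F (φ ∘ f)
    ∫-map a f []            φ = sym (zeroʳ a)
    ∫-map a f ((b , x) ∷ F) φ =
      trans (+-cong (*-assoc a b _) (∫-map a f F φ)) (sym (distribˡ a _ _))

    ∫-concatMap : ∀ (g : Carrier × A → K[ B ]) F {φ ψ} →
                  (∀ a x → ∫ (g (a , x)) φ ≈ a * ψ x) → ∫ (concatMap g F) φ ≈ ∫ F ψ
    ∫-concatMap g []            eq = refl
    ∫-concatMap g ((a , x) ∷ F) eq =
      trans (∫-++ (g (a , x)) (concatMap g F) _) (+-cong (eq a x) (∫-concatMap g F eq))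

  -- Linear extension and indicator coefficients

  scale : Carrier → K[ A ] → K[ A ]
  scale a = List.map (λ (b , x) → a * b , x)

  ∫-scale : ∀ a (F : K[ A ]) φ → ∫ (scale a F) φ ≈ a * ∫ F φ
  ∫-scale a F φ = ∫-map a id F φ

  η : A → K[ A ]
  η x = (1# , x) ∷ []

  ∫-η : ∀ (x : A) φ → ∫ (η x) φ ≈ φ x
  ∫-η x φ = trans (∫-∷ 1# x [] φ) (trans (+-cong (*-identityˡ _) (∫-[] φ)) (+-identityʳ _))

  infixl 1 _>>=_

  _>>=_ : K[ A ] → (A → K[ B ]) → K[ B ]
  F >>= f = concatMap (λ (a , x) → scale a (f x)) F

  ∫->>= : ∀ (F : K[ A ]) (f : A → K[ B ]) φ → ∫ (F >>= f) φ ≈ ∫ F (λ x → ∫ (f x) φ)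
  ∫->>= F f φ = ∫-concatMap _ F (λ a x → ∫-scale a (f x) φ)

  ⟦_⟧ : ∀ {p} {P : Set p} → Dec P → Carrier
  ⟦ d ⟧ = if does d then 1# else 0#

  ⟦⟧-yes : ∀ {p} {P : Set p} (d : Dec P) {x} → P → ⟦ d ⟧ * x ≈ x
  ⟦⟧-yes (yes _) _ = *-identityˡ _
  ⟦⟧-yes (no ¬p) p = ⊥-elim (¬p p)

  ⟦⟧-no : ∀ {p} {P : Set p} (d : Dec P) {x} → ¬ P → ⟦ d ⟧ * x ≈ 0#
  ⟦⟧-no (yes p) ¬p = ⊥-elim (¬p p)
  ⟦⟧-no (no _)  _  = zeroˡ _

  ⟦⟧-guard : ∀ {p} {P : Set p} (d : Dec P) {x y} → (P → x ≈ y) → ⟦ d ⟧ * x ≈ ⟦ d ⟧ * y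
  ⟦⟧-guard (yes p) eq = *-congˡ (eq p)
  ⟦⟧-guard (no _)  eq = trans (zeroˡ _) (sym (zeroˡ _))

  ⟦⟧-cong : ∀ {p q} {P : Set p} {Q : Set q} (d : Dec P) (e : Dec Q) →
            (P → Q) → (Q → P) → ⟦ d ⟧ ≈ ⟦ e ⟧
  ⟦⟧-cong (yes p) (yes q) f g = refl
  ⟦⟧-cong (yes p) (no ¬q) f g = ⊥-elim (¬q (f p))
  ⟦⟧-cong (no ¬p) (yes q) f g = ⊥-elim (¬p (g q))
  ⟦⟧-cong (no ¬p) (no ¬q) f g = refl

  ⟦⟧-× : ∀ {p q} {P : Set p} {Q : Set q} (d : Dec P) (e : Dec Q) →
         ⟦ d ×-dec e ⟧ ≈ ⟦ d ⟧ * ⟦ e ⟧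
  ⟦⟧-× (yes p) e = sym (*-identityˡ _)
  ⟦⟧-× (no ¬p) e = sym (zeroˡ _)

  -- Cocommutative coassociative comultiplications

  module Coalgebra
    (δ : A → K[ A × A ])
    (coassoc : ∀ x (φ : A → A → A → Carrier) → ∫ (δ x) (λ (y , z) → ∫ (δ y) λ (p , q) → φ p q z)
                     ≈ ∫ (δ x) (λ (p , y) → ∫ (δ y) λ (q , z) → φ p q z))
    (cocomm : ∀ x (φ : A → A → Carrier) → ∫ (δ x) (λ (y , z) → φ y z) ≈ ∫ (δ x) (λ (y , z) → φ z y))
    where

    -- Coassociativity brings the two middle factors q and r under one coproduct, cocommutativity
    -- swaps them there, and the regrouping is then undone. This is what makes products of
    -- coproducts compatible.
    exchange : ∀ x (φ : A → A → A → A → Carrier) →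
      ∫ (δ x) (λ (y , z) → ∫ (δ y) λ (p , q) → ∫ (δ z) λ (r , s) → φ p q r s) ≈
      ∫ (δ x) (λ (y , z) → ∫ (δ y) λ (p , r) → ∫ (δ z) λ (q , s) → φ p q r s)
    exchange x φ = begin
      ∫ (δ x) (λ (y , z) → ∫ (δ y) λ (p , q) → ∫ (δ z) λ (r , s) → φ p q r s)
        ≈⟨ coassoc x (λ p q z → ∫ (δ z) λ (r , s) → φ p q r s) ⟩
      ∫ (δ x) (λ (p , y) → ∫ (δ y) λ (q , z) → ∫ (δ z) λ (r , s) → φ p q r s)
        ≈⟨ ∫-cong (δ x) (λ (p , y) → coassoc y (φ p)) ⟨
      ∫ (δ x) (λ (p , y) → ∫ (δ y) λ (w , s) → ∫ (δ w) λ (q , r) → φ p q r s)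
        ≈⟨ ∫-cong (δ x) (λ (p , y) → ∫-cong (δ y) λ (w , s) → cocomm w (λ q r → φ p q r s)) ⟩
      ∫ (δ x) (λ (p , y) → ∫ (δ y) λ (w , s) → ∫ (δ w) λ (r , q) → φ p q r s)
        ≈⟨ ∫-cong (δ x) (λ (p , y) → coassoc y (λ r q s → φ p q r s)) ⟩
      ∫ (δ x) (λ (p , y) → ∫ (δ y) λ (r , z) → ∫ (δ z) λ (q , s) → φ p q r s)
        ≈⟨ coassoc x (λ p r z → ∫ (δ z) λ (q , s) → φ p q r s) ⟨
      ∫ (δ x) (λ (y , z) → ∫ (δ y) λ (p , r) → ∫ (δ z) λ (q , s) → φ p q r s) ∎

  -- Coproduct of a single generator

  splits : ℕ → K[ ℕ × ℕ ]
  splits zero    = η (0 , 0)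
  -- The factor `1# *` brings the shifted list into the shape that `∫-map` evaluates.
  splits (suc n) = (1# , 0 , suc n) ∷ List.map (λ (k , a , b) → 1# * k , suc a , b) (splits n)

  splits-0 : ∀ φ → ∫ (splits 0) φ ≈ φ (0 , 0)
  splits-0 φ = ∫-η _ φ

  splits-suc : ∀ n φ → ∫ (splits (suc n)) φ ≈ φ (0 , suc n) + ∫ (splits n) (λ (a , b) → φ (suc a , b))
  splits-suc n φ = trans (∫-∷ 1# (0 , suc n) _ φ) (+-cong (*-identityˡ _)
    (trans (∫-map 1# (λ (a , b) → suc a , b) (splits n) φ) (*-identityˡ _)))

  splits-sucʳ : ∀ n φ → ∫ (splits (suc n)) φ ≈ ∫ (splits n) (λ (a , b) → φ (a , suc b)) + φ (suc n , 0)
  splits-sucʳ zero    φ = trans (splits-suc 0 φ) (+-cong (sym (splits-0 _)) (splits-0 _))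
  splits-sucʳ (suc n) φ = begin
    ∫ (splits (suc (suc n))) φ
      ≈⟨ splits-suc (suc n) φ ⟩
    φ (0 , suc (suc n)) + ∫ (splits (suc n)) (λ (a , b) → φ (suc a , b))
      ≈⟨ +-congˡ (splits-sucʳ n _) ⟩
    φ (0 , suc (suc n)) + (∫ (splits n) (λ (a , b) → φ (suc a , suc b)) + φ (suc (suc n) , 0))
      ≈⟨ +-assoc _ _ _ ⟨
    (φ (0 , suc (suc n)) + ∫ (splits n) (λ (a , b) → φ (suc a , suc b))) + φ (suc (suc n) , 0)
      ≈⟨ +-congʳ (splits-suc n _) ⟨
    ∫ (splits (suc n)) (λ (a , b) → φ (a , suc b)) + φ (suc (suc n) , 0) ∎

  splits-cong : ∀ n {φ ψ} → (∀ a b → a ℕ.+ b ≡ n → φ (a , b) ≈ ψ (a , b)) →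
                ∫ (splits n) φ ≈ ∫ (splits n) ψ
  splits-cong zero    {φ} {ψ} eq = trans (splits-0 φ) (trans (eq 0 0 ≡.refl) (sym (splits-0 ψ)))
  splits-cong (suc n) {φ} {ψ} eq = trans (splits-suc n φ) (trans
    (+-cong (eq 0 (suc n) ≡.refl) (splits-cong n λ a b a+b≡n → eq (suc a) b (≡.cong suc a+b≡n)))
    (sym (splits-suc n ψ)))

  splits-cocomm : ∀ n (φ : ℕ → ℕ → Carrier) →
                  ∫ (splits n) (λ (a , b) → φ a b) ≈ ∫ (splits n) (λ (a , b) → φ b a)
  splits-cocomm zero    φ = trans (splits-0 _) (sym (splits-0 _))
  splits-cocomm (suc n) φ = begin
    ∫ (splits (suc n)) (λ (a , b) → φ a b)                 ≈⟨ splits-suc n _ ⟩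
    φ 0 (suc n) + ∫ (splits n) (λ (a , b) → φ (suc a) b)   ≈⟨ +-congˡ (splits-cocomm n λ a b → φ (suc a) b) ⟩
    φ 0 (suc n) + ∫ (splits n) (λ (a , b) → φ (suc b) a)   ≈⟨ +-comm _ _ ⟩
    ∫ (splits n) (λ (a , b) → φ (suc b) a) + φ 0 (suc n)   ≈⟨ splits-sucʳ n (λ (a , b) → φ b a) ⟨
    ∫ (splits (suc n)) (λ (a , b) → φ b a)                 ∎

  splits-coassoc : ∀ n (φ : ℕ → ℕ → ℕ → Carrier) →
    ∫ (splits n) (λ (y , z) → ∫ (splits y) λ (p , q) → φ p q z) ≈
    ∫ (splits n) (λ (p , y) → ∫ (splits y) λ (q , z) → φ p q z)
  splits-coassoc zero    φ = trans (splits-0 _) (trans (splits-0 _)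
    (sym (trans (splits-0 _) (splits-0 _))))
  splits-coassoc (suc n) φ = begin
    ∫ (splits (suc n)) (λ (y , z) → ∫ (splits y) λ (p , q) → φ p q z)
      ≈⟨ splits-suc n _ ⟩
    ∫ (splits 0) (λ (p , q) → φ p q (suc n)) +
    ∫ (splits n) (λ (y , z) → ∫ (splits (suc y)) λ (p , q) → φ p q z)
      ≈⟨ +-cong (splits-0 _) (trans (∫-cong (splits n) λ (y , z) → splits-suc y (λ (p , q) → φ p q z)) (∫-+ (splits n) _ _)) ⟩
    φ 0 0 (suc n) + (∫ (splits n) (λ (y , z) → φ 0 (suc y) z) +
    ∫ (splits n) (λ (y , z) → ∫ (splits y) λ (p , q) → φ (suc p) q z))
      ≈⟨ +-assoc _ _ _ ⟨
    φ 0 0 (suc n) + ∫ (splits n) (λ (y , z) → φ 0 (suc y) z) +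
    ∫ (splits n) (λ (y , z) → ∫ (splits y) λ (p , q) → φ (suc p) q z)
      ≈⟨ +-cong (sym (splits-suc n _)) (splits-coassoc n (λ p q z → φ (suc p) q z)) ⟩
    ∫ (splits (suc n)) (λ (q , z) → φ 0 q z) +
    ∫ (splits n) (λ (p , y) → ∫ (splits y) λ (q , z) → φ (suc p) q z)
      ≈⟨ splits-suc n _ ⟨
    ∫ (splits (suc n)) (λ (p , y) → ∫ (splits y) λ (q , z) → φ p q z) ∎

  open Coalgebra splits splits-coassoc splits-cocomm public
    using () renaming (exchange to splits-exchange)

  -- The coproduct of words

  Δ : Word → K[ Word × Word ]
  Δ []      = η ([] , [])
  Δ (m ∷ w) = splits (suc m) >>= λ (a , b) → Δ w >>= λ (r , s) → η (a ▹ r , b ▹ s)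

  Δ-∷ : ∀ m w φ → ∫ (Δ (m ∷ w)) φ ≈
        ∫ (splits (suc m)) (λ (a , b) → ∫ (Δ w) λ (r , s) → φ (a ▹ r , b ▹ s))
  Δ-∷ m w φ = trans (∫->>= (splits (suc m)) _ φ) (∫-cong (splits (suc m)) λ (a , b) →
    trans (∫->>= (Δ w) _ φ) (∫-cong (Δ w) λ (r , s) → ∫-η _ φ))

  Δ-▹ : ∀ a w φ → ∫ (Δ (a ▹ w)) φ ≈
        ∫ (splits a) (λ (b , d) → ∫ (Δ w) λ (r , s) → φ (b ▹ r , d ▹ s))
  Δ-▹ zero    w φ = sym (splits-0 _)
  Δ-▹ (suc m) w φ = Δ-∷ m w φ

  -- Δ preserves total degree, so test functions matter only on pairs of complementary degrees.
  Δ-cong : ∀ w {φ ψ} → (∀ r s → degree r ℕ.+ degree s ≡ degree w → φ (r , s) ≈ ψ (r , s)) →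
           ∫ (Δ w) φ ≈ ∫ (Δ w) ψ
  Δ-cong []      {φ} {ψ} eq = trans (∫-η _ φ) (trans (eq [] [] ≡.refl) (sym (∫-η _ ψ)))
  Δ-cong (m ∷ w) {φ} {ψ} eq = trans (Δ-∷ m w φ) (trans
    (splits-cong (suc m) λ a b a+b≡1+m → Δ-cong w λ r s r+s≡w → eq (a ▹ r) (b ▹ s)
      (≡.trans (degree-▹-+ a b r s) (≡.cong₂ ℕ._+_ a+b≡1+m r+s≡w)))
    (sym (Δ-∷ m w ψ)))

  Δ-cocomm : ∀ w (φ : Word → Word → Carrier) → ∫ (Δ w) (λ (r , s) → φ r s) ≈ ∫ (Δ w) (λ (r , s) → φ s r)
  Δ-cocomm []      φ = trans (∫-η _ _) (sym (∫-η _ _))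
  Δ-cocomm (m ∷ w) φ = begin
    ∫ (Δ (m ∷ w)) (λ (r , s) → φ r s)
      ≈⟨ Δ-∷ m w _ ⟩
    ∫ (splits (suc m)) (λ (a , b) → ∫ (Δ w) λ (r , s) → φ (a ▹ r) (b ▹ s))
      ≈⟨ splits-cocomm (suc m) (λ a b → ∫ (Δ w) λ (r , s) → φ (a ▹ r) (b ▹ s)) ⟩
    ∫ (splits (suc m)) (λ (a , b) → ∫ (Δ w) λ (r , s) → φ (b ▹ r) (a ▹ s))
      ≈⟨ ∫-cong (splits (suc m)) (λ (a , b) → Δ-cocomm w λ r s → φ (b ▹ r) (a ▹ s)) ⟩
    ∫ (splits (suc m)) (λ (a , b) → ∫ (Δ w) λ (r , s) → φ (b ▹ s) (a ▹ r))
      ≈⟨ Δ-∷ m w _ ⟨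
    ∫ (Δ (m ∷ w)) (λ (r , s) → φ s r) ∎

  Δ-coassoc : ∀ w (φ : Word → Word → Word → Carrier) →
    ∫ (Δ w) (λ (y , z) → ∫ (Δ y) λ (p , q) → φ p q z) ≈
    ∫ (Δ w) (λ (p , y) → ∫ (Δ y) λ (q , z) → φ p q z)
  Δ-coassoc []      φ = trans (∫-η _ _) (trans (∫-η _ _) (sym (trans (∫-η _ _) (∫-η _ _))))
  Δ-coassoc (m ∷ w) φ = begin
    ∫ (Δ (m ∷ w)) (λ (y , z) → ∫ (Δ y) λ (p , q) → φ p q z)
      ≈⟨ Δ-∷ m w _ ⟩
    ∫ (splits (suc m)) (λ (a , b) → ∫ (Δ w) λ (r , s) → ∫ (Δ (a ▹ r)) λ (p , q) → φ p q (b ▹ s))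
      ≈⟨ ∫-cong (splits (suc m)) (λ (a , b) → trans
           (∫-cong (Δ w) λ (r , s) → Δ-▹ a r λ (p , q) → φ p q (b ▹ s)) (∫-swap (Δ w) (splits a) _)) ⟩
    ∫ (splits (suc m)) (λ (a , b) → ∫ (splits a) λ (d , e) →
      ∫ (Δ w) λ (r , s) → ∫ (Δ r) λ (p , q) → φ (d ▹ p) (e ▹ q) (b ▹ s))
      ≈⟨ splits-coassoc (suc m) (λ d e b → ∫ (Δ w) λ (r , s) → ∫ (Δ r) λ (p , q) → φ (d ▹ p) (e ▹ q) (b ▹ s)) ⟩
    ∫ (splits (suc m)) (λ (d , a) → ∫ (splits a) λ (e , b) →
      ∫ (Δ w) λ (r , s) → ∫ (Δ r) λ (p , q) → φ (d ▹ p) (e ▹ q) (b ▹ s))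
      ≈⟨ ∫-cong (splits (suc m)) (λ (d , a) → ∫-cong (splits a) λ (e , b) →
           Δ-coassoc w λ p q s → φ (d ▹ p) (e ▹ q) (b ▹ s)) ⟩
    ∫ (splits (suc m)) (λ (d , a) → ∫ (splits a) λ (e , b) →
      ∫ (Δ w) λ (p , y) → ∫ (Δ y) λ (q , s) → φ (d ▹ p) (e ▹ q) (b ▹ s))
      ≈⟨ ∫-cong (splits (suc m)) (λ (d , a) → trans
           (∫-cong (Δ w) λ (p , y) → Δ-▹ a y λ (q , s) → φ (d ▹ p) q s) (∫-swap (Δ w) (splits a) _)) ⟨
    ∫ (splits (suc m)) (λ (d , a) → ∫ (Δ w) λ (p , y) → ∫ (Δ (a ▹ y)) λ (q , s) → φ (d ▹ p) q s)
      ≈⟨ Δ-∷ m w _ ⟨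
    ∫ (Δ (m ∷ w)) (λ (p , y) → ∫ (Δ y) λ (q , z) → φ p q z) ∎

  open Coalgebra Δ Δ-coassoc Δ-cocomm public
    using () renaming (exchange to Δ-exchange)

  -- The indicator of degree 0 is the counit: only the term that moves every letter into the right
  -- factor survives.
  Δ-counitˡ : ∀ w (φ : Word → Word → Carrier) →
              ∫ (Δ w) (λ (r , s) → ⟦ degree r ℕ.≟ 0 ⟧ * φ r s) ≈ φ [] w
  Δ-counitˡ []      φ = trans (∫-η _ _) (*-identityˡ _)
  Δ-counitˡ (m ∷ w) φ = begin
    ∫ (Δ (m ∷ w)) (λ (r , s) → ⟦ degree r ℕ.≟ 0 ⟧ * φ r s)
      ≈⟨ trans (Δ-∷ m w _) (splits-suc m _) ⟩
    ∫ (Δ w) (λ (r , s) → ⟦ degree r ℕ.≟ 0 ⟧ * φ r (m ∷ s)) +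
    ∫ (splits m) (λ (a , b) → ∫ (Δ w) λ (r , s) → ⟦ degree (a ∷ r) ℕ.≟ 0 ⟧ * φ (a ∷ r) (b ▹ s))
      ≈⟨ +-cong (Δ-counitˡ w λ r s → φ r (m ∷ s))
           (trans (∫-cong (splits m) λ (a , b) → trans
              (∫-cong (Δ w) λ (r , s) → ⟦⟧-no (degree (a ∷ r) ℕ.≟ 0) λ ()) (∫-0 (Δ w)))
            (∫-0 (splits m))) ⟩
    φ [] (m ∷ w) + 0#
      ≈⟨ +-identityʳ _ ⟩
    φ [] (m ∷ w) ∎

  Δ-counitʳ : ∀ w (φ : Word → Word → Carrier) →
              ∫ (Δ w) (λ (r , s) → ⟦ degree s ℕ.≟ 0 ⟧ * φ r s) ≈ φ w []
  Δ-counitʳ w φ = trans (Δ-cocomm w λ r s → ⟦ degree s ℕ.≟ 0 ⟧ * φ r s) (Δ-counitˡ w λ r s → φ s r)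

  Δ-++ : ∀ u v (φ : Word → Word → Carrier) → ∫ (Δ (u ++ v)) (λ (r , s) → φ r s) ≈
         ∫ (Δ u) (λ (p , q) → ∫ (Δ v) λ (r , s) → φ (p ++ r) (q ++ s))
  Δ-++ []      v φ = sym (∫-η _ _)
  Δ-++ (m ∷ u) v φ = begin
    ∫ (Δ (m ∷ u ++ v)) (λ (r , s) → φ r s)
      ≈⟨ Δ-∷ m (u ++ v) _ ⟩
    ∫ (splits (suc m)) (λ (a , b) → ∫ (Δ (u ++ v)) λ (r , s) → φ (a ▹ r) (b ▹ s))
      ≈⟨ ∫-cong (splits (suc m)) (λ (a , b) → Δ-++ u v λ r s → φ (a ▹ r) (b ▹ s)) ⟩
    ∫ (splits (suc m)) (λ (a , b) → ∫ (Δ u) λ (p , q) → ∫ (Δ v) λ (r , s) → φ (a ▹ (p ++ r)) (b ▹ (q ++ s)))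
      ≈⟨ ∫-cong (splits (suc m)) (λ (a , b) → ∫-cong (Δ u) λ (p , q) → ∫-cong (Δ v) λ (r , s) →
           reflexive (≡.cong₂ φ (▹-++ a p r) (▹-++ b q s))) ⟨
    ∫ (splits (suc m)) (λ (a , b) → ∫ (Δ u) λ (p , q) → ∫ (Δ v) λ (r , s) → φ ((a ▹ p) ++ r) ((b ▹ q) ++ s))
      ≈⟨ Δ-∷ m u _ ⟨
    ∫ (Δ (m ∷ u)) (λ (p , q) → ∫ (Δ v) λ (r , s) → φ (p ++ r) (q ++ s)) ∎

  -- The internal product of words

  infixl 7 _⊛_

  -- The matrix sum, organised by rows: r is the first row, which takes a part of every column sum,
  -- s is what the rows u still have to fill, and the indicator imposes the first row sum.
  _⊛_ : Word → Word → K[ Word ]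
  []      ⊛ v = scale ⟦ degree v ℕ.≟ 0 ⟧ (η [])
  (i ∷ u) ⊛ v = Δ v >>= λ (r , s) → scale ⟦ degree r ℕ.≟ suc i ⟧ (u ⊛ s >>= λ w → η (r ++ w))

  ⊛-[] : ∀ v φ → ∫ ([] ⊛ v) φ ≈ ⟦ degree v ℕ.≟ 0 ⟧ * φ []
  ⊛-[] v φ = trans (∫-scale _ (η []) φ) (*-congˡ (∫-η _ φ))

  ⊛-∷ : ∀ i u v φ → ∫ ((i ∷ u) ⊛ v) φ ≈
        ∫ (Δ v) (λ (r , s) → ⟦ degree r ℕ.≟ suc i ⟧ * ∫ (u ⊛ s) λ w → φ (r ++ w))
  ⊛-∷ i u v φ = trans (∫->>= (Δ v) _ φ) (∫-cong (Δ v) λ (r , s) → trans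
    (∫-scale ⟦ degree r ℕ.≟ suc i ⟧ _ φ)
    (*-congˡ (trans (∫->>= (u ⊛ s) _ φ) (∫-cong (u ⊛ s) λ w → ∫-η _ φ))))

  ⊛-▹ : ∀ a u v φ → ∫ ((a ▹ u) ⊛ v) φ ≈
        ∫ (Δ v) (λ (r , s) → ⟦ degree r ℕ.≟ a ⟧ * ∫ (u ⊛ s) λ w → φ (r ++ w))
  ⊛-▹ zero    u v φ = sym (Δ-counitˡ v λ r s → ∫ (u ⊛ s) λ w → φ (r ++ w))
  ⊛-▹ (suc i) u v φ = ⊛-∷ i u v φ

  -- The product vanishes unless the two degrees agree, and then it lives in that common degree.
  ⊛-cong : ∀ u v {φ ψ} → (degree u ≡ degree v → ∀ w → degree w ≡ degree v → φ w ≈ ψ w) →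
           ∫ (u ⊛ v) φ ≈ ∫ (u ⊛ v) ψ
  ⊛-cong []      v {φ} {ψ} eq = begin
    ∫ ([] ⊛ v) φ                 ≈⟨ ⊛-[] v φ ⟩
    ⟦ degree v ℕ.≟ 0 ⟧ * φ []    ≈⟨ ⟦⟧-guard (degree v ℕ.≟ 0) (λ v≡0 → eq (≡.sym v≡0) [] (≡.sym v≡0)) ⟩
    ⟦ degree v ℕ.≟ 0 ⟧ * ψ []    ≈⟨ ⊛-[] v ψ ⟨
    ∫ ([] ⊛ v) ψ                 ∎
  ⊛-cong (i ∷ u) v {φ} {ψ} eq = begin
    ∫ ((i ∷ u) ⊛ v) φ
      ≈⟨ ⊛-∷ i u v φ ⟩
    ∫ (Δ v) (λ (r , s) → ⟦ degree r ℕ.≟ suc i ⟧ * ∫ (u ⊛ s) λ w → φ (r ++ w))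
      ≈⟨ Δ-cong v (λ r s r+s≡v → ⟦⟧-guard (degree r ℕ.≟ suc i) λ r≡1+i → ⊛-cong u s λ u≡s w w≡s →
           eq (≡.trans (≡.cong₂ ℕ._+_ (≡.sym r≡1+i) u≡s) r+s≡v) (r ++ w)
              (≡.trans (degree-++ r w) (≡.trans (≡.cong (degree r ℕ.+_) w≡s) r+s≡v))) ⟩
    ∫ (Δ v) (λ (r , s) → ⟦ degree r ℕ.≟ suc i ⟧ * ∫ (u ⊛ s) λ w → ψ (r ++ w))
      ≈⟨ ⊛-∷ i u v ψ ⟨
    ∫ ((i ∷ u) ⊛ v) ψ ∎

  -- The splitting formula: the rows of u and the rows of u′ share the column sums, and Δ v lists
  -- the ways to divide these between the two blocks.
  ⊛-++ : ∀ u u′ v φ → ∫ ((u ++ u′) ⊛ v) φ ≈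
         ∫ (Δ v) (λ (p , q) → ∫ (u ⊛ p) λ x → ∫ (u′ ⊛ q) λ y → φ (x ++ y))
  ⊛-++ []      u′ v φ = sym (trans
    (∫-cong (Δ v) λ (p , q) → ⊛-[] p λ x → ∫ (u′ ⊛ q) λ y → φ (x ++ y))
    (Δ-counitˡ v λ p q → ∫ (u′ ⊛ q) φ))
  ⊛-++ (i ∷ u) u′ v φ = begin
    ∫ ((i ∷ u ++ u′) ⊛ v) φ
      ≈⟨ ⊛-∷ i (u ++ u′) v φ ⟩
    ∫ (Δ v) (λ (r , s) → ⟦ degree r ℕ.≟ suc i ⟧ * ∫ ((u ++ u′) ⊛ s) λ w → φ (r ++ w))
      ≈⟨ ∫-cong (Δ v) (λ (r , s) → trans (*-congˡ (⊛-++ u u′ s λ w → φ (r ++ w))) (sym (∫-*ˡ (Δ s) _ _))) ⟩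
    ∫ (Δ v) (λ (r , s) → ∫ (Δ s) λ (p , q) →
      ⟦ degree r ℕ.≟ suc i ⟧ * ∫ (u ⊛ p) λ x → ∫ (u′ ⊛ q) λ y → φ (r ++ (x ++ y)))
      ≈⟨ Δ-coassoc v (λ r p q → ⟦ degree r ℕ.≟ suc i ⟧ * ∫ (u ⊛ p) λ x → ∫ (u′ ⊛ q) λ y → φ (r ++ (x ++ y))) ⟨
    ∫ (Δ v) (λ (z , q) → ∫ (Δ z) λ (r , p) →
      ⟦ degree r ℕ.≟ suc i ⟧ * ∫ (u ⊛ p) λ x → ∫ (u′ ⊛ q) λ y → φ (r ++ (x ++ y)))
      ≈⟨ ∫-cong (Δ v) (λ (z , q) → ∫-cong (Δ z) λ (r , p) → *-congˡ (∫-cong (u ⊛ p) λ x → ∫-cong (u′ ⊛ q) λ y →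
           reflexive (≡.cong φ (List.++-assoc r x y)))) ⟨
    ∫ (Δ v) (λ (z , q) → ∫ (Δ z) λ (r , p) →
      ⟦ degree r ℕ.≟ suc i ⟧ * ∫ (u ⊛ p) λ x → ∫ (u′ ⊛ q) λ y → φ ((r ++ x) ++ y))
      ≈⟨ ∫-cong (Δ v) (λ (z , q) → ⊛-∷ i u z λ x → ∫ (u′ ⊛ q) λ y → φ (x ++ y)) ⟨
    ∫ (Δ v) (λ (z , q) → ∫ ((i ∷ u) ⊛ z) λ x → ∫ (u′ ⊛ q) λ y → φ (x ++ y)) ∎

  splits-⟦⟧ : ∀ n x y → ∫ (splits n) (λ (a , b) → ⟦ x ℕ.≟ a ⟧ * ⟦ y ℕ.≟ b ⟧) ≈ ⟦ x ℕ.+ y ℕ.≟ n ⟧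
  splits-⟦⟧ zero    zero    y = trans (splits-0 _) (*-identityˡ _)
  splits-⟦⟧ zero    (suc x) y = trans (splits-0 _) (zeroˡ _)
  splits-⟦⟧ (suc n) zero    y = trans (splits-suc n _) (trans
    (+-cong (*-identityˡ _) (trans (∫-cong (splits n) λ _ → zeroˡ _) (∫-0 (splits n)))) (+-identityʳ _))
  splits-⟦⟧ (suc n) (suc x) y = trans (splits-suc n _) (trans
    (+-cong (zeroˡ _) (splits-⟦⟧ n x y)) (+-identityˡ _))

  -- Splitting every entry of a matrix writes it as a sum of two matrices, and thereby splits its
  -- row sums and its column sums at once.
  Δ-⊛ : ∀ u v φ → ∫ (u ⊛ v) (λ w → ∫ (Δ w) φ) ≈
        ∫ (Δ u) (λ (p , q) → ∫ (Δ v) λ (r , s) → ∫ (p ⊛ r) λ x → ∫ (q ⊛ s) λ y → φ (x , y))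
  Δ-⊛ []      v φ = begin
    ∫ ([] ⊛ v) (λ w → ∫ (Δ w) φ)
      ≈⟨ trans (⊛-[] v _) (*-congˡ (∫-η _ φ)) ⟩
    ⟦ degree v ℕ.≟ 0 ⟧ * φ ([] , [])
      ≈⟨ Δ-counitˡ v (λ _ s → ⟦ degree s ℕ.≟ 0 ⟧ * φ ([] , [])) ⟨
    ∫ (Δ v) (λ (r , s) → ⟦ degree r ℕ.≟ 0 ⟧ * (⟦ degree s ℕ.≟ 0 ⟧ * φ ([] , [])))
      ≈⟨ ∫-cong (Δ v) (λ (r , s) → trans (⊛-[] r _) (*-congˡ (⊛-[] s _))) ⟨
    ∫ (Δ v) (λ (r , s) → ∫ ([] ⊛ r) λ x → ∫ ([] ⊛ s) λ y → φ (x , y))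
      ≈⟨ ∫-η ([] , []) _ ⟨
    ∫ (Δ []) (λ (p , q) → ∫ (Δ v) λ (r , s) → ∫ (p ⊛ r) λ x → ∫ (q ⊛ s) λ y → φ (x , y)) ∎
  Δ-⊛ (i ∷ u) v φ = begin
    ∫ ((i ∷ u) ⊛ v) (λ w → ∫ (Δ w) φ)
      ≈⟨ ⊛-∷ i u v _ ⟩
    ∫ (Δ v) (λ (r , s) → ⟦ degree r ℕ.≟ suc i ⟧ * ∫ (u ⊛ s) λ w → ∫ (Δ (r ++ w)) φ)
      ≈⟨ ∫-cong (Δ v) (λ (r , s) → *-congˡ (begin
         ∫ (u ⊛ s) (λ w → ∫ (Δ (r ++ w)) φ)
           ≈⟨ ∫-cong (u ⊛ s) (λ w → Δ-++ r w λ x y → φ (x , y)) ⟩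
         ∫ (u ⊛ s) (λ w → ∫ (Δ r) λ (r₁ , r₂) → ∫ (Δ w) λ (x , y) → φ (r₁ ++ x , r₂ ++ y))
           ≈⟨ ∫-swap (u ⊛ s) (Δ r) _ ⟩
         ∫ (Δ r) (λ (r₁ , r₂) → ∫ (u ⊛ s) λ w → ∫ (Δ w) λ (x , y) → φ (r₁ ++ x , r₂ ++ y))
           ≈⟨ ∫-cong (Δ r) (λ (r₁ , r₂) → Δ-⊛ u s λ (x , y) → φ (r₁ ++ x , r₂ ++ y)) ⟩
         ∫ (Δ r) (λ (r₁ , r₂) → ∫ (Δ u) λ (p , q) → ∫ (Δ s) λ (s₁ , s₂) → Ψ p q r₁ r₂ s₁ s₂)
           ≈⟨ ∫-swap (Δ r) (Δ u) _ ⟩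
         ∫ (Δ u) (λ (p , q) → ∫ (Δ r) λ (r₁ , r₂) → ∫ (Δ s) λ (s₁ , s₂) → Ψ p q r₁ r₂ s₁ s₂) ∎)) ⟩
    ∫ (Δ v) (λ (r , s) → ⟦ degree r ℕ.≟ suc i ⟧ *
      ∫ (Δ u) λ (p , q) → ∫ (Δ r) λ (r₁ , r₂) → ∫ (Δ s) λ (s₁ , s₂) → Ψ p q r₁ r₂ s₁ s₂)
      ≈⟨ trans (∫-cong (Δ v) λ (r , s) → sym (∫-*ˡ (Δ u) _ _)) (∫-swap (Δ v) (Δ u) _) ⟩
    ∫ (Δ u) (λ (p , q) → ∫ (Δ v) λ (r , s) → ⟦ degree r ℕ.≟ suc i ⟧ *
      ∫ (Δ r) λ (r₁ , r₂) → ∫ (Δ s) λ (s₁ , s₂) → Ψ p q r₁ r₂ s₁ s₂)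
      ≈⟨ ∫-cong (Δ u) (λ (p , q) → ∫-cong (Δ v) λ (r , s) → trans
           (sym (trans (∫-cong (Δ r) λ (r₁ , r₂) → ∫-*ˡ (Δ s) _ _) (∫-*ˡ (Δ r) _ _)))
           (Δ-cong r λ r₁ r₂ r₁+r₂≡r → ∫-cong (Δ s) λ (s₁ , s₂) →
             *-congʳ (reflexive (≡.cong (λ d → ⟦ d ℕ.≟ suc i ⟧) (≡.sym r₁+r₂≡r))))) ⟩
    ∫ (Δ u) (λ (p , q) → ∫ (Δ v) λ (r , s) → ∫ (Δ r) λ (r₁ , r₂) → ∫ (Δ s) λ (s₁ , s₂) →
      ⟦ degree r₁ ℕ.+ degree r₂ ℕ.≟ suc i ⟧ * Ψ p q r₁ r₂ s₁ s₂)
      ≈⟨ ∫-cong (Δ u) (λ (p , q) → Δ-exchange v λ r₁ s₁ r₂ s₂ →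
           ⟦ degree r₁ ℕ.+ degree r₂ ℕ.≟ suc i ⟧ * Ψ p q r₁ r₂ s₁ s₂) ⟨
    ∫ (Δ u) (λ (p , q) → ∫ (Δ v) λ (r , s) → ∫ (Δ r) λ (r₁ , s₁) → ∫ (Δ s) λ (r₂ , s₂) →
      ⟦ degree r₁ ℕ.+ degree r₂ ℕ.≟ suc i ⟧ * Ψ p q r₁ r₂ s₁ s₂)
      -- The condition on the total degree of r₁ and r₂ is expanded over the splittings (a , b) of
      -- `suc i`. These become the first parts of the two factors of Δ (i ∷ u).
      ≈⟨ ∫-cong (Δ u) (λ (p , q) → ∫-cong (Δ v) λ (r , s) → ∫-cong (Δ r) λ (r₁ , s₁) → ∫-cong (Δ s) λ (r₂ , s₂) →
           trans (∫-*ʳ (splits (suc i)) _ _) (*-congʳ (splits-⟦⟧ (suc i) (degree r₁) (degree r₂)))) ⟨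
    ∫ (Δ u) (λ (p , q) → ∫ (Δ v) λ (r , s) → ∫ (Δ r) λ (r₁ , s₁) → ∫ (Δ s) λ (r₂ , s₂) →
      ∫ (splits (suc i)) λ (a , b) →
      (⟦ degree r₁ ℕ.≟ a ⟧ * ⟦ degree r₂ ℕ.≟ b ⟧) * Ψ p q r₁ r₂ s₁ s₂)
      ≈⟨ trans (∫-swap (splits (suc i)) (Δ u) _) (∫-cong (Δ u) λ (p , q) →
         trans (∫-swap (splits (suc i)) (Δ v) _) (∫-cong (Δ v) λ (r , s) →
         trans (∫-swap (splits (suc i)) (Δ r) _) (∫-cong (Δ r) λ (r₁ , s₁) →
         ∫-swap (splits (suc i)) (Δ s) _))) ⟨
    ∫ (splits (suc i)) (λ (a , b) → ∫ (Δ u) λ (p , q) → ∫ (Δ v) λ (r , s) →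
      ∫ (Δ r) λ (r₁ , s₁) → ∫ (Δ s) λ (r₂ , s₂) →
      (⟦ degree r₁ ℕ.≟ a ⟧ * ⟦ degree r₂ ℕ.≟ b ⟧) * Ψ p q r₁ r₂ s₁ s₂)
      ≈⟨ ∫-cong (splits (suc i)) (λ (a , b) → ∫-cong (Δ u) λ (p , q) → ∫-cong (Δ v) λ (r , s) →
           trans (⊛-▹ a p r _) (∫-cong (Δ r) λ (r₁ , s₁) → begin
           ⟦ degree r₁ ℕ.≟ a ⟧ * ∫ (p ⊛ s₁) (λ x → ∫ ((b ▹ q) ⊛ s) λ y → φ (r₁ ++ x , y))
             ≈⟨ *-congˡ (trans (∫-cong (p ⊛ s₁) λ x → ⊛-▹ b q s _) (∫-swap (p ⊛ s₁) (Δ s) _)) ⟩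
           ⟦ degree r₁ ℕ.≟ a ⟧ * ∫ (Δ s) (λ (r₂ , s₂) → ∫ (p ⊛ s₁) λ x →
             ⟦ degree r₂ ℕ.≟ b ⟧ * ∫ (q ⊛ s₂) λ y → φ (r₁ ++ x , r₂ ++ y))
             ≈⟨ ∫-*ˡ (Δ s) _ _ ⟨
           ∫ (Δ s) (λ (r₂ , s₂) → ⟦ degree r₁ ℕ.≟ a ⟧ * ∫ (p ⊛ s₁) λ x →
             ⟦ degree r₂ ℕ.≟ b ⟧ * ∫ (q ⊛ s₂) λ y → φ (r₁ ++ x , r₂ ++ y))
             ≈⟨ ∫-cong (Δ s) (λ (r₂ , s₂) → trans (*-congˡ (∫-*ˡ (p ⊛ s₁) _ _)) (sym (*-assoc _ _ _))) ⟩
           ∫ (Δ s) (λ (r₂ , s₂) → (⟦ degree r₁ ℕ.≟ a ⟧ * ⟦ degree r₂ ℕ.≟ b ⟧) * Ψ p q r₁ r₂ s₁ s₂) ∎)) ⟨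
    ∫ (splits (suc i)) (λ (a , b) → ∫ (Δ u) λ (p , q) → ∫ (Δ v) λ (r , s) →
      ∫ ((a ▹ p) ⊛ r) λ x → ∫ ((b ▹ q) ⊛ s) λ y → φ (x , y))
      ≈⟨ Δ-∷ i u _ ⟨
    ∫ (Δ (i ∷ u)) (λ (p , q) → ∫ (Δ v) λ (r , s) → ∫ (p ⊛ r) λ x → ∫ (q ⊛ s) λ y → φ (x , y)) ∎
    where
    Ψ : Word → Word → Word → Word → Word → Word → Carrier
    Ψ p q r₁ r₂ s₁ s₂ = ∫ (p ⊛ s₁) λ x → ∫ (q ⊛ s₂) λ y → φ (r₁ ++ x , r₂ ++ y)

  -- Induction on the rows of u: `⊛-++` splits w on one side, and `Δ-⊛` recombines the pieces on the
  -- other.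
  ⊛-assoc : ∀ u v w φ → ∫ (u ⊛ v) (λ x → ∫ (x ⊛ w) φ) ≈ ∫ (v ⊛ w) (λ y → ∫ (u ⊛ y) φ)
  ⊛-assoc []      v w φ = begin
    ∫ ([] ⊛ v) (λ x → ∫ (x ⊛ w) φ)
      ≈⟨ ⊛-[] v _ ⟩
    ⟦ degree v ℕ.≟ 0 ⟧ * ∫ ([] ⊛ w) φ
      ≈⟨ ⟦⟧-guard (degree v ℕ.≟ 0) (λ v≡0 → trans (⊛-[] w φ)
           (sym (trans (reflexive (≡.cong (λ v → ∫ (v ⊛ w) λ _ → φ []) (degree≡0 {v} v≡0))) (⊛-[] w _)))) ⟩
    ⟦ degree v ℕ.≟ 0 ⟧ * ∫ (v ⊛ w) (λ y → φ [])
      ≈⟨ ∫-*ˡ (v ⊛ w) _ _ ⟨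
    ∫ (v ⊛ w) (λ y → ⟦ degree v ℕ.≟ 0 ⟧ * φ [])
      ≈⟨ ⊛-cong v w (λ v≡w y y≡w → trans (⊛-[] y φ)
           (*-congʳ (reflexive (≡.cong (λ d → ⟦ d ℕ.≟ 0 ⟧) (≡.trans y≡w (≡.sym v≡w)))))) ⟨
    ∫ (v ⊛ w) (λ y → ∫ ([] ⊛ y) φ) ∎
  ⊛-assoc (i ∷ u) v w φ = begin
    ∫ ((i ∷ u) ⊛ v) (λ x → ∫ (x ⊛ w) φ)
      ≈⟨ ⊛-∷ i u v _ ⟩
    ∫ (Δ v) (λ (r , s) → ⟦ degree r ℕ.≟ suc i ⟧ * ∫ (u ⊛ s) λ x → ∫ ((r ++ x) ⊛ w) φ)
      ≈⟨ ∫-cong (Δ v) (λ (r , s) → *-congˡ (begin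
         ∫ (u ⊛ s) (λ x → ∫ ((r ++ x) ⊛ w) φ)
           ≈⟨ trans (∫-cong (u ⊛ s) λ x → ⊛-++ r x w φ) (∫-swap (u ⊛ s) (Δ w) _) ⟩
         ∫ (Δ w) (λ (w₁ , w₂) → ∫ (u ⊛ s) λ x → ∫ (r ⊛ w₁) λ p → ∫ (x ⊛ w₂) λ q → φ (p ++ q))
           ≈⟨ ∫-cong (Δ w) (λ (w₁ , w₂) → trans (∫-swap (u ⊛ s) (r ⊛ w₁) _)
                (∫-cong (r ⊛ w₁) λ p → ⊛-assoc u s w₂ λ q → φ (p ++ q))) ⟩
         ∫ (Δ w) (λ (w₁ , w₂) → ∫ (r ⊛ w₁) λ p → ∫ (s ⊛ w₂) λ y → ∫ (u ⊛ y) λ q → φ (p ++ q)) ∎)) ⟩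
    ∫ (Δ v) (λ (r , s) → ⟦ degree r ℕ.≟ suc i ⟧ *
      ∫ (Δ w) λ (w₁ , w₂) → ∫ (r ⊛ w₁) λ p → ∫ (s ⊛ w₂) λ y → ∫ (u ⊛ y) λ q → φ (p ++ q))
      -- Words in r ⊛ w₁ have the degree of r, so the row-sum condition can be tested on p. It then
      -- depends on the products alone, as `Δ-⊛` requires.
      ≈⟨ ∫-cong (Δ v) (λ (r , s) → trans
           (sym (∫-*ˡ (Δ w) _ _)) (∫-cong (Δ w) λ (w₁ , w₂) → trans
           (sym (∫-*ˡ (r ⊛ w₁) _ _)) (⊛-cong r w₁ λ r≡w₁ p p≡w₁ → trans
           (*-congʳ (reflexive (≡.cong (λ d → ⟦ d ℕ.≟ suc i ⟧) (≡.trans r≡w₁ (≡.sym p≡w₁)))))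
           (sym (∫-*ˡ (s ⊛ w₂) _ _))))) ⟩
    ∫ (Δ v) (λ (r , s) → ∫ (Δ w) λ (w₁ , w₂) → ∫ (r ⊛ w₁) λ p → ∫ (s ⊛ w₂) λ y →
      ⟦ degree p ℕ.≟ suc i ⟧ * ∫ (u ⊛ y) λ q → φ (p ++ q))
      ≈⟨ Δ-⊛ v w _ ⟨
    ∫ (v ⊛ w) (λ y → ∫ (Δ y) λ (p , y′) → ⟦ degree p ℕ.≟ suc i ⟧ * ∫ (u ⊛ y′) λ q → φ (p ++ q))
      ≈⟨ ∫-cong (v ⊛ w) (λ y → ⊛-∷ i u y φ) ⟨
    ∫ (v ⊛ w) (λ y → ∫ ((i ∷ u) ⊛ y) φ) ∎

  -- The derivation S₍ₘ₊₁₎ ↦ Sₘ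

  ∂ʷ : Word → K[ Word ]
  ∂ʷ []      = []
  ∂ʷ (m ∷ w) = (1# , m ▹ w) ∷ List.map (λ (a , u) → 1# * a , m ∷ u) (∂ʷ w)

  ∂ʷ-∷ : ∀ m w φ → ∫ (∂ʷ (m ∷ w)) φ ≈ φ (m ▹ w) + ∫ (∂ʷ w) (λ u → φ (m ∷ u))
  ∂ʷ-∷ m w φ = trans (∫-∷ 1# (m ▹ w) _ φ)
    (+-cong (*-identityˡ _) (trans (∫-map 1# (m ∷_) (∂ʷ w) φ) (*-identityˡ _)))

  ∂ʷ-++ : ∀ u v φ → ∫ (∂ʷ (u ++ v)) φ ≈ ∫ (∂ʷ u) (λ x → φ (x ++ v)) + ∫ (∂ʷ v) (λ y → φ (u ++ y))
  ∂ʷ-++ []      v φ = sym (trans (+-congʳ (∫-[] _)) (+-identityˡ _))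
  ∂ʷ-++ (m ∷ u) v φ = begin
    ∫ (∂ʷ (m ∷ u ++ v)) φ
      ≈⟨ ∂ʷ-∷ m (u ++ v) φ ⟩
    φ (m ▹ (u ++ v)) + ∫ (∂ʷ (u ++ v)) (λ x → φ (m ∷ x))
      ≈⟨ +-cong (reflexive (≡.cong φ (≡.sym (▹-++ m u v)))) (∂ʷ-++ u v λ x → φ (m ∷ x)) ⟩
    φ ((m ▹ u) ++ v) + (∫ (∂ʷ u) (λ x → φ (m ∷ x ++ v)) + ∫ (∂ʷ v) (λ y → φ (m ∷ u ++ y)))
      ≈⟨ +-assoc _ _ _ ⟨
    φ ((m ▹ u) ++ v) + ∫ (∂ʷ u) (λ x → φ (m ∷ x ++ v)) + ∫ (∂ʷ v) (λ y → φ (m ∷ u ++ y))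
      ≈⟨ +-congʳ (∂ʷ-∷ m u λ x → φ (x ++ v)) ⟨
    ∫ (∂ʷ (m ∷ u)) (λ x → φ (x ++ v)) + ∫ (∂ʷ v) (λ y → φ (m ∷ u ++ y)) ∎

  -- The only word of degree 1 is `0 ∷ []`, so the part of Δ with left degree 1 is S₁ ⊗ ∂. This
  -- links internal products by S₁ with the derivation.
  Δ-∂ʷ : ∀ w (φ : Word → Word → Carrier) →
         ∫ (Δ w) (λ (r , s) → ⟦ degree r ℕ.≟ 1 ⟧ * φ r s) ≈ ∫ (∂ʷ w) (φ (0 ∷ []))
  Δ-∂ʷ []      φ = trans (∫-η _ _) (trans (zeroˡ _) (sym (∫-[] _)))
  Δ-∂ʷ (m ∷ w) φ = begin
    ∫ (Δ (m ∷ w)) (λ (r , s) → ⟦ degree r ℕ.≟ 1 ⟧ * φ r s)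
      ≈⟨ trans (Δ-∷ m w _) (splits-suc m _) ⟩
    ∫ (Δ w) (λ (r , s) → ⟦ degree r ℕ.≟ 1 ⟧ * φ r (m ∷ s)) +
    ∫ (splits m) (λ (a , b) → ∫ (Δ w) λ (r , s) → ⟦ a ℕ.+ degree r ℕ.≟ 0 ⟧ * φ (a ∷ r) (b ▹ s))
      ≈⟨ +-cong (Δ-∂ʷ w λ r s → φ r (m ∷ s)) (rest m) ⟩
    ∫ (∂ʷ w) (λ s → φ (0 ∷ []) (m ∷ s)) + φ (0 ∷ []) (m ▹ w)
      ≈⟨ +-comm _ _ ⟩
    φ (0 ∷ []) (m ▹ w) + ∫ (∂ʷ w) (λ s → φ (0 ∷ []) (m ∷ s))
      ≈⟨ ∂ʷ-∷ m w _ ⟨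
    ∫ (∂ʷ (m ∷ w)) (φ (0 ∷ [])) ∎
    where
    rest : ∀ m → ∫ (splits m) (λ (a , b) → ∫ (Δ w) λ (r , s) → ⟦ a ℕ.+ degree r ℕ.≟ 0 ⟧ * φ (a ∷ r) (b ▹ s))
                 ≈ φ (0 ∷ []) (m ▹ w)
    rest zero    = trans (splits-0 _) (Δ-counitˡ w λ r s → φ (0 ∷ r) s)
    rest (suc m) = trans (splits-suc m _) (trans
      (+-cong (Δ-counitˡ w λ r s → φ (0 ∷ r) (m ∷ s))
        (trans (∫-cong (splits m) λ (a , b) → trans (∫-cong (Δ w) λ _ → zeroˡ _) (∫-0 (Δ w))) (∫-0 (splits m))))
      (+-identityʳ _))

  -- Reading ∂ʷ as a component of Δ lets `Δ-cong` do the degree bookkeeping.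
  ∂ʷ-cong : ∀ w {φ ψ} → (∀ u → suc (degree u) ≡ degree w → φ u ≈ ψ u) → ∫ (∂ʷ w) φ ≈ ∫ (∂ʷ w) ψ
  ∂ʷ-cong w {φ} {ψ} eq = begin
    ∫ (∂ʷ w) φ                                            ≈⟨ Δ-∂ʷ w (λ _ s → φ s) ⟨
    ∫ (Δ w) (λ (r , s) → ⟦ degree r ℕ.≟ 1 ⟧ * φ s)        ≈⟨ Δ-cong w (λ r s r+s≡w → ⟦⟧-guard (degree r ℕ.≟ 1) λ r≡1 →
                                                               eq s (≡.trans (≡.cong (ℕ._+ degree s) (≡.sym r≡1)) r+s≡w)) ⟩
    ∫ (Δ w) (λ (r , s) → ⟦ degree r ℕ.≟ 1 ⟧ * ψ s)        ≈⟨ Δ-∂ʷ w (λ _ s → ψ s) ⟩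
    ∫ (∂ʷ w) ψ                                            ∎

  -- Group-like sequences

  -- Homogeneity in terms of test functions passes through sums and products by plain congruence,
  -- with no need to track cancelling coefficients.
  Homogeneous : ℕ → K[ Word ] → Set (c ⊔ ℓ)
  Homogeneous n F = ∀ {φ ψ} → (∀ w → degree w ≡ n → φ w ≈ ψ w) → ∫ F φ ≈ ∫ F ψ

  -- Expresses that the series Σ γ n is group-like for Δ, with γ n as its component of degree n.
  record GroupLike (γ : ℕ → K[ Word ]) : Set (c ⊔ ℓ) where
    field
      unit        : ∀ φ → ∫ (γ 0) φ ≈ φ []
      homogeneous : ∀ n → Homogeneous n (γ n)
      coproduct   : ∀ n (φ : Word → Word → Carrier) →
                    ∫ (γ n) (λ w → ∫ (Δ w) λ (x , y) → φ x y) ≈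
                    ∫ (splits n) (λ (a , b) → ∫ (γ a) λ x → ∫ (γ b) λ y → φ x y)

  GroupLike-resp : ∀ {γ δ} → (∀ n φ → ∫ (γ n) φ ≈ ∫ (δ n) φ) → GroupLike γ → GroupLike δ
  GroupLike-resp {γ} {δ} γ≈δ gl = record
    { unit        = λ φ → trans (sym (γ≈δ 0 φ)) (unit φ)
    ; homogeneous = λ n eq → trans (sym (γ≈δ n _)) (trans (homogeneous n eq) (γ≈δ n _))
    ; coproduct   = λ n φ → trans (sym (γ≈δ n _)) (trans (coproduct n φ)
        (∫-cong (splits n) λ (a , b) → trans (∫-cong (γ a) λ x → γ≈δ b _) (γ≈δ a _)))
    }
    where open GroupLike gl

  -- The image of a word under the algebra morphism S₍ₘ₊₁₎ ↦ γ₍ₘ₊₁₎.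
  eval : (ℕ → K[ Word ]) → Word → K[ Word ]
  eval γ []      = η []
  eval γ (m ∷ w) = γ (suc m) >>= λ x → eval γ w >>= λ y → η (x ++ y)

  eval-∷ : ∀ γ m w φ → ∫ (eval γ (m ∷ w)) φ ≈ ∫ (γ (suc m)) (λ x → ∫ (eval γ w) λ y → φ (x ++ y))
  eval-∷ γ m w φ = trans (∫->>= (γ (suc m)) _ φ) (∫-cong (γ (suc m)) λ x →
    trans (∫->>= (eval γ w) _ φ) (∫-cong (eval γ w) λ y → ∫-η _ φ))

  eval-▹ : ∀ {γ} → GroupLike γ → ∀ a w φ →
           ∫ (eval γ (a ▹ w)) φ ≈ ∫ (γ a) (λ x → ∫ (eval γ w) λ y → φ (x ++ y))
  eval-▹     gl zero    w φ = sym (GroupLike.unit gl _)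
  eval-▹ {γ} gl (suc m) w φ = eval-∷ γ m w φ

  -- Right multiplication by a group-like sequence is multiplicative, since
  -- S^u ⊛ - distributes over the coproduct.
  ⊛-groupLike : ∀ {γ} → GroupLike γ → ∀ u n φ →
                ∫ (γ n) (λ v → ∫ (u ⊛ v) φ) ≈ ⟦ degree u ℕ.≟ n ⟧ * ∫ (eval γ u) φ
  ⊛-groupLike gl [] zero    φ = trans (GroupLike.unit gl _) (trans (⊛-[] [] φ) (*-congˡ (sym (∫-η [] φ))))
  ⊛-groupLike {γ} gl [] (suc n) φ = begin
    ∫ (γ (suc n)) (λ v → ∫ ([] ⊛ v) φ)
      ≈⟨ GroupLike.homogeneous gl (suc n) (λ v v≡1+n → trans (⊛-[] v φ)
           (⟦⟧-no (degree v ℕ.≟ 0) λ v≡0 → ℕ.1+n≢0 (≡.trans (≡.sym v≡1+n) v≡0))) ⟩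
    ∫ (γ (suc n)) (λ _ → 0#)
      ≈⟨ ∫-0 (γ (suc n)) ⟩
    0#
      ≈⟨ zeroˡ _ ⟨
    0# * ∫ (η []) φ ∎
  ⊛-groupLike {γ} gl (i ∷ u) n φ = begin
    ∫ (γ n) (λ v → ∫ ((i ∷ u) ⊛ v) φ)
      ≈⟨ ∫-cong (γ n) (λ v → ⊛-∷ i u v φ) ⟩
    ∫ (γ n) (λ v → ∫ (Δ v) λ (r , s) → ⟦ degree r ℕ.≟ suc i ⟧ * ∫ (u ⊛ s) λ w → φ (r ++ w))
      ≈⟨ coproduct n _ ⟩
    ∫ (splits n) (λ (a , b) → ∫ (γ a) λ r → ∫ (γ b) λ s →
      ⟦ degree r ℕ.≟ suc i ⟧ * ∫ (u ⊛ s) λ w → φ (r ++ w))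
      ≈⟨ ∫-cong (splits n) (λ (a , b) → trans
           (homogeneous a λ r r≡a → trans (∫-*ˡ (γ b) _ _) (trans
             (*-cong (⟦⟧-cong (degree r ℕ.≟ suc i) (suc i ℕ.≟ a)
                        (λ r≡1+i → ≡.trans (≡.sym r≡1+i) r≡a) (λ 1+i≡a → ≡.trans r≡a (≡.sym 1+i≡a)))
                     (⊛-groupLike gl u b λ w → φ (r ++ w)))
             (sym (*-assoc _ _ _))))
           (trans (∫-*ˡ (γ a) _ _) (*-assoc _ _ _))) ⟩
    ∫ (splits n) (λ (a , b) → ⟦ suc i ℕ.≟ a ⟧ * (⟦ degree u ℕ.≟ b ⟧ * T a))
      -- Under its indicator, T a equals the constant T (suc i). The remaining sum over splittings
      -- only tests whether `suc i` and the degree of u add up to n.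
      ≈⟨ ∫-cong (splits n) (λ (a , b) → trans
           (⟦⟧-guard (suc i ℕ.≟ a) λ 1+i≡a → *-congˡ (reflexive (≡.cong T (≡.sym 1+i≡a)))) (sym (*-assoc _ _ _))) ⟩
    ∫ (splits n) (λ (a , b) → (⟦ suc i ℕ.≟ a ⟧ * ⟦ degree u ℕ.≟ b ⟧) * T (suc i))
      ≈⟨ trans (∫-*ʳ (splits n) _ _) (*-congʳ (splits-⟦⟧ n (suc i) (degree u))) ⟩
    ⟦ degree (i ∷ u) ℕ.≟ n ⟧ * T (suc i)
      ≈⟨ *-congˡ (eval-∷ γ i u φ) ⟨
    ⟦ degree (i ∷ u) ℕ.≟ n ⟧ * ∫ (eval γ (i ∷ u)) φ ∎
    where
    open GroupLike gl
    T : ℕ → Carrier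
    T a = ∫ (γ a) λ r → ∫ (eval γ u) λ w → φ (r ++ w)

  letter : ℕ → K[ Word ]
  letter n = η (n ▹ [])

  letter-groupLike : GroupLike letter
  letter-groupLike = record
    { unit        = λ φ → ∫-η [] φ
    ; homogeneous = λ n {φ} {ψ} eq → trans (∫-η _ φ) (trans
        (eq (n ▹ []) (≡.trans (degree-▹ n []) (ℕ.+-identityʳ n))) (sym (∫-η _ ψ)))
    ; coproduct   = λ n φ → trans (∫-η (n ▹ []) _) (trans (Δ-▹ n [] _) (∫-cong (splits n) λ (a , b) →
        trans (∫-η ([] , []) _) (sym (trans (∫-η (a ▹ []) _) (∫-η (b ▹ []) _)))))
    }

  convolve : (γ δ : ℕ → K[ Word ]) → ℕ → K[ Word ]
  convolve γ δ n = splits n >>= λ (a , b) → γ a >>= λ x → δ b >>= λ y → η (x ++ y)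

  ∫-convolve : ∀ γ δ n φ → ∫ (convolve γ δ n) φ ≈
               ∫ (splits n) (λ (a , b) → ∫ (γ a) λ x → ∫ (δ b) λ y → φ (x ++ y))
  ∫-convolve γ δ n φ = trans (∫->>= (splits n) _ φ) (∫-cong (splits n) λ (a , b) →
    trans (∫->>= (γ a) _ φ) (∫-cong (γ a) λ x → trans (∫->>= (δ b) _ φ) (∫-cong (δ b) λ y → ∫-η _ φ)))

  -- A product of group-like series is group-like because Δ is multiplicative (`Δ-++`);
  -- `splits-exchange` regroups the four indices into two convolutions.
  convolve-groupLike : ∀ {γ δ} → GroupLike γ → GroupLike δ → GroupLike (convolve γ δ)
  convolve-groupLike {γ} {δ} glγ glδ = record
    { unit        = λ φ → trans (∫-convolve γ δ 0 φ) (trans (splits-0 _) (trans (γ-gl.unit _) (δ-gl.unit _)))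
    ; homogeneous = λ n {φ} {ψ} eq → trans (∫-convolve γ δ n φ) (trans
        (splits-cong n λ a b a+b≡n → γ-gl.homogeneous a λ x x≡a → δ-gl.homogeneous b λ y y≡b →
          eq (x ++ y) (≡.trans (degree-++ x y) (≡.trans (≡.cong₂ ℕ._+_ x≡a y≡b) a+b≡n)))
        (sym (∫-convolve γ δ n ψ)))
    ; coproduct   = coproduct
    }
    where
    module γ-gl = GroupLike glγ
    module δ-gl = GroupLike glδ
    coproduct : ∀ n (φ : Word → Word → Carrier) →
      ∫ (convolve γ δ n) (λ w → ∫ (Δ w) λ (x , y) → φ x y) ≈
      ∫ (splits n) (λ (a , b) → ∫ (convolve γ δ a) λ x → ∫ (convolve γ δ b) λ y → φ x y)
    coproduct n φ = begin
      ∫ (convolve γ δ n) (λ w → ∫ (Δ w) λ (x , y) → φ x y)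
        ≈⟨ ∫-convolve γ δ n _ ⟩
      ∫ (splits n) (λ (a , b) → ∫ (γ a) λ x → ∫ (δ b) λ y → ∫ (Δ (x ++ y)) λ (z , w) → φ z w)
        ≈⟨ ∫-cong (splits n) (λ (a , b) → begin
           ∫ (γ a) (λ x → ∫ (δ b) λ y → ∫ (Δ (x ++ y)) λ (z , w) → φ z w)
             ≈⟨ ∫-cong (γ a) (λ x → trans (∫-cong (δ b) λ y → Δ-++ x y φ) (∫-swap (δ b) (Δ x) _)) ⟩
           ∫ (γ a) (λ x → ∫ (Δ x) λ (p , q) → ∫ (δ b) λ y → ∫ (Δ y) λ (r , s) → φ (p ++ r) (q ++ s))
             ≈⟨ γ-gl.coproduct a _ ⟩
           ∫ (splits a) (λ (a₁ , a₂) → ∫ (γ a₁) λ p → ∫ (γ a₂) λ q →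
             ∫ (δ b) λ y → ∫ (Δ y) λ (r , s) → φ (p ++ r) (q ++ s))
             ≈⟨ ∫-cong (splits a) (λ (a₁ , a₂) → trans
                  (∫-cong (γ a₁) λ p → trans (∫-cong (γ a₂) λ q → δ-gl.coproduct b _) (∫-swap (γ a₂) (splits b) _))
                  (∫-swap (γ a₁) (splits b) _)) ⟩
           ∫ (splits a) (λ (a₁ , a₂) → ∫ (splits b) λ (b₁ , b₂) → Ψ a₁ a₂ b₁ b₂) ∎) ⟩
      ∫ (splits n) (λ (a , b) → ∫ (splits a) λ (a₁ , a₂) → ∫ (splits b) λ (b₁ , b₂) → Ψ a₁ a₂ b₁ b₂)
        ≈⟨ splits-exchange n Ψ ⟩
      ∫ (splits n) (λ (a , b) → ∫ (splits a) λ (a₁ , b₁) → ∫ (splits b) λ (a₂ , b₂) → Ψ a₁ a₂ b₁ b₂)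
        ≈⟨ ∫-cong (splits n) (λ (a , b) → trans (∫-convolve γ δ a _)
             (∫-cong (splits a) λ (a₁ , b₁) → begin
               ∫ (γ a₁) (λ p → ∫ (δ b₁) λ r → ∫ (convolve γ δ b) λ w → φ (p ++ r) w)
                 ≈⟨ trans (∫-cong (γ a₁) λ p → trans (∫-cong (δ b₁) λ r → ∫-convolve γ δ b _)
                      (∫-swap (δ b₁) (splits b) _)) (∫-swap (γ a₁) (splits b) _) ⟩
               ∫ (splits b) (λ (a₂ , b₂) → ∫ (γ a₁) λ p → ∫ (δ b₁) λ r → ∫ (γ a₂) λ q → ∫ (δ b₂) λ s → φ (p ++ r) (q ++ s))
                 ≈⟨ ∫-cong (splits b) (λ (a₂ , b₂) → ∫-cong (γ a₁) λ p → ∫-swap (δ b₁) (γ a₂) _) ⟩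
               ∫ (splits b) (λ (a₂ , b₂) → Ψ a₁ a₂ b₁ b₂) ∎)) ⟨
      ∫ (splits n) (λ (a , b) → ∫ (convolve γ δ a) λ x → ∫ (convolve γ δ b) λ y → φ x y) ∎
      where
      Ψ : ℕ → ℕ → ℕ → ℕ → Carrier
      Ψ a₁ a₂ b₁ b₂ = ∫ (γ a₁) λ p → ∫ (γ a₂) λ q → ∫ (δ b₁) λ r → ∫ (δ b₂) λ s → φ (p ++ r) (q ++ s)

  -- Divided powers of S₁

  fromℕ : ℕ → Carrier
  fromℕ n = n ×′ 1#

  fromℕ-+ : ∀ m n → fromℕ (m ℕ.+ n) ≈ fromℕ m + fromℕ n
  fromℕ-+ zero    n = sym (+-identityˡ _)
  fromℕ-+ (suc m) n = trans (+-congˡ (fromℕ-+ m n)) (sym (+-assoc _ _ _))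

  -- Leibniz' rule for the derivation of K[x, y] that lowers degrees by 1.
  splits-leibniz : ∀ n (g : ℕ → ℕ → Carrier) →
    fromℕ (suc n) * ∫ (splits (suc n)) (λ (a , b) → g a b) ≈
    ∫ (splits n) (λ (a , b) → fromℕ (suc a) * g (suc a) b) +
    ∫ (splits n) (λ (a , b) → fromℕ (suc b) * g a (suc b))
  splits-leibniz n g = begin
    fromℕ (suc n) * ∫ (splits (suc n)) (λ (a , b) → g a b)
      ≈⟨ ∫-*ˡ (splits (suc n)) _ _ ⟨
    ∫ (splits (suc n)) (λ (a , b) → fromℕ (suc n) * g a b)
      ≈⟨ splits-cong (suc n) (λ a b a+b≡1+n → trans
           (*-congʳ (trans (reflexive (≡.cong fromℕ (≡.sym a+b≡1+n))) (fromℕ-+ a b))) (distribʳ _ _ _)) ⟩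
    ∫ (splits (suc n)) (λ (a , b) → fromℕ a * g a b + fromℕ b * g a b)
      ≈⟨ ∫-+ (splits (suc n)) _ _ ⟩
    ∫ (splits (suc n)) (λ (a , b) → fromℕ a * g a b) + ∫ (splits (suc n)) (λ (a , b) → fromℕ b * g a b)
      ≈⟨ +-cong (trans (splits-suc n _) (trans (+-congʳ (zeroˡ _)) (+-identityˡ _)))
                (trans (splits-sucʳ n _) (trans (+-congˡ (zeroˡ _)) (+-identityʳ _))) ⟩
    ∫ (splits n) (λ (a , b) → fromℕ (suc a) * g (suc a) b) +
    ∫ (splits n) (λ (a , b) → fromℕ (suc b) * g a (suc b)) ∎

  -- The form in which characteristic zero enters the exponential identities: they are checked after
  -- multiplication by a positive integer.
  Cancellative : Set (c ⊔ ℓ)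
  Cancellative = ∀ n {x y} → fromℕ (suc n) * x ≈ fromℕ (suc n) * y → x ≈ y

  -- e n behaves as tⁿ/n!.
  record IsExponential (t : Carrier) (e : ℕ → Carrier) : Set ℓ where
    field
      e-0   : e 0 ≈ 1#
      e-suc : ∀ n → fromℕ (suc n) * e (suc n) ≈ t * e n

  power : (ℕ → Carrier) → ℕ → K[ Word ]
  power e n = scale (e n) (η (List.replicate n 0))

  ∫-power : ∀ e n φ → ∫ (power e n) φ ≈ e n * φ (List.replicate n 0)
  ∫-power e n φ = trans (∫-scale (e n) (η (List.replicate n 0)) φ) (*-congˡ (∫-η _ φ))

  degree-replicate : ∀ n → degree (List.replicate n 0) ≡ n
  degree-replicate zero    = ≡.refl
  degree-replicate (suc n) = ≡.cong suc (degree-replicate n)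

  ∂ʷ-replicate : ∀ n φ → ∫ (∂ʷ (List.replicate (suc n) 0)) φ ≈ fromℕ (suc n) * φ (List.replicate n 0)
  ∂ʷ-replicate n φ = trans (∂ʷ-∷ 0 (List.replicate n 0) φ) (trans (+-congˡ (rest n φ))
    (sym (trans (distribʳ _ 1# _) (+-congʳ (*-identityˡ _)))))
    where
    rest : ∀ n φ → ∫ (∂ʷ (List.replicate n 0)) (λ u → φ (0 ∷ u)) ≈ fromℕ n * φ (List.replicate n 0)
    rest zero    φ = trans (∫-[] _) (sym (zeroˡ _))
    rest (suc n) φ = ∂ʷ-replicate n (λ u → φ (0 ∷ u))

  -- The exponential of the primitive element S₁ is group-like. After multiplication by `suc n` both
  -- sides obey the same recursion: primitivity of S₁ produces two halves on the left, and Leibniz'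
  -- rule produces the matching ones on the right.
  power-groupLike : ∀ {t e} → Cancellative → IsExponential t e → GroupLike (power e)
  power-groupLike {t} {e} cancel isExp = record
    { unit        = λ φ → trans (∫-power e 0 φ) (trans (*-congʳ e-0) (*-identityˡ _))
    ; homogeneous = λ n {φ} {ψ} eq → trans (∫-power e n φ) (trans
        (*-congˡ (eq _ (degree-replicate n))) (sym (∫-power e n ψ)))
    ; coproduct   = λ n φ → trans (∫-power e n _) (trans (coproduct n φ) (∫-cong (splits n) λ (a , b) →
        sym (trans (∫-power e a _) (trans (*-congˡ (∫-power e b _)) (sym (*-assoc _ _ _))))))
    }
    where
    open IsExponential isExp
    coproduct : ∀ n (φ : Word → Word → Carrier) →
      e n * ∫ (Δ (List.replicate n 0)) (λ (x , y) → φ x y) ≈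
      ∫ (splits n) (λ (a , b) → (e a * e b) * φ (List.replicate a 0) (List.replicate b 0))
    coproduct zero    φ = trans (*-congˡ (∫-η _ _)) (sym (trans (splits-0 _)
      (*-congʳ (trans (*-congʳ e-0) (*-identityˡ _)))))
    coproduct (suc n) φ = cancel n (begin
      fromℕ (suc n) * (e (suc n) * ∫ (Δ (0 ∷ 0ⁿ)) (λ (x , y) → φ x y))
        ≈⟨ trans (sym (*-assoc _ _ _)) (*-congʳ (e-suc n)) ⟩
      (t * e n) * ∫ (Δ (0 ∷ 0ⁿ)) (λ (x , y) → φ x y)
        ≈⟨ *-congˡ (trans (Δ-∷ 0 0ⁿ _) (trans (splits-suc 0 _) (trans (+-comm _ _) (+-congʳ (splits-0 _))))) ⟩
      (t * e n) * (∫ (Δ 0ⁿ) (λ (x , y) → φ (0 ∷ x) y) + ∫ (Δ 0ⁿ) (λ (x , y) → φ x (0 ∷ y)))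
        ≈⟨ distribˡ _ _ _ ⟩
      (t * e n) * ∫ (Δ 0ⁿ) (λ (x , y) → φ (0 ∷ x) y) + (t * e n) * ∫ (Δ 0ⁿ) (λ (x , y) → φ x (0 ∷ y))
        ≈⟨ +-cong (half (λ x y → φ (0 ∷ x) y)) (half (λ x y → φ x (0 ∷ y))) ⟩
      ∫ (splits n) (λ (a , b) → t * ((e a * e b) * φ (List.replicate (suc a) 0) (List.replicate b 0))) +
      ∫ (splits n) (λ (a , b) → t * ((e a * e b) * φ (List.replicate a 0) (List.replicate (suc b) 0)))
        ≈⟨ +-cong (∫-cong (splits n) λ (a , b) → stepˡ a (e b) _) (∫-cong (splits n) λ (a , b) → stepʳ (e a) b _) ⟨
      ∫ (splits n) (λ (a , b) → fromℕ (suc a) * ((e (suc a) * e b) * φ (List.replicate (suc a) 0) (List.replicate b 0))) +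
      ∫ (splits n) (λ (a , b) → fromℕ (suc b) * ((e a * e (suc b)) * φ (List.replicate a 0) (List.replicate (suc b) 0)))
        ≈⟨ splits-leibniz n _ ⟨
      fromℕ (suc n) * ∫ (splits (suc n)) (λ (a , b) → (e a * e b) * φ (List.replicate a 0) (List.replicate b 0)) ∎)
      where
      0ⁿ = List.replicate n 0
      half : ∀ ψ → (t * e n) * ∫ (Δ 0ⁿ) (λ (x , y) → ψ x y) ≈
        ∫ (splits n) (λ (a , b) → t * ((e a * e b) * ψ (List.replicate a 0) (List.replicate b 0)))
      half ψ = trans (*-assoc _ _ _) (trans (*-congˡ (coproduct n ψ)) (sym (∫-*ˡ (splits n) _ _)))
      stepˡ : ∀ a x z → fromℕ (suc a) * ((e (suc a) * x) * z) ≈ t * ((e a * x) * z)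
      stepˡ a x z = begin
        fromℕ (suc a) * ((e (suc a) * x) * z)  ≈⟨ *-congˡ (*-assoc _ _ _) ⟩
        fromℕ (suc a) * (e (suc a) * (x * z))  ≈⟨ *-assoc _ _ _ ⟨
        (fromℕ (suc a) * e (suc a)) * (x * z)  ≈⟨ *-congʳ (e-suc a) ⟩
        (t * e a) * (x * z)                    ≈⟨ *-assoc _ _ _ ⟩
        t * (e a * (x * z))                    ≈⟨ *-congˡ (*-assoc _ _ _) ⟨
        t * ((e a * x) * z)                    ∎
      stepʳ : ∀ x b z → fromℕ (suc b) * ((x * e (suc b)) * z) ≈ t * ((x * e b) * z)
      stepʳ x b z = trans (*-congˡ (*-congʳ (*-comm _ _))) (trans (stepˡ b x z) (*-congˡ (*-congʳ (*-comm _ _))))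

  -- The product exp(tx) exp(t′x) has derivative t + t′ times itself, which is zero here, so all its
  -- coefficients beyond the constant one vanish.
  exponential-inverse : ∀ {t t′ e e′} → Cancellative → IsExponential t e → IsExponential t′ e′ →
    t + t′ ≈ 0# → ∀ n → ∫ (splits (suc n)) (λ (a , b) → e a * e′ b) ≈ 0#
  exponential-inverse {t} {t′} {e} {e′} cancel E E′ t+t′≈0 n = cancel n (begin
    fromℕ (suc n) * ∫ (splits (suc n)) (λ (a , b) → e a * e′ b)
      ≈⟨ splits-leibniz n (λ a b → e a * e′ b) ⟩
    ∫ (splits n) (λ (a , b) → fromℕ (suc a) * (e (suc a) * e′ b)) +
    ∫ (splits n) (λ (a , b) → fromℕ (suc b) * (e a * e′ (suc b)))
      ≈⟨ +-cong
           (∫-cong (splits n) λ (a , b) → trans (sym (*-assoc _ _ _)) (trans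
             (*-congʳ (IsExponential.e-suc E a)) (*-assoc _ _ _)))
           (∫-cong (splits n) λ (a , b) → trans (x∙yz≈y∙xz _ _ _) (trans
             (*-congˡ (IsExponential.e-suc E′ b)) (x∙yz≈y∙xz _ _ _))) ⟩
    ∫ (splits n) (λ (a , b) → t * (e a * e′ b)) + ∫ (splits n) (λ (a , b) → t′ * (e a * e′ b))
      ≈⟨ +-cong (∫-*ˡ (splits n) _ _) (∫-*ˡ (splits n) _ _) ⟩
    t * ∫ (splits n) (λ (a , b) → e a * e′ b) + t′ * ∫ (splits n) (λ (a , b) → e a * e′ b)
      ≈⟨ trans (sym (distribʳ _ _ _)) (trans (*-congʳ t+t′≈0) (zeroˡ _)) ⟩
    0#
      ≈⟨ zeroʳ _ ⟨
    fromℕ (suc n) * 0# ∎)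

  -- Enumerations of matrices

  uniform : List A → K[ A ]
  uniform = List.map (1# ,_)

  ∫-uniform-∷ : ∀ (x : A) xs φ → ∫ (uniform (x ∷ xs)) φ ≈ φ x + ∫ (uniform xs) φ
  ∫-uniform-∷ x xs φ = trans (∫-∷ 1# x (uniform xs) φ) (+-congʳ (*-identityˡ _))

  ∫-uniform-++ : ∀ (xs ys : List A) φ → ∫ (uniform (xs ++ ys)) φ ≈ ∫ (uniform xs) φ + ∫ (uniform ys) φ
  ∫-uniform-++ xs ys φ =
    trans (reflexive (≡.cong (λ F → ∫ F φ) (List.map-++ (1# ,_) xs ys))) (∫-++ (uniform xs) (uniform ys) φ)

  ∫-uniform-map : ∀ (f : A → B) xs φ → ∫ (uniform (List.map f xs)) φ ≈ ∫ (uniform xs) (λ x → φ (f x))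
  ∫-uniform-map f []       φ = trans (∫-[] _) (sym (∫-[] _))
  ∫-uniform-map f (x ∷ xs) φ = trans (∫-uniform-∷ (f x) (List.map f xs) φ)
    (trans (+-congˡ (∫-uniform-map f xs φ)) (sym (∫-uniform-∷ x xs _)))

  ∫-uniform-cartesianProductWith : ∀ {C : Set} (f : A → B → C) xs ys φ →
    ∫ (uniform (List.cartesianProductWith f xs ys)) φ ≈
    ∫ (uniform xs) (λ x → ∫ (uniform ys) λ y → φ (f x y))
  ∫-uniform-cartesianProductWith f []       ys φ = trans (∫-[] _) (sym (∫-[] _))
  ∫-uniform-cartesianProductWith f (x ∷ xs) ys φ = trans
    (∫-uniform-++ (List.map (f x) ys) (List.cartesianProductWith f xs ys) φ) (trans
    (+-cong (∫-uniform-map (f x) ys φ) (∫-uniform-cartesianProductWith f xs ys φ))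
    (sym (∫-uniform-∷ x xs _)))

  ∫-uniform-filter : ∀ {p} {P : Pred A p} (P? : Decidable P) xs φ →
    ∫ (uniform (List.filter P? xs)) φ ≈ ∫ (uniform xs) (λ x → ⟦ P? x ⟧ * φ x)
  ∫-uniform-filter P? []       φ = trans (∫-[] _) (sym (∫-[] _))
  ∫-uniform-filter P? (x ∷ xs) φ with does (P? x) in eq
  ... | true  = trans (∫-uniform-∷ x _ φ) (trans
    (+-cong (sym (trans (*-congʳ (reflexive (≡.cong (if_then 1# else 0#) eq))) (*-identityˡ _)))
            (∫-uniform-filter P? xs φ))
    (sym (∫-uniform-∷ x xs _)))
  ... | false = trans (∫-uniform-filter P? xs φ) (trans (sym (+-identityˡ _)) (trans
    (+-congʳ (sym (trans (*-congʳ (reflexive (≡.cong (if_then 1# else 0#) eq))) (zeroˡ _))))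
    (sym (∫-uniform-∷ x xs _))))

  ∫-uniform-concatMap : ∀ (f : A → K[ B ]) xs φ →
    ∫ (concatMap f xs) φ ≈ ∫ (uniform xs) (λ x → ∫ (f x) φ)
  ∫-uniform-concatMap f []       φ = trans (∫-[] _) (sym (∫-[] _))
  ∫-uniform-concatMap f (x ∷ xs) φ = trans (∫-++ (f x) (concatMap f xs) φ)
    (trans (+-congˡ (∫-uniform-concatMap f xs φ)) (sym (∫-uniform-∷ x xs _)))

  ∫-upTo-suc : ∀ n φ → ∫ (uniform (upTo (suc n))) φ ≈ φ 0 + ∫ (uniform (upTo n)) (λ x → φ (suc x))
  ∫-upTo-suc n φ = trans (∫-uniform-∷ 0 _ φ) (+-congˡ (trans
    (reflexive (≡.cong (λ xs → ∫ (uniform xs) φ) (≡.sym (List.map-upTo suc n))))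
    (∫-uniform-map suc (upTo n) φ)))

  -- The equation x + t = j has the same solutions as a splitting of j with second part t; the
  -- vanishing of f from N onwards makes the cutoff harmless.
  ∫-upTo-splits : ∀ N j t f → (∀ x → N ℕ.≤ x → f x ≈ 0#) →
    ∫ (uniform (upTo N)) (λ x → ⟦ x ℕ.+ t ℕ.≟ j ⟧ * f x) ≈
    ∫ (splits j) (λ (a , b) → ⟦ t ℕ.≟ b ⟧ * f a)
  ∫-upTo-splits zero    j       t f f≈0 = trans (∫-[] _) (sym (trans
    (∫-cong (splits j) λ (a , b) → trans (*-congˡ (f≈0 a ℕ.z≤n)) (zeroʳ _)) (∫-0 (splits j))))
  ∫-upTo-splits (suc N) zero    t f f≈0 = trans (∫-upTo-suc N _) (trans
    (+-congˡ (trans (∫-cong (uniform (upTo N)) λ x → zeroˡ _) (∫-0 (uniform (upTo N)))))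
    (trans (+-identityʳ _) (sym (splits-0 _))))
  ∫-upTo-splits (suc N) (suc j) t f f≈0 = trans (∫-upTo-suc N _) (trans
    (+-congˡ (∫-upTo-splits N j t (λ x → f (suc x)) λ x N≤x → f≈0 (suc x) (ℕ.s≤s N≤x)))
    (sym (splits-suc j _)))

  _≟ᵛ_ : ∀ {n} (x y : Vec ℕ n) → Dec (x ≡ y)
  _≟ᵛ_ = Vec.≡-dec ℕ._≟_

  ⟦⟧-≟ᵛ-∷ : ∀ {n} x y (xs ys : Vec ℕ n) →
            ⟦ (x Vec.∷ xs) ≟ᵛ (y Vec.∷ ys) ⟧ ≈ ⟦ x ℕ.≟ y ⟧ * ⟦ xs ≟ᵛ ys ⟧
  ⟦⟧-≟ᵛ-∷ x y xs ys = trans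
    (⟦⟧-cong ((x Vec.∷ xs) ≟ᵛ (y Vec.∷ ys)) (x ℕ.≟ y ×-dec xs ≟ᵛ ys)
      Vec.∷-injective (λ (x≡y , xs≡ys) → ≡.cong₂ Vec._∷_ x≡y xs≡ys))
    (⟦⟧-× (x ℕ.≟ y) (xs ≟ᵛ ys))

  -- The coproduct before zero parts are dropped, so that the number of columns stays fixed.
  splitsᵛ : ∀ {n} → Vec ℕ n → K[ Vec ℕ n × Vec ℕ n ]
  splitsᵛ Vec.[]      = η (Vec.[] , Vec.[])
  splitsᵛ (j Vec.∷ J) = splits j >>= λ (a , b) → splitsᵛ J >>= λ (r , s) → η (a Vec.∷ r , b Vec.∷ s)

  splitsᵛ-∷ : ∀ {n} j (J : Vec ℕ n) φ → ∫ (splitsᵛ (j Vec.∷ J)) φ ≈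
              ∫ (splits j) (λ (a , b) → ∫ (splitsᵛ J) λ (r , s) → φ (a Vec.∷ r , b Vec.∷ s))
  splitsᵛ-∷ j J φ = trans (∫->>= (splits j) _ φ) (∫-cong (splits j) λ (a , b) →
    trans (∫->>= (splitsᵛ J) _ φ) (∫-cong (splitsᵛ J) λ (r , s) → ∫-η _ φ))

  -- Choosing a first row x above column sums t with total J amounts to splitting J.
  ∫-tuples-splitsᵛ : ∀ N {n} (J t : Vec ℕ n) f → (∀ x → N ℕ.≤ Vec.sum x → f x ≈ 0#) →
    ∫ (uniform (tuples (upTo N) n)) (λ x → ⟦ Vec.zipWith ℕ._+_ x t ≟ᵛ J ⟧ * f x) ≈
    ∫ (splitsᵛ J) (λ (r , s) → ⟦ t ≟ᵛ s ⟧ * f r)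
  ∫-tuples-splitsᵛ N Vec.[] Vec.[] f f≈0 =
    trans (∫-uniform-∷ Vec.[] [] _) (trans (+-congˡ (∫-[] _)) (trans (+-identityʳ _) (sym (∫-η _ _))))
  ∫-tuples-splitsᵛ N {suc n} (j Vec.∷ J) (k Vec.∷ t) f f≈0 = begin
    ∫ (uniform (tuples (upTo N) (suc n))) (λ x → ⟦ Vec.zipWith ℕ._+_ x (k Vec.∷ t) ≟ᵛ (j Vec.∷ J) ⟧ * f x)
      ≈⟨ ∫-uniform-cartesianProductWith Vec._∷_ (upTo N) (tuples (upTo N) n) _ ⟩
    ∫ (uniform (upTo N)) (λ x → ∫ (uniform (tuples (upTo N) n)) λ xs →
      ⟦ (x ℕ.+ k Vec.∷ Vec.zipWith ℕ._+_ xs t) ≟ᵛ (j Vec.∷ J) ⟧ * f (x Vec.∷ xs))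
      ≈⟨ ∫-cong (uniform (upTo N)) (λ x → trans
           (∫-cong (uniform (tuples (upTo N) n)) λ xs → trans
             (*-congʳ (⟦⟧-≟ᵛ-∷ (x ℕ.+ k) j (Vec.zipWith ℕ._+_ xs t) J)) (*-assoc _ _ _))
           (trans (∫-*ˡ (uniform (tuples (upTo N) n)) _ _)
             (*-congˡ (∫-tuples-splitsᵛ N J t (λ xs → f (x Vec.∷ xs)) λ xs N≤xs →
               f≈0 (x Vec.∷ xs) (ℕ.≤-trans N≤xs (ℕ.m≤n+m (Vec.sum xs) x)))))) ⟩
    ∫ (uniform (upTo N)) (λ x → ⟦ x ℕ.+ k ℕ.≟ j ⟧ * ∫ (splitsᵛ J) λ (r , s) → ⟦ t ≟ᵛ s ⟧ * f (x Vec.∷ r))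
      ≈⟨ ∫-upTo-splits N j k _ (λ x N≤x → trans
           (∫-cong (splitsᵛ J) λ (r , s) → trans
             (*-congˡ (f≈0 (x Vec.∷ r) (ℕ.≤-trans N≤x (ℕ.m≤m+n x (Vec.sum r))))) (zeroʳ _))
           (∫-0 (splitsᵛ J))) ⟩
    ∫ (splits j) (λ (a , b) → ⟦ k ℕ.≟ b ⟧ * ∫ (splitsᵛ J) λ (r , s) → ⟦ t ≟ᵛ s ⟧ * f (a Vec.∷ r))
      ≈⟨ ∫-cong (splits j) (λ (a , b) → trans (sym (∫-*ˡ (splitsᵛ J) _ _)) (∫-cong (splitsᵛ J) λ (r , s) →
           trans (sym (*-assoc _ _ _)) (*-congʳ (sym (⟦⟧-≟ᵛ-∷ k b t s))))) ⟩
    ∫ (splits j) (λ (a , b) → ∫ (splitsᵛ J) λ (r , s) → ⟦ (k Vec.∷ t) ≟ᵛ (b Vec.∷ s) ⟧ * f (a Vec.∷ r))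
      ≈⟨ splitsᵛ-∷ j J _ ⟨
    ∫ (splitsᵛ (j Vec.∷ J)) (λ (r , s) → ⟦ (k Vec.∷ t) ≟ᵛ s ⟧ * f r) ∎

  compressᵛ : ∀ {n} → Vec ℕ n → Word
  compressᵛ J = compress (Vec.toList J)

  splitsᵛ-Δ : ∀ {n} (J : Vec ℕ n) (φ : Word → Word → Carrier) →
    ∫ (splitsᵛ J) (λ (r , s) → φ (compressᵛ r) (compressᵛ s)) ≈ ∫ (Δ (compressᵛ J)) (λ (r , s) → φ r s)
  splitsᵛ-Δ Vec.[]      φ = trans (∫-η _ _) (sym (∫-η _ _))
  splitsᵛ-Δ (j Vec.∷ J) φ = trans (splitsᵛ-∷ j J _) (trans
    (∫-cong (splits j) λ (a , b) → splitsᵛ-Δ J λ r s → φ (a ▹ r) (b ▹ s))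
    (sym (Δ-▹ j (compressᵛ J) _)))

  -- Induction on rows. J is a vector that may contain zeros, since removing a row can exhaust a
  -- column; `compressᵛ` discards the zeros. The bound N is independent of u because the search
  -- range is fixed while the remaining row sums shrink.
  ∫-matrices : ∀ N u {n} (J : Vec ℕ n) φ → degree u ℕ.< N →
    ∫ (uniform (tuples (tuples (upTo N) n) (length (parts u))))
      (λ M → ⟦ rowSums M ≟ᵛ Vec.fromList (parts u) ⟧ * (⟦ colSums M ≟ᵛ J ⟧ * φ (compress (entries M)))) ≈
    ∫ (u ⊛ compressᵛ J) φ
  ∫-matrices N []      {n} J φ u<N = begin
    ∫ (uniform (Vec.[] ∷ [])) (λ M → ⟦ rowSums M ≟ᵛ Vec.[] ⟧ * (⟦ colSums M ≟ᵛ J ⟧ * φ (compress (entries M))))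
      ≈⟨ trans (∫-uniform-∷ Vec.[] [] _) (trans (+-cong (*-identityˡ _) (∫-[] _)) (+-identityʳ _)) ⟩
    ⟦ Vec.replicate _ 0 ≟ᵛ J ⟧ * φ []
      -- Without rows all column sums are 0, which is the degree 0 condition in the base case of ⊛.
      ≈⟨ *-congʳ (⟦⟧-cong (Vec.replicate _ 0 ≟ᵛ J) (degree (compressᵛ J) ℕ.≟ 0) (λ { ≡.refl → degree-0 n }) (0-degree J)) ⟩
    ⟦ degree (compressᵛ J) ℕ.≟ 0 ⟧ * φ []
      ≈⟨ ⊛-[] (compressᵛ J) φ ⟨
    ∫ ([] ⊛ compressᵛ J) φ ∎
    where
    degree-0 : ∀ n → degree (compressᵛ (Vec.replicate n 0)) ≡ 0
    degree-0 zero    = ≡.refl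
    degree-0 (suc n) = degree-0 n
    0-degree : ∀ {n} (J : Vec ℕ n) → degree (compressᵛ J) ≡ 0 → Vec.replicate n 0 ≡ J
    0-degree Vec.[]         eq = ≡.refl
    0-degree (zero Vec.∷ J) eq = ≡.cong (0 Vec.∷_) (0-degree J eq)
  ∫-matrices N (i ∷ u) {n} J φ u<N = begin
    ∫ (uniform (tuples rows (suc (length I))))
      (λ M → ⟦ rowSums M ≟ᵛ (suc i Vec.∷ Vec.fromList I) ⟧ * (⟦ colSums M ≟ᵛ J ⟧ * φ (compress (entries M))))
      ≈⟨ ∫-uniform-cartesianProductWith Vec._∷_ rows (tuples rows (length I)) _ ⟩
    ∫ (uniform rows) (λ x → ∫ (uniform (tuples rows (length I))) λ M →
      ⟦ (Vec.sum x Vec.∷ rowSums M) ≟ᵛ (suc i Vec.∷ Vec.fromList I) ⟧ *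
      (⟦ Vec.zipWith ℕ._+_ x (colSums M) ≟ᵛ J ⟧ * φ (compress (entries (x Vec.∷ M)))))
      ≈⟨ ∫-swap (uniform rows) (uniform (tuples rows (length I))) _ ⟩
    ∫ (uniform (tuples rows (length I))) (λ M → ∫ (uniform rows) λ x →
      ⟦ (Vec.sum x Vec.∷ rowSums M) ≟ᵛ (suc i Vec.∷ Vec.fromList I) ⟧ *
      (⟦ Vec.zipWith ℕ._+_ x (colSums M) ≟ᵛ J ⟧ * φ (compress (entries (x Vec.∷ M)))))
      ≈⟨ ∫-cong (uniform (tuples rows (length I))) (λ M → ∫-cong (uniform rows) λ x → trans
           (*-congʳ (⟦⟧-≟ᵛ-∷ (Vec.sum x) (suc i) (rowSums M) (Vec.fromList I)))
           (trans (x∙yz≈y∙xz _ _ _) (*-congˡ (*-assoc _ _ _)))) ⟩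
    ∫ (uniform (tuples rows (length I))) (λ M → ∫ (uniform rows) λ x →
      ⟦ Vec.zipWith ℕ._+_ x (colSums M) ≟ᵛ J ⟧ *
      (⟦ Vec.sum x ℕ.≟ suc i ⟧ * (⟦ rowSums M ≟ᵛ Vec.fromList I ⟧ * φ (compress (entries (x Vec.∷ M))))))
      -- A row missed by the search would have sum at least N, hence more than `suc i`, and the
      -- row-sum indicator rejects it.
      ≈⟨ ∫-cong (uniform (tuples rows (length I))) (λ M → ∫-tuples-splitsᵛ N J (colSums M) _ λ x N≤x →
           ⟦⟧-no (Vec.sum x ℕ.≟ suc i) λ x≡1+i → ℕ.<⇒≱ u<N (ℕ.≤-trans N≤x
             (ℕ.≤-trans (ℕ.≤-reflexive x≡1+i) (ℕ.m≤m+n (suc i) (degree u))))) ⟩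
    ∫ (uniform (tuples rows (length I))) (λ M → ∫ (splitsᵛ J) λ (r , s) →
      ⟦ colSums M ≟ᵛ s ⟧ *
      (⟦ Vec.sum r ℕ.≟ suc i ⟧ * (⟦ rowSums M ≟ᵛ Vec.fromList I ⟧ * φ (compress (entries (r Vec.∷ M))))))
      ≈⟨ ∫-swap (uniform (tuples rows (length I))) (splitsᵛ J) _ ⟩
    ∫ (splitsᵛ J) (λ (r , s) → ∫ (uniform (tuples rows (length I))) λ M →
      ⟦ colSums M ≟ᵛ s ⟧ *
      (⟦ Vec.sum r ℕ.≟ suc i ⟧ * (⟦ rowSums M ≟ᵛ Vec.fromList I ⟧ * φ (compress (entries (r Vec.∷ M))))))
      ≈⟨ ∫-cong (splitsᵛ J) (λ (r , s) → trans
           (∫-cong (uniform (tuples rows (length I))) λ M → trans (x∙yz≈y∙xz _ _ _)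
             (*-cong (reflexive (≡.cong (λ d → ⟦ d ℕ.≟ suc i ⟧) (≡.sym (degree-compressᵛ r))))
               (trans (x∙yz≈y∙xz _ _ _) (*-congˡ (*-congˡ (reflexive (≡.cong φ (compress-entries r M))))))))
           (trans (∫-*ˡ (uniform (tuples rows (length I))) _ _)
             (*-congˡ (∫-matrices N u s (λ w → φ (compressᵛ r ++ w))
               (ℕ.≤-<-trans (ℕ.m≤n+m (degree u) (suc i)) u<N))))) ⟩
    ∫ (splitsᵛ J) (λ (r , s) → ⟦ degree (compressᵛ r) ℕ.≟ suc i ⟧ *
      ∫ (u ⊛ compressᵛ s) λ w → φ (compressᵛ r ++ w))
      ≈⟨ splitsᵛ-Δ J (λ r s → ⟦ degree r ℕ.≟ suc i ⟧ * ∫ (u ⊛ s) λ w → φ (r ++ w)) ⟩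
    ∫ (Δ (compressᵛ J)) (λ (r , s) → ⟦ degree r ℕ.≟ suc i ⟧ * ∫ (u ⊛ s) λ w → φ (r ++ w))
      ≈⟨ ⊛-∷ i u (compressᵛ J) φ ⟨
    ∫ ((i ∷ u) ⊛ compressᵛ J) φ ∎
    where
    rows = tuples (upTo N) n
    I = parts u
    degree-compressᵛ : ∀ {n} (r : Vec ℕ n) → degree (compressᵛ r) ≡ Vec.sum r
    degree-compressᵛ Vec.[]      = ≡.refl
    degree-compressᵛ (a Vec.∷ r) = ≡.trans (degree-▹ a (compressᵛ r)) (≡.cong (a ℕ.+_) (degree-compressᵛ r))
    compress-entries : ∀ {k} (r : Vec ℕ n) (M : Matrix k n) →
      compress (entries (r Vec.∷ M)) ≡ compressᵛ r ++ compress (entries M)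
    compress-entries r M = ≡.trans (≡.cong compress (Vec.toList-++ r (Vec.concat M)))
      (compress-++ (Vec.toList r) (entries M))

-- Transfer to Sym over a field of characteristic zero

module SymmetricFunctions {c ℓ₁ ℓ₂} (K : HeytingField c ℓ₁ ℓ₂) (char0 : CharZero K) where

  open NSym K char0

  private
    R : CommutativeRing c ℓ₁
    R = HeytingCommutativeRing.commutativeRing (HeytingField.heytingCommutativeRing K)

  open HeytingField K using (#⇒invertible)
  open CommutativeRing R hiding (zero)
  open FormalSums R
  open CommutativeSemigroupProperties *-commutativeSemigroup using (x∙yz≈y∙xz)
  open RingProperties ring using (-1*x≈-x)
  open RawSemiringDefs (Semiring.rawSemiring semiring) using () renaming (_^_ to _^ᴷ_)
  module ≈-Reasoning = SetoidReasoning setoid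

  -- Coefficients and integrals

  infix 4 _≃_

  -- A record rather than a bare function type, so that F and G can be inferred from a proof.
  record _≃_ (F G : Sym) : Set (c ⊔ ℓ₁) where
    constructor by-∫
    field at : ∀ φ → ∫ F φ ≈ ∫ G φ

  open _≃_ public

  ≃-setoid : Setoid c (c ⊔ ℓ₁)
  ≃-setoid = record
    { Carrier = Sym ; _≈_ = _≃_
    ; isEquivalence = record
      { refl  = by-∫ λ φ → refl
      ; sym   = λ F≃G → by-∫ λ φ → sym (at F≃G φ)
      ; trans = λ F≃G G≃H → by-∫ λ φ → trans (at F≃G φ) (at G≃H φ)
      }
    }

  module ≃ = Setoid ≃-setoid
  module ≃-Reasoning = SetoidReasoning ≃-setoid

  coeff-∫ : ∀ F w → coeff F w ≈ ∫ F (λ u → ⟦ u ≟ʷ w ⟧)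
  coeff-∫ []            w = sym (∫-[] _)
  coeff-∫ ((a , u) ∷ F) w with u ≟ʷ w in eq
  ... | yes _ = trans (+-cong (sym (trans (*-congˡ (reflexive (≡.cong ⟦_⟧ eq))) (*-identityʳ a))) (coeff-∫ F w)) (sym (∫-∷ a u F _))
  ... | no  _ = trans (coeff-∫ F w) (trans (sym (+-identityˡ _)) (trans
    (+-congʳ (sym (trans (*-congˡ (reflexive (≡.cong ⟦_⟧ eq))) (zeroʳ a)))) (sym (∫-∷ a u F _))))

  ≃⇒≋ : ∀ {F G} → F ≃ G → F ≋ G
  ≃⇒≋ {F} {G} F≃G w = trans (coeff-∫ F w) (trans (at F≃G _) (sym (coeff-∫ G w)))

  remove : Word → Sym → Sym
  remove u []            = []
  remove u ((a , v) ∷ F) with v ≟ʷ u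
  ... | yes _ = remove u F
  ... | no  _ = (a , v) ∷ remove u F

  remove-head : ∀ a u F → remove u ((a , u) ∷ F) ≡ remove u F
  remove-head a u F with u ≟ʷ u
  ... | yes _   = ≡.refl
  ... | no  u≢u = ⊥-elim (u≢u ≡.refl)

  length-remove : ∀ u F → length (remove u F) ℕ.≤ length F
  length-remove u []            = ℕ.z≤n
  length-remove u ((a , v) ∷ F) with v ≟ʷ u
  ... | yes _ = ℕ.m≤n⇒m≤1+n (length-remove u F)
  ... | no  _ = ℕ.s≤s (length-remove u F)

  ∫-remove : ∀ u F φ → ∫ F φ ≈ coeff F u * φ u + ∫ (remove u F) φ
  ∫-remove u []            φ = trans (sym (+-identityˡ _)) (+-congʳ (sym (zeroˡ _)))
  ∫-remove u ((a , v) ∷ F) φ with v ≟ʷ u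
  ... | yes ≡.refl = trans (∫-∷ a v F φ) (trans (+-congˡ (∫-remove u F φ))
    (trans (sym (+-assoc _ _ _)) (+-congʳ (sym (distribʳ _ _ _)))))
  ... | no  _      = begin
    ∫ ((a , v) ∷ F) φ                                       ≈⟨ ∫-∷ a v F φ ⟩
    a * φ v + ∫ F φ                                         ≈⟨ +-congˡ (∫-remove u F φ) ⟩
    a * φ v + (coeff F u * φ u + ∫ (remove u F) φ)          ≈⟨ +-assoc _ _ _ ⟨
    a * φ v + coeff F u * φ u + ∫ (remove u F) φ            ≈⟨ +-congʳ (+-comm _ _) ⟩
    coeff F u * φ u + a * φ v + ∫ (remove u F) φ            ≈⟨ +-assoc _ _ _ ⟩
    coeff F u * φ u + (a * φ v + ∫ (remove u F) φ)          ≈⟨ +-congˡ (∫-∷ a v (remove u F) φ) ⟨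
    coeff F u * φ u + ∫ ((a , v) ∷ remove u F) φ            ∎
    where open ≈-Reasoning

  -- The first word has total coefficient zero, so deleting all its occurrences changes no integral
  -- and shortens the list. The bound n carries the recursion on length.
  ≋𝟘⇒∫≈0 : ∀ n F → length F ℕ.≤ n → F ≋ 𝟘 → ∀ φ → ∫ F φ ≈ 0#
  ≋𝟘⇒∫≈0 n       []            _         F≋𝟘 φ = ∫-[] φ
  ≋𝟘⇒∫≈0 (suc n) ((a , u) ∷ F) (ℕ.s≤s F≤n) F≋𝟘 φ = trans (split φ)
    (≋𝟘⇒∫≈0 n (remove u F) (ℕ.≤-trans (length-remove u F) F≤n)
      (λ w → trans (coeff-∫ (remove u F) w) (trans (sym (split _)) (trans (sym (coeff-∫ _ w)) (F≋𝟘 w)))) φ)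
    where
    split : ∀ φ → ∫ ((a , u) ∷ F) φ ≈ ∫ (remove u F) φ
    split φ = trans (∫-remove u ((a , u) ∷ F) φ) (trans
      (+-cong (trans (*-congʳ (F≋𝟘 u)) (zeroˡ _)) (reflexive (≡.cong (λ G → ∫ G φ) (remove-head a u F))))
      (+-identityˡ _))

  -- Two lists with equal coefficients may have unrelated shapes; passing to F - G leaves a single
  -- list, from which words can be deleted one after another.
  ≋⇒≃ : ∀ {F G} → F ≋ G → F ≃ G
  ≋⇒≃ {F} {G} F≋G = by-∫ λ φ → begin
    ∫ F φ                                          ≈⟨ +-identityʳ _ ⟨
    ∫ F φ + 0#                                     ≈⟨ +-congˡ (-‿inverseˡ _) ⟨
    ∫ F φ + (- ∫ G φ + ∫ G φ)                      ≈⟨ +-assoc _ _ _ ⟨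
    (∫ F φ + - ∫ G φ) + ∫ G φ                      ≈⟨ +-congʳ (difference φ) ⟨
    ∫ (F ⊕ (- 1#) • G) φ + ∫ G φ                   ≈⟨ +-congʳ (≋𝟘⇒∫≈0 _ (F ⊕ (- 1#) • G) ℕ.≤-refl vanishes φ) ⟩
    0# + ∫ G φ                                     ≈⟨ +-identityˡ _ ⟩
    ∫ G φ                                          ∎
    where
    open ≈-Reasoning
    difference : ∀ φ → ∫ (F ⊕ (- 1#) • G) φ ≈ ∫ F φ + - ∫ G φ
    difference φ = trans (∫-++ F _ φ) (+-congˡ (trans (∫-scale (- 1#) G φ) (-1*x≈-x _)))
    vanishes : F ⊕ (- 1#) • G ≋ 𝟘
    vanishes w = begin
      coeff (F ⊕ (- 1#) • G) w                                   ≈⟨ coeff-∫ (F ⊕ (- 1#) • G) w ⟩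
      ∫ (F ⊕ (- 1#) • G) _                                       ≈⟨ difference _ ⟩
      ∫ F (λ u → ⟦ u ≟ʷ w ⟧) + - ∫ G (λ u → ⟦ u ≟ʷ w ⟧)          ≈⟨ +-congʳ (trans (sym (coeff-∫ F w)) (trans (F≋G w) (coeff-∫ G w))) ⟩
      ∫ G (λ u → ⟦ u ≟ʷ w ⟧) + - ∫ G (λ u → ⟦ u ≟ʷ w ⟧)          ≈⟨ -‿inverseʳ _ ⟩
      0#                                                         ∎

  -- The two products of Sym

  ∫-• : ∀ a F φ → ∫ (a • F) φ ≈ a * ∫ F φ
  ∫-• = ∫-scale

  ∫-⊕ : ∀ F G φ → ∫ (F ⊕ G) φ ≈ ∫ F φ + ∫ G φ
  ∫-⊕ = ∫-++

  ∫-𝟙 : ∀ φ → ∫ 𝟙 φ ≈ φ []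
  ∫-𝟙 = ∫-η []

  ∫-· : ∀ F G φ → ∫ (F · G) φ ≈ ∫ F (λ u → ∫ G λ v → φ (u ++ v))
  ∫-· []            G φ = trans (∫-[] _) (sym (∫-[] _))
  ∫-· ((a , u) ∷ F) G φ = trans (∫-++ (List.map _ G) (F · G) φ) (trans
    (+-cong (∫-map a (u ++_) G φ) (∫-· F G φ)) (sym (∫-∷ a u F _)))

  ∫-S : ∀ n φ → ∫ (S n) φ ≈ φ (n ▹ [])
  ∫-S zero    φ = ∫-η [] φ
  ∫-S (suc m) φ = ∫-η (m ∷ []) φ

  ∫-S^ : ∀ I φ → ∫ (S^ I) φ ≈ φ (compress I)
  ∫-S^ []      φ = ∫-𝟙 φ
  ∫-S^ (i ∷ I) φ = trans (∫-· (S i) (S^ I) φ) (trans (∫-S i _) (trans (∫-S^ I _)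
    (reflexive (≡.cong φ (▹-++ i [] (compress I))))))

  ∫-S^⋆S^ : ∀ u v φ → ∫ (S^ parts u ⋆S^ parts v) φ ≈ ∫ (u ⊛ v) φ
  ∫-S^⋆S^ u v φ = begin
    ∫ (S^ I ⋆S^ J) φ
      ≈⟨ ∫-uniform-concatMap (λ M → S^ (entries M)) (matrices I J) φ ⟩
    ∫ (uniform (matrices I J)) (λ M → ∫ (S^ (entries M)) φ)
      ≈⟨ ∫-uniform-filter _ (tuples (tuples (upTo (suc (degree u))) (length J)) (length I)) _ ⟩
    ∫ (uniform (tuples (tuples (upTo (suc (degree u))) (length J)) (length I))) (λ M →
      ⟦ rowSums M ≟ᵛ Vec.fromList I ×-dec colSums M ≟ᵛ Vec.fromList J ⟧ * ∫ (S^ (entries M)) φ)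
      ≈⟨ ∫-cong (uniform _) (λ M → trans
           (*-cong (⟦⟧-× (rowSums M ≟ᵛ Vec.fromList I) (colSums M ≟ᵛ Vec.fromList J)) (∫-S^ (entries M) φ))
           (*-assoc _ _ _)) ⟩
    ∫ (uniform (tuples (tuples (upTo (suc (degree u))) (length J)) (length I))) (λ M →
      ⟦ rowSums M ≟ᵛ Vec.fromList I ⟧ * (⟦ colSums M ≟ᵛ Vec.fromList J ⟧ * φ (compress (entries M))))
      ≈⟨ ∫-matrices (suc (degree u)) u (Vec.fromList J) φ ℕ.≤-refl ⟩
    ∫ (u ⊛ compressᵛ (Vec.fromList J)) φ
      ≈⟨ reflexive (≡.cong (λ w → ∫ (u ⊛ w) φ) (≡.trans
           (≡.cong compress (Vec.toList∘fromList J)) (compress-parts v))) ⟩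
    ∫ (u ⊛ v) φ ∎
    where
    open ≈-Reasoning
    I = parts u
    J = parts v

  ∫-⋆ : ∀ F G φ → ∫ (F ⋆ G) φ ≈ ∫ F (λ u → ∫ G λ v → ∫ (u ⊛ v) φ)
  ∫-⋆ F G φ = ∫-concatMap _ F λ a u → trans
    (∫-concatMap _ G λ b v → trans (∫-• (a * b) (S^ parts u ⋆S^ parts v) φ) (trans
      (*-congˡ (∫-S^⋆S^ u v φ)) (trans (*-congʳ (*-comm a b)) (*-assoc b a _))))
    (∫-*ˡ G a _)

  ⊕-cong : ∀ {F F′ G G′} → F ≃ F′ → G ≃ G′ → F ⊕ G ≃ F′ ⊕ G′
  ⊕-cong {F} {F′} {G} {G′} F≃ G≃ = by-∫ λ φ →
    trans (∫-⊕ F G φ) (trans (+-cong (at F≃ φ) (at G≃ φ)) (sym (∫-⊕ F′ G′ φ)))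

  ⊕-identityʳ : ∀ F → F ⊕ 𝟘 ≃ F
  ⊕-identityʳ F = by-∫ λ φ → trans (∫-⊕ F 𝟘 φ) (trans (+-congˡ (∫-[] φ)) (+-identityʳ _))

  •-cong : ∀ {a b F G} → a ≈ b → F ≃ G → a • F ≃ b • G
  •-cong {a} {b} {F} {G} a≈b F≃G = by-∫ λ φ →
    trans (∫-• a F φ) (trans (*-cong a≈b (at F≃G φ)) (sym (∫-• b G φ)))

  •-⊕ : ∀ a F G → a • (F ⊕ G) ≃ a • F ⊕ a • G
  •-⊕ a F G = by-∫ λ φ → trans (∫-• a (F ⊕ G) φ) (trans (*-congˡ (∫-⊕ F G φ)) (trans (distribˡ _ _ _)
    (sym (trans (∫-⊕ (a • F) (a • G) φ) (+-cong (∫-• a F φ) (∫-• a G φ))))))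

  ·-cong : ∀ {F F′ G G′} → F ≃ F′ → G ≃ G′ → F · G ≃ F′ · G′
  ·-cong {F} {F′} {G} {G′} F≃ G≃ = by-∫ λ φ → trans (∫-· F G φ) (trans
    (∫-cong F λ u → at G≃ _) (trans (at F≃ _) (sym (∫-· F′ G′ φ))))

  ·-congˡ : ∀ {F G G′} → G ≃ G′ → F · G ≃ F · G′
  ·-congˡ {F} = ·-cong (≃.refl {F})

  ·-congʳ : ∀ {F F′ G} → F ≃ F′ → F · G ≃ F′ · G
  ·-congʳ {G = G} F≃ = ·-cong F≃ (≃.refl {G})

  ·-assoc : ∀ F G H → (F · G) · H ≃ F · (G · H)
  ·-assoc F G H = by-∫ λ φ → begin
    ∫ ((F · G) · H) φ                                              ≈⟨ trans (∫-· (F · G) H φ) (∫-· F G _) ⟩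
    ∫ F (λ u → ∫ G λ v → ∫ H λ w → φ ((u ++ v) ++ w))              ≈⟨ ∫-cong F (λ u → ∫-cong G λ v → ∫-cong H λ w → reflexive (≡.cong φ (List.++-assoc u v w))) ⟩
    ∫ F (λ u → ∫ G λ v → ∫ H λ w → φ (u ++ (v ++ w)))              ≈⟨ ∫-cong F (λ u → ∫-· G H _) ⟨
    ∫ F (λ u → ∫ (G · H) λ w → φ (u ++ w))                         ≈⟨ ∫-· F (G · H) φ ⟨
    ∫ (F · (G · H)) φ                                              ∎
    where open ≈-Reasoning

  ·-identityˡ : ∀ F → 𝟙 · F ≃ F
  ·-identityˡ F = by-∫ λ φ → trans (∫-· 𝟙 F φ) (∫-𝟙 _)

  ·-zeroʳ : ∀ F → F · 𝟘 ≃ 𝟘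
  ·-zeroʳ F = by-∫ λ φ → trans (∫-· F 𝟘 φ) (trans (∫-cong F λ u → ∫-[] _) (trans (∫-0 F) (sym (∫-[] _))))

  ·-distribˡ : ∀ F G H → F · (G ⊕ H) ≃ F · G ⊕ F · H
  ·-distribˡ F G H = by-∫ λ φ → trans (∫-· F (G ⊕ H) φ) (trans (∫-cong F λ u → ∫-⊕ G H _) (trans (∫-+ F _ _)
    (sym (trans (∫-⊕ (F · G) (F · H) φ) (+-cong (∫-· F G φ) (∫-· F H φ))))))

  •-·ˡ : ∀ a F G → (a • F) · G ≃ a • (F · G)
  •-·ˡ a F G = by-∫ λ φ → trans (∫-· (a • F) G φ) (trans (∫-• a F _)
    (sym (trans (∫-• a (F · G) φ) (*-congˡ (∫-· F G φ)))))

  •-·ʳ : ∀ a F G → F · (a • G) ≃ a • (F · G)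
  •-·ʳ a F G = by-∫ λ φ → trans (∫-· F (a • G) φ) (trans (∫-cong F λ u → ∫-• a G _) (trans (∫-*ˡ F a _)
    (sym (trans (∫-• a (F · G) φ) (*-congˡ (∫-· F G φ))))))

  ⋆-cong : ∀ {F F′ G G′} → F ≃ F′ → G ≃ G′ → F ⋆ G ≃ F′ ⋆ G′
  ⋆-cong {F} {F′} {G} {G′} F≃ G≃ = by-∫ λ φ → trans (∫-⋆ F G φ) (trans
    (∫-cong F λ u → at G≃ _) (trans (at F≃ _) (sym (∫-⋆ F′ G′ φ))))

  ⋆-congˡ : ∀ {F G G′} → G ≃ G′ → F ⋆ G ≃ F ⋆ G′
  ⋆-congˡ {F} = ⋆-cong (≃.refl {F})

  ⋆-congʳ : ∀ {F F′ G} → F ≃ F′ → F ⋆ G ≃ F′ ⋆ G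
  ⋆-congʳ {G = G} F≃ = ⋆-cong F≃ (≃.refl {G})

  ⋆-assoc : ∀ F G H → (F ⋆ G) ⋆ H ≃ F ⋆ (G ⋆ H)
  ⋆-assoc F G H = by-∫ λ φ → begin
    ∫ ((F ⋆ G) ⋆ H) φ                                                ≈⟨ trans (∫-⋆ (F ⋆ G) H φ) (∫-⋆ F G _) ⟩
    ∫ F (λ u → ∫ G λ v → ∫ (u ⊛ v) λ x → ∫ H λ w → ∫ (x ⊛ w) φ)      ≈⟨ ∫-cong F (λ u → ∫-cong G λ v → ∫-swap (u ⊛ v) H _) ⟩
    ∫ F (λ u → ∫ G λ v → ∫ H λ w → ∫ (u ⊛ v) λ x → ∫ (x ⊛ w) φ)      ≈⟨ ∫-cong F (λ u → ∫-cong G λ v → ∫-cong H λ w → ⊛-assoc u v w φ) ⟩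
    ∫ F (λ u → ∫ G λ v → ∫ H λ w → ∫ (v ⊛ w) λ y → ∫ (u ⊛ y) φ)      ≈⟨ ∫-cong F (λ u → ∫-⋆ G H _) ⟨
    ∫ F (λ u → ∫ (G ⋆ H) λ y → ∫ (u ⊛ y) φ)                          ≈⟨ ∫-⋆ F (G ⋆ H) φ ⟨
    ∫ (F ⋆ (G ⋆ H)) φ                                                ∎
    where open ≈-Reasoning

  ⋆-zeroˡ : ∀ F → 𝟘 ⋆ F ≃ 𝟘
  ⋆-zeroˡ F = ≃.refl

  ⋆-zeroʳ : ∀ F → F ⋆ 𝟘 ≃ 𝟘
  ⋆-zeroʳ F = by-∫ λ φ → trans (∫-⋆ F 𝟘 φ) (trans (∫-cong F λ u → ∫-[] _) (trans (∫-0 F) (sym (∫-[] _))))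

  ⋆-distribˡ : ∀ F G H → F ⋆ (G ⊕ H) ≃ (F ⋆ G) ⊕ (F ⋆ H)
  ⋆-distribˡ F G H = by-∫ λ φ → trans (∫-⋆ F (G ⊕ H) φ) (trans (∫-cong F λ u → ∫-⊕ G H _) (trans (∫-+ F _ _)
    (sym (trans (∫-⊕ (F ⋆ G) (F ⋆ H) φ) (+-cong (∫-⋆ F G φ) (∫-⋆ F H φ))))))

  ⋆-distribʳ : ∀ F G H → (G ⊕ H) ⋆ F ≃ (G ⋆ F) ⊕ (H ⋆ F)
  ⋆-distribʳ F G H = by-∫ λ φ → trans (∫-⋆ (G ⊕ H) F φ) (trans (∫-⊕ G H _)
    (sym (trans (∫-⊕ (G ⋆ F) (H ⋆ F) φ) (+-cong (∫-⋆ G F φ) (∫-⋆ H F φ)))))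

  •-⋆ˡ : ∀ a F G → (a • F) ⋆ G ≃ a • (F ⋆ G)
  •-⋆ˡ a F G = by-∫ λ φ → trans (∫-⋆ (a • F) G φ) (trans (∫-• a F _)
    (sym (trans (∫-• a (F ⋆ G) φ) (*-congˡ (∫-⋆ F G φ)))))

  •-⋆ʳ : ∀ a F G → F ⋆ (a • G) ≃ a • (F ⋆ G)
  •-⋆ʳ a F G = by-∫ λ φ → trans (∫-⋆ F (a • G) φ) (trans (∫-cong F λ u → ∫-• a G _) (trans (∫-*ˡ F a _)
    (sym (trans (∫-• a (F ⋆ G) φ) (*-congˡ (∫-⋆ F G φ))))))

  -- The derivation on Sym

  ∂ : Sym → Sym
  ∂ F = F >>= ∂ʷ

  ∫-∂ : ∀ F φ → ∫ (∂ F) φ ≈ ∫ F (λ w → ∫ (∂ʷ w) φ)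
  ∫-∂ F φ = ∫->>= F ∂ʷ φ

  ∂-cong : ∀ {F G} → F ≃ G → ∂ F ≃ ∂ G
  ∂-cong {F} {G} F≃G = by-∫ λ φ → trans (∫-∂ F φ) (trans (at F≃G _) (sym (∫-∂ G φ)))

  ∂-⊕ : ∀ F G → ∂ (F ⊕ G) ≃ ∂ F ⊕ ∂ G
  ∂-⊕ F G = by-∫ λ φ → trans (∫-∂ (F ⊕ G) φ) (trans (∫-⊕ F G _)
    (sym (trans (∫-⊕ (∂ F) (∂ G) φ) (+-cong (∫-∂ F φ) (∫-∂ G φ)))))

  ∂-· : ∀ F G → ∂ (F · G) ≃ ∂ F · G ⊕ F · ∂ G
  ∂-· F G = by-∫ λ φ → begin
    ∫ (∂ (F · G)) φ
      ≈⟨ trans (∫-∂ (F · G) φ) (∫-· F G _) ⟩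
    ∫ F (λ u → ∫ G λ v → ∫ (∂ʷ (u ++ v)) φ)
      ≈⟨ ∫-cong F (λ u → trans (∫-cong G λ v → ∂ʷ-++ u v φ) (∫-+ G _ _)) ⟩
    ∫ F (λ u → ∫ G (λ v → ∫ (∂ʷ u) λ x → φ (x ++ v)) + ∫ G (λ v → ∫ (∂ʷ v) λ y → φ (u ++ y)))
      ≈⟨ ∫-+ F _ _ ⟩
    ∫ F (λ u → ∫ G λ v → ∫ (∂ʷ u) λ x → φ (x ++ v)) + ∫ F (λ u → ∫ G λ v → ∫ (∂ʷ v) λ y → φ (u ++ y))
      ≈⟨ +-cong
           (trans (∫-· (∂ F) G φ) (trans (∫-∂ F _) (∫-cong F λ u → ∫-swap (∂ʷ u) G _)))
           (trans (∫-· F (∂ G) φ) (∫-cong F λ u → ∫-∂ G _)) ⟨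
    ∫ (∂ F · G) φ + ∫ (F · ∂ G) φ
      ≈⟨ ∫-⊕ (∂ F · G) (F · ∂ G) φ ⟨
    ∫ (∂ F · G ⊕ F · ∂ G) φ ∎
    where open ≈-Reasoning

  ∂-·-const : ∀ F {G} → ∂ G ≃ 𝟘 → ∂ (F · G) ≃ ∂ F · G
  ∂-·-const F {G} ∂G≃𝟘 = begin
    ∂ (F · G)           ≈⟨ ∂-· F G ⟩
    ∂ F · G ⊕ F · ∂ G   ≈⟨ ⊕-cong (≃.refl {∂ F · G}) (≃.trans (·-congˡ {F} ∂G≃𝟘) (·-zeroʳ F)) ⟩
    ∂ F · G ⊕ 𝟘         ≈⟨ ⊕-identityʳ (∂ F · G) ⟩
    ∂ F · G             ∎
    where open ≃-Reasoning

  ∂-S-0 : ∂ (S 0) ≃ 𝟘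
  ∂-S-0 = by-∫ λ φ → trans (∫-∂ (S 0) φ) (∫-𝟙 _)

  ∂-S-suc : ∀ n → ∂ (S (suc n)) ≃ S n
  ∂-S-suc n = by-∫ λ φ → begin
    ∫ (∂ (S (suc n))) φ                      ≈⟨ trans (∫-∂ (S (suc n)) φ) (∫-S (suc n) _) ⟩
    ∫ (∂ʷ (n ∷ [])) φ                        ≈⟨ ∂ʷ-∷ n [] φ ⟩
    φ (n ▹ []) + ∫ [] (λ u → φ (n ∷ u))      ≈⟨ trans (+-congˡ (∫-[] _)) (+-identityʳ _) ⟩
    φ (n ▹ [])                               ≈⟨ ∫-S n φ ⟨
    ∫ (S n) φ                                ∎
    where open ≈-Reasoning

  -- Homogeneous elements

  -- The list F may contain words of other degrees whose coefficients cancel. Truncation to degree n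
  -- discards them without changing any coefficient, and `≋⇒≃` carries this over to integrals.
  Sym[]⇒homogeneous : ∀ {n F} → F ∈ Sym[ n ] → Homogeneous n F
  Sym[]⇒homogeneous {n} {F} F∈ {φ} {ψ} eq = begin
    ∫ F φ                                            ≈⟨ restrict φ ⟩
    ∫ F (λ w → ⟦ degree w ℕ.≟ n ⟧ * φ w)             ≈⟨ ∫-cong F (λ w → ⟦⟧-guard (degree w ℕ.≟ n) (eq w)) ⟩
    ∫ F (λ w → ⟦ degree w ℕ.≟ n ⟧ * ψ w)             ≈⟨ restrict ψ ⟨
    ∫ F ψ                                            ∎
    where
    open ≈-Reasoning
    Fₙ : Sym
    Fₙ = F >>= λ w → scale ⟦ degree w ℕ.≟ n ⟧ (η w)
    ∫-Fₙ : ∀ φ → ∫ Fₙ φ ≈ ∫ F (λ w → ⟦ degree w ℕ.≟ n ⟧ * φ w)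
    ∫-Fₙ φ = trans (∫->>= F _ φ) (∫-cong F λ w → trans (∫-scale _ (η w) φ) (*-congˡ (∫-η w φ)))
    coeff-Fₙ : ∀ w → coeff Fₙ w ≈ ⟦ degree w ℕ.≟ n ⟧ * coeff F w
    coeff-Fₙ w = begin
      coeff Fₙ w                                                  ≈⟨ trans (coeff-∫ Fₙ w) (∫-Fₙ _) ⟩
      ∫ F (λ u → ⟦ degree u ℕ.≟ n ⟧ * ⟦ u ≟ʷ w ⟧)                 ≈⟨ ∫-cong F (λ u → trans (*-comm _ _) (⟦⟧-guard (u ≟ʷ w) λ u≡w → reflexive (≡.cong (λ v → ⟦ degree v ℕ.≟ n ⟧) u≡w))) ⟩
      ∫ F (λ u → ⟦ u ≟ʷ w ⟧ * ⟦ degree w ℕ.≟ n ⟧)                 ≈⟨ ∫-*ʳ F _ _ ⟩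
      ∫ F (λ u → ⟦ u ≟ʷ w ⟧) * ⟦ degree w ℕ.≟ n ⟧                 ≈⟨ trans (*-congʳ (sym (coeff-∫ F w))) (*-comm _ _) ⟩
      ⟦ degree w ℕ.≟ n ⟧ * coeff F w                              ∎
    F≋Fₙ : F ≋ Fₙ
    F≋Fₙ w with degree w ℕ.≟ n
    ... | yes w≡n = sym (trans (coeff-Fₙ w) (⟦⟧-yes (degree w ℕ.≟ n) w≡n))
    ... | no  w≢n = trans (F∈ w w≢n) (sym (trans (coeff-Fₙ w) (⟦⟧-no (degree w ℕ.≟ n) w≢n)))
    restrict : ∀ φ → ∫ F φ ≈ ∫ F (λ w → ⟦ degree w ℕ.≟ n ⟧ * φ w)
    restrict φ = trans (at (≋⇒≃ {F} {Fₙ} F≋Fₙ) φ) (∫-Fₙ φ)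

  homogeneous⇒Sym[] : ∀ {n F} → Homogeneous n F → F ∈ Sym[ n ]
  homogeneous⇒Sym[] {n} {F} hom w w≢n = trans (coeff-∫ F w) (trans
    (hom λ u u≡n → trans (sym (*-identityʳ _))
      (⟦⟧-no (u ≟ʷ w) λ u≡w → w≢n (≡.trans (≡.cong degree (≡.sym u≡w)) u≡n)))
    (∫-0 F))

  homogeneous-resp : ∀ {n F G} → F ≃ G → Homogeneous n F → Homogeneous n G
  homogeneous-resp F≃G hom eq = trans (sym (at F≃G _)) (trans (hom eq) (at F≃G _))

  homogeneous-𝟘 : ∀ {n} → Homogeneous n 𝟘
  homogeneous-𝟘 eq = trans (∫-[] _) (sym (∫-[] _))

  homogeneous-⊕ : ∀ {n F G} → Homogeneous n F → Homogeneous n G → Homogeneous n (F ⊕ G)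
  homogeneous-⊕ {n} {F} {G} homF homG eq =
    trans (∫-⊕ F G _) (trans (+-cong (homF eq) (homG eq)) (sym (∫-⊕ F G _)))

  homogeneous-• : ∀ a {n F} → Homogeneous n F → Homogeneous n (a • F)
  homogeneous-• a {F = F} hom eq = trans (∫-• a F _) (trans (*-congˡ (hom eq)) (sym (∫-• a F _)))

  homogeneous-· : ∀ {m n F G} → Homogeneous m F → Homogeneous n G → Homogeneous (m ℕ.+ n) (F · G)
  homogeneous-· {F = F} {G} homF homG eq = trans (∫-· F G _) (trans
    (homF λ u u≡m → homG λ v v≡n → eq (u ++ v) (≡.trans (degree-++ u v) (≡.cong₂ ℕ._+_ u≡m v≡n)))
    (sym (∫-· F G _)))

  homogeneous-⋆ : ∀ {n F} G → Homogeneous n F → Homogeneous n (F ⋆ G)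
  homogeneous-⋆ {F = F} G homF eq = trans (∫-⋆ F G _) (trans
    (homF λ u u≡n → ∫-cong G λ v → ⊛-cong u v λ u≡v w w≡v → eq w (≡.trans w≡v (≡.trans (≡.sym u≡v) u≡n)))
    (sym (∫-⋆ F G _)))

  homogeneous-S : ∀ n → Homogeneous n (S n)
  homogeneous-S n eq = trans (∫-S n _) (trans
    (eq (n ▹ []) (≡.trans (degree-▹ n []) (ℕ.+-identityʳ n))) (sym (∫-S n _)))

  homogeneous-∂ : ∀ {n F} → Homogeneous (suc n) F → Homogeneous n (∂ F)
  homogeneous-∂ {F = F} hom eq = trans (∫-∂ F _) (trans
    (hom λ w w≡1+n → ∂ʷ-cong w λ u 1+u≡w → eq u (ℕ.suc-injective (≡.trans 1+u≡w w≡1+n)))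
    (sym (∫-∂ F _)))

  -- Units and group-like right factors

  -- A matrix with a single row is its vector of column sums. In terms of Δ, no rows remain after
  -- the first, so the right counit applies.
  S-⋆ : ∀ {n G} → Homogeneous n G → S n ⋆ G ≃ G
  S-⋆ {n} {G} hom = by-∫ λ φ → trans (∫-⋆ (S n) G φ) (trans (∫-S n _)
    (hom λ v v≡n → trans (unit v φ) (⟦⟧-yes (degree v ℕ.≟ n) v≡n)))
    where
    open ≈-Reasoning
    unit : ∀ v φ → ∫ ((n ▹ []) ⊛ v) φ ≈ ⟦ degree v ℕ.≟ n ⟧ * φ v
    unit v φ = begin
      ∫ ((n ▹ []) ⊛ v) φ
        ≈⟨ ⊛-▹ n [] v φ ⟩
      ∫ (Δ v) (λ (r , s) → ⟦ degree r ℕ.≟ n ⟧ * ∫ ([] ⊛ s) λ w → φ (r ++ w))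
        ≈⟨ ∫-cong (Δ v) (λ (r , s) → trans (*-congˡ (⊛-[] s _)) (x∙yz≈y∙xz _ _ _)) ⟩
      ∫ (Δ v) (λ (r , s) → ⟦ degree s ℕ.≟ 0 ⟧ * (⟦ degree r ℕ.≟ n ⟧ * φ (r ++ [])))
        ≈⟨ Δ-counitʳ v (λ r _ → ⟦ degree r ℕ.≟ n ⟧ * φ (r ++ [])) ⟩
      ⟦ degree v ℕ.≟ n ⟧ * φ (v ++ [])
        ≈⟨ *-congˡ (reflexive (≡.cong φ (List.++-identityʳ v))) ⟩
      ⟦ degree v ℕ.≟ n ⟧ * φ v ∎

  ⋆-groupLike : ∀ {γ n F} → GroupLike γ → Homogeneous n F → F ⋆ γ n ≃ (F >>= eval γ)
  ⋆-groupLike {γ} {n} {F} gl hom = by-∫ λ φ → trans (∫-⋆ F (γ n) φ) (trans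
    (hom λ u u≡n → trans (⊛-groupLike gl u n φ) (⟦⟧-yes (degree u ℕ.≟ n) u≡n))
    (sym (∫->>= F (eval γ) φ)))

  S-groupLike : GroupLike S
  S-groupLike = GroupLike-resp (λ n φ → trans (∫-η _ φ) (sym (∫-S n φ))) letter-groupLike

  -- The sequence S is itself group-like, and the endomorphism that it induces fixes every
  -- generator.
  ⋆-S : ∀ {n F} → Homogeneous n F → F ⋆ S n ≃ F
  ⋆-S {n} {F} hom = ≃.trans (⋆-groupLike S-groupLike hom)
    (by-∫ λ φ → trans (∫->>= F (eval S) φ) (∫-cong F λ w → eval-S w φ))
    where
    eval-S : ∀ w φ → ∫ (eval S w) φ ≈ φ w
    eval-S []      φ = ∫-η [] φ
    eval-S (m ∷ w) φ = trans (eval-∷ S m w φ) (trans (∫-S (suc m) _) (eval-S w _))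

  -- Exponentials

  inv-inverseˡ : ∀ n .{{_ : ℕ.NonZero n}} → inv n * fromℕ n ≈ 1#
  inv-inverseˡ n = trans (*-congˡ (sym (trans (+-congˡ -0≈0) (+-identityʳ _))))
    (proj₁ (proj₂ (#⇒invertible (char0 n))))
    where
    -0≈0 : - 0# ≈ 0#
    -0≈0 = trans (sym (+-identityˡ _)) (-‿inverseʳ 0#)

  invFact-0 : invFact 0 ≈ 1#
  invFact-0 = trans (sym (*-identityʳ _)) (trans (*-congˡ (sym (+-identityʳ 1#))) (inv-inverseˡ 1))

  fromℕ-* : ∀ m n → fromℕ (m ℕ.* n) ≈ fromℕ m * fromℕ n
  fromℕ-* zero    n = sym (zeroˡ _)
  fromℕ-* (suc m) n = trans (fromℕ-+ n (m ℕ.* n)) (trans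
    (+-cong (sym (*-identityˡ _)) (fromℕ-* m n)) (sym (distribʳ _ _ _)))

  cancellative : Cancellative
  cancellative n {x} {y} eq = begin
    x                                      ≈⟨ unscale x ⟨
    inv (suc n) * (fromℕ (suc n) * x)      ≈⟨ *-congˡ eq ⟩
    inv (suc n) * (fromℕ (suc n) * y)      ≈⟨ unscale y ⟩
    y                                      ∎
    where
    open ≈-Reasoning
    unscale : ∀ x → inv (suc n) * (fromℕ (suc n) * x) ≈ x
    unscale x = trans (sym (*-assoc _ _ _)) (trans (*-congʳ (inv-inverseˡ (suc n))) (*-identityˡ x))

  invFact-suc : ∀ n → fromℕ (suc n) * invFact (suc n) ≈ invFact n
  invFact-suc n = begin
    fromℕ (suc n) * invFact (suc n)
      ≈⟨ *-identityˡ _ ⟨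
    1# * (fromℕ (suc n) * invFact (suc n))
      ≈⟨ *-congʳ (inv-inverseˡ (n !) {{n ℕ.!≢0}}) ⟨
    (invFact n * fromℕ (n !)) * (fromℕ (suc n) * invFact (suc n))
      ≈⟨ *-assoc _ _ _ ⟩
    invFact n * (fromℕ (n !) * (fromℕ (suc n) * invFact (suc n)))
      ≈⟨ *-congˡ (trans (sym (*-assoc _ _ _)) (trans
           (*-congʳ (trans (*-comm _ _) (sym (fromℕ-* (suc n) (n !))))) (*-comm _ _))) ⟩
    invFact n * (invFact (suc n) * fromℕ (suc n !))
      ≈⟨ *-congˡ (inv-inverseˡ (suc n !) {{suc n ℕ.!≢0}}) ⟩
    invFact n * 1#
      ≈⟨ *-identityʳ _ ⟩
    invFact n ∎
    where open ≈-Reasoning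

  -- The coefficients of exp(x) and exp(-x).
  e⁺ e⁻ : ℕ → Carrier
  e⁺ n = invFact n
  e⁻ n = (- 1#) ^ᴷ n * invFact n

  e⁺-exponential : IsExponential 1# e⁺
  e⁺-exponential = record
    { e-0   = invFact-0
    ; e-suc = λ n → trans (invFact-suc n) (sym (*-identityˡ _))
    }

  e⁻-exponential : IsExponential (- 1#) e⁻
  e⁻-exponential = record
    { e-0   = trans (*-identityˡ _) invFact-0
    ; e-suc = λ n → trans (x∙yz≈y∙xz _ _ _) (trans (*-congˡ (invFact-suc n)) (*-assoc _ _ _))
    }

  pow : (ℕ → Carrier) → ℕ → Sym
  pow e n = e n • (S 1 ^ n)

  E : ℕ → Sym
  E = pow e⁺

  ∫-S₁^ : ∀ n φ → ∫ (S 1 ^ n) φ ≈ φ (List.replicate n 0)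
  ∫-S₁^ zero    φ = ∫-𝟙 φ
  ∫-S₁^ (suc n) φ = trans (∫-· (S 1) (S 1 ^ n) φ) (trans (∫-S 1 _) (∫-S₁^ n _))

  ∫-pow : ∀ e n φ → ∫ (pow e n) φ ≈ e n * φ (List.replicate n 0)
  ∫-pow e n φ = trans (∫-• (e n) (S 1 ^ n) φ) (*-congˡ (∫-S₁^ n φ))

  pow-groupLike : ∀ {t e} → IsExponential t e → GroupLike (pow e)
  pow-groupLike {e = e} isExp = GroupLike-resp
    (λ n φ → trans (∫-power e n φ) (sym (∫-pow e n φ))) (power-groupLike cancellative isExp)

  ∫-sum-splits : ∀ n (f : ℕ → ℕ → Sym) φ →
    ∫ (sum {suc n} λ i → f (toℕ i) (n ∸ toℕ i)) φ ≈ ∫ (splits n) (λ (a , b) → ∫ (f a b) φ)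
  ∫-sum-splits zero    f φ = trans (at (⊕-identityʳ (f 0 0)) φ) (sym (splits-0 _))
  ∫-sum-splits (suc n) f φ = trans (∫-⊕ (f 0 (suc n)) _ φ) (trans
    (+-congˡ (∫-sum-splits n (λ a b → f (suc a) b) φ)) (sym (splits-suc n _)))

  ∫-S♯ : ∀ n φ → ∫ (S♯ n) φ ≈ ∫ (splits n) (λ (a , b) → ∫ (pow e⁻ a · S b) φ)
  ∫-S♯ n φ = ∫-sum-splits n (λ a b → pow e⁻ a · S b) φ

  -- The series of S♯ is exp(-S₁) · Σ Sₙ, a product of two group-like series.
  S♯-groupLike : GroupLike S♯
  S♯-groupLike = GroupLike-resp
    (λ n φ → trans (∫-convolve (pow e⁻) S n φ) (sym (trans (∫-S♯ n φ)
      (∫-cong (splits n) λ (a , b) → ∫-· (pow e⁻ a) (S b) φ))))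
    (convolve-groupLike (pow-groupLike e⁻-exponential) S-groupLike)

  ∂-pow-0 : ∀ e → ∂ (pow e 0) ≃ 𝟘
  ∂-pow-0 e = by-∫ λ φ → trans (∫-∂ (pow e 0) φ) (trans (∫-pow e 0 _) (trans
    (*-congˡ (∫-[] φ)) (trans (zeroʳ _) (sym (∫-[] φ)))))

  ∂-pow-suc : ∀ {t e} → IsExponential t e → ∀ n → ∂ (pow e (suc n)) ≃ t • pow e n
  ∂-pow-suc {t} {e} isExp n = by-∫ λ φ → begin
    ∫ (∂ (pow e (suc n))) φ                                        ≈⟨ trans (∫-∂ (pow e (suc n)) φ) (∫-pow e (suc n) _) ⟩
    e (suc n) * ∫ (∂ʷ (List.replicate (suc n) 0)) φ                ≈⟨ *-congˡ (∂ʷ-replicate n φ) ⟩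
    e (suc n) * (fromℕ (suc n) * φ (List.replicate n 0))           ≈⟨ trans (sym (*-assoc _ _ _)) (*-congʳ (*-comm _ _)) ⟩
    (fromℕ (suc n) * e (suc n)) * φ (List.replicate n 0)           ≈⟨ trans (*-congʳ (e-suc n)) (*-assoc _ _ _) ⟩
    t * (e n * φ (List.replicate n 0))                             ≈⟨ *-congˡ (∫-pow e n φ) ⟨
    t * ∫ (pow e n) φ                                              ≈⟨ ∫-• t (pow e n) φ ⟨
    ∫ (t • pow e n) φ                                              ∎
    where
    open ≈-Reasoning
    open IsExponential isExp

  1•-identity : ∀ F → 1# • F ≃ F
  1•-identity F = by-∫ λ φ → trans (∫-• 1# F φ) (*-identityˡ _)

  ∂-E-suc : ∀ n → ∂ (E (suc n)) ≃ E n
  ∂-E-suc n = ≃.trans (∂-pow-suc e⁺-exponential n) (1•-identity (E n))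

  -- In generating series in z, ∂ multiplies exp(-z S₁) by -z and Σ Sₘ zᵐ by z. The two halves of
  -- the product rule thus cancel, once the first is shifted at the lower end of the sum and the
  -- second at the upper end.
  ∂-S♯ : ∀ n → ∂ (S♯ n) ≃ 𝟘
  ∂-S♯ n = by-∫ λ φ → begin
    ∫ (∂ (S♯ n)) φ
      ≈⟨ trans (∫-∂ (S♯ n) φ) (∫-S♯ n _) ⟩
    ∫ (splits n) (λ (a , b) → ∫ (pow e⁻ a · S b) λ w → ∫ (∂ʷ w) φ)
      ≈⟨ ∫-cong (splits n) (λ (a , b) → trans (sym (∫-∂ (pow e⁻ a · S b) φ)) (trans
           (at (∂-· (pow e⁻ a) (S b)) φ) (∫-⊕ (∂ (pow e⁻ a) · S b) (pow e⁻ a · ∂ (S b)) φ))) ⟩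
    ∫ (splits n) (λ (a , b) → ∫ (∂ (pow e⁻ a) · S b) φ + ∫ (pow e⁻ a · ∂ (S b)) φ)
      ≈⟨ ∫-+ (splits n) _ _ ⟩
    ∫ (splits n) (λ (a , b) → ∫ (∂ (pow e⁻ a) · S b) φ) + ∫ (splits n) (λ (a , b) → ∫ (pow e⁻ a · ∂ (S b)) φ)
      ≈⟨ telescope n φ ⟩
    0#
      ≈⟨ ∫-[] φ ⟨
    ∫ 𝟘 φ ∎
    where
    open ≈-Reasoning
    ∂e-0 : ∀ b φ → ∫ (∂ (pow e⁻ 0) · S b) φ ≈ 0#
    ∂e-0 b φ = trans (at (·-congʳ {G = S b} (∂-pow-0 e⁻)) φ) (∫-[] φ)
    ∂S-0 : ∀ a φ → ∫ (pow e⁻ a · ∂ (S 0)) φ ≈ 0#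
    ∂S-0 a φ = trans (at (≃.trans (·-congˡ {pow e⁻ a} ∂-S-0) (·-zeroʳ (pow e⁻ a))) φ) (∫-[] φ)
    telescope : ∀ n φ →
      ∫ (splits n) (λ (a , b) → ∫ (∂ (pow e⁻ a) · S b) φ) + ∫ (splits n) (λ (a , b) → ∫ (pow e⁻ a · ∂ (S b)) φ) ≈ 0#
    telescope zero    φ = trans (+-cong (trans (splits-0 _) (∂e-0 0 φ)) (trans (splits-0 _) (∂S-0 0 φ))) (+-identityˡ 0#)
    telescope (suc n) φ = begin
      ∫ (splits (suc n)) (λ (a , b) → ∫ (∂ (pow e⁻ a) · S b) φ) + ∫ (splits (suc n)) (λ (a , b) → ∫ (pow e⁻ a · ∂ (S b)) φ)
        ≈⟨ +-cong (trans (splits-suc n _) (trans (+-congʳ (∂e-0 (suc n) φ)) (+-identityˡ _)))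
                  (trans (splits-sucʳ n _) (trans (+-congˡ (∂S-0 (suc n) φ)) (+-identityʳ _))) ⟩
      ∫ (splits n) (λ (a , b) → ∫ (∂ (pow e⁻ (suc a)) · S b) φ) + ∫ (splits n) (λ (a , b) → ∫ (pow e⁻ a · ∂ (S (suc b))) φ)
        ≈⟨ +-cong
             (∫-cong (splits n) λ (a , b) → trans
               (at (≃.trans (·-congʳ {G = S b} (∂-pow-suc e⁻-exponential a)) (•-·ˡ (- 1#) (pow e⁻ a) (S b))) φ)
               (trans (∫-• (- 1#) (pow e⁻ a · S b) φ) (-1*x≈-x _)))
             (∫-cong (splits n) λ (a , b) → at (·-congˡ {pow e⁻ a} (∂-S-suc b)) φ) ⟩
      ∫ (splits n) (λ (a , b) → - ∫ (pow e⁻ a · S b) φ) + ∫ (splits n) (λ (a , b) → ∫ (pow e⁻ a · S b) φ)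
        ≈⟨ ∫-+ (splits n) _ _ ⟨
      ∫ (splits n) (λ (a , b) → - ∫ (pow e⁻ a · S b) φ + ∫ (pow e⁻ a · S b) φ)
        ≈⟨ trans (∫-cong (splits n) λ _ → -‿inverseˡ _) (∫-0 (splits n)) ⟩
      0# ∎

  -- The morphism Sₘ ↦ S♯ₘ

  ρ : Sym → Sym
  ρ F = F >>= eval S♯

  ∫-ρ : ∀ F φ → ∫ (ρ F) φ ≈ ∫ F (λ u → ∫ (eval S♯ u) φ)
  ∫-ρ F φ = ∫->>= F (eval S♯) φ

  ρ-cong : ∀ {F G} → F ≃ G → ρ F ≃ ρ G
  ρ-cong {F} {G} F≃G = by-∫ λ φ → trans (∫-ρ F φ) (trans (at F≃G _) (sym (∫-ρ G φ)))

  ⋆-S♯ : ∀ {n F} → Homogeneous n F → F ⋆ S♯ n ≃ ρ F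
  ⋆-S♯ = ⋆-groupLike S♯-groupLike

  homogeneous-S♯ : ∀ n → Homogeneous n (S♯ n)
  homogeneous-S♯ = GroupLike.homogeneous S♯-groupLike

  homogeneous-ρ : ∀ {n F} → Homogeneous n F → Homogeneous n (ρ F)
  homogeneous-ρ {n} {F} hom = homogeneous-resp (⋆-S♯ hom) (homogeneous-⋆ {F = F} (S♯ n) hom)

  -- The instance of multiplicativity of ρ by which a left factor S♯ₙ is absorbed into D⁰.
  S♯-·-ρ : ∀ n F → S♯ n · ρ F ≃ ρ (S n · F)
  S♯-·-ρ n F = by-∫ λ φ → begin
    ∫ (S♯ n · ρ F) φ
      ≈⟨ trans (∫-· (S♯ n) (ρ F) φ) (∫-cong (S♯ n) λ x → ∫-ρ F _) ⟩
    ∫ (S♯ n) (λ x → ∫ F λ u → ∫ (eval S♯ u) λ y → φ (x ++ y))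
      ≈⟨ ∫-swap (S♯ n) F _ ⟩
    ∫ F (λ u → ∫ (S♯ n) λ x → ∫ (eval S♯ u) λ y → φ (x ++ y))
      ≈⟨ ∫-cong F (λ u → trans (reflexive (≡.cong (λ w → ∫ (eval S♯ w) φ) (▹-++ n [] u))) (eval-▹ S♯-groupLike n u φ)) ⟨
    ∫ F (λ u → ∫ (eval S♯ ((n ▹ []) ++ u)) φ)
      ≈⟨ trans (∫-ρ (S n · F) φ) (trans (∫-· (S n) F _) (∫-S n _)) ⟨
    ∫ (ρ (S n · F)) φ ∎
    where open ≈-Reasoning

  ρ-S : ∀ n → ρ (S n) ≃ S♯ n
  ρ-S n = ≃.trans (≃.sym (⋆-S♯ (homogeneous-S n))) (S-⋆ (homogeneous-S♯ n))

  ∂-ρ : ∀ F → ∂ (ρ F) ≃ 𝟘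
  ∂-ρ F = by-∫ λ φ → trans (∫-∂ (ρ F) φ) (trans (∫-ρ F _) (trans
    (∫-cong F λ u → trans (∂-eval u φ) (∫-[] φ)) (trans (∫-0 F) (sym (∫-[] φ)))))
    where
    open ≈-Reasoning
    ∂-eval : ∀ u φ → ∫ (eval S♯ u) (λ w → ∫ (∂ʷ w) φ) ≈ ∫ 𝟘 φ
    ∂-eval []      φ = ∫-η [] _
    ∂-eval (m ∷ u) φ = begin
      ∫ (eval S♯ (m ∷ u)) (λ w → ∫ (∂ʷ w) φ)
        ≈⟨ trans (eval-∷ S♯ m u _) (sym (∫-· (S♯ (suc m)) (eval S♯ u) _)) ⟩
      ∫ (S♯ (suc m) · eval S♯ u) (λ w → ∫ (∂ʷ w) φ)
        ≈⟨ ∫-∂ (S♯ (suc m) · eval S♯ u) φ ⟨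
      ∫ (∂ (S♯ (suc m) · eval S♯ u)) φ
        ≈⟨ at (∂-·-const (S♯ (suc m)) (by-∫ λ ψ → trans (∫-∂ (eval S♯ u) ψ) (∂-eval u ψ))) φ ⟩
      ∫ (∂ (S♯ (suc m)) · eval S♯ u) φ
        ≈⟨ at (·-congʳ {G = eval S♯ u} (∂-S♯ (suc m))) φ ⟩
      ∫ 𝟘 φ ∎

  -- Left multiplication by S₁ acts through ∂

  ∂^ : ℕ → Sym → Sym
  ∂^ zero    F = F
  ∂^ (suc i) F = ∂^ i (∂ F)

  ∂^-cong : ∀ i {F G} → F ≃ G → ∂^ i F ≃ ∂^ i G
  ∂^-cong zero    F≃G = F≃G
  ∂^-cong (suc i) F≃G = ∂^-cong i (∂-cong F≃G)

  ∂^-𝟘 : ∀ i → ∂^ i 𝟘 ≃ 𝟘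
  ∂^-𝟘 zero    = ≃.refl
  ∂^-𝟘 (suc i) = ∂^-𝟘 i

  homogeneous-∂^ : ∀ i {j F} → Homogeneous (i ℕ.+ j) F → Homogeneous j (∂^ i F)
  homogeneous-∂^ zero            hom = hom
  homogeneous-∂^ (suc i) {F = F} hom = homogeneous-∂^ i (homogeneous-∂ {F = F} hom)

  -- A first row of sum 1 selects the terms of the coproduct of G with left factor S₁, and by `Δ-∂ʷ`
  -- their right factors add up to ∂ G.
  S₁·-⋆ : ∀ F G → (S 1 · F) ⋆ G ≃ S 1 · (F ⋆ ∂ G)
  S₁·-⋆ F G = by-∫ λ φ → begin
    ∫ ((S 1 · F) ⋆ G) φ
      ≈⟨ trans (∫-⋆ (S 1 · F) G φ) (trans (∫-· (S 1) F _) (∫-S 1 _)) ⟩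
    ∫ F (λ u → ∫ G λ v → ∫ ((0 ∷ u) ⊛ v) φ)
      ≈⟨ ∫-cong F (λ u → ∫-cong G λ v → trans (⊛-∷ 0 u v φ) (Δ-∂ʷ v λ r s → ∫ (u ⊛ s) λ w → φ (r ++ w))) ⟩
    ∫ F (λ u → ∫ G λ v → ∫ (∂ʷ v) λ s → ∫ (u ⊛ s) λ w → φ (0 ∷ w))
      ≈⟨ ∫-cong F (λ u → ∫-∂ G _) ⟨
    ∫ F (λ u → ∫ (∂ G) λ s → ∫ (u ⊛ s) λ w → φ (0 ∷ w))
      ≈⟨ trans (∫-· (S 1) (F ⋆ ∂ G) φ) (trans (∫-S 1 _) (∫-⋆ F (∂ G) _)) ⟨
    ∫ (S 1 · (F ⋆ ∂ G)) φ ∎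
    where open ≈-Reasoning

  S₁^·-⋆ : ∀ i F G → (S 1 ^ i · F) ⋆ G ≃ S 1 ^ i · (F ⋆ ∂^ i G)
  S₁^·-⋆ zero    F G = ≃.trans (⋆-congʳ {G = G} (·-identityˡ F)) (≃.sym (·-identityˡ (F ⋆ G)))
  S₁^·-⋆ (suc i) F G = begin
    (S 1 · S 1 ^ i · F) ⋆ G              ≈⟨ ⋆-congʳ {G = G} (·-assoc (S 1) (S 1 ^ i) F) ⟩
    (S 1 · (S 1 ^ i · F)) ⋆ G            ≈⟨ S₁·-⋆ (S 1 ^ i · F) G ⟩
    S 1 · ((S 1 ^ i · F) ⋆ ∂ G)          ≈⟨ ·-congˡ {S 1} (S₁^·-⋆ i F (∂ G)) ⟩
    S 1 · (S 1 ^ i · (F ⋆ ∂^ i (∂ G)))   ≈⟨ ·-assoc (S 1) (S 1 ^ i) (F ⋆ ∂^ i (∂ G)) ⟨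
    S 1 · S 1 ^ i · (F ⋆ ∂^ i (∂ G))     ∎
    where open ≃-Reasoning

  pow·-⋆ : ∀ e i F G → (pow e i · F) ⋆ G ≃ pow e i · (F ⋆ ∂^ i G)
  pow·-⋆ e i F G = begin
    (pow e i · F) ⋆ G                 ≈⟨ ⋆-congʳ {G = G} (•-·ˡ (e i) (S 1 ^ i) F) ⟩
    (e i • (S 1 ^ i · F)) ⋆ G         ≈⟨ •-⋆ˡ (e i) (S 1 ^ i · F) G ⟩
    e i • ((S 1 ^ i · F) ⋆ G)         ≈⟨ •-cong refl (S₁^·-⋆ i F G) ⟩
    e i • (S 1 ^ i · (F ⋆ ∂^ i G))    ≈⟨ •-·ˡ (e i) (S 1 ^ i) (F ⋆ ∂^ i G) ⟨
    pow e i · (F ⋆ ∂^ i G)            ∎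
    where open ≃-Reasoning

  ∂-E·-zero : ∀ {X} → ∂ X ≃ 𝟘 → ∂ (E 0 · X) ≃ 𝟘
  ∂-E·-zero {X} ∂X≃𝟘 = ≃.trans (∂-·-const (E 0) {X} ∂X≃𝟘) (·-congʳ {G = X} (∂-pow-0 e⁺))

  ∂-E·-suc : ∀ n {X} → ∂ X ≃ 𝟘 → ∂ (E (suc n) · X) ≃ E n · X
  ∂-E·-suc n {X} ∂X≃𝟘 = ≃.trans (∂-·-const (E (suc n)) ∂X≃𝟘) (·-congʳ {G = X} (∂-E-suc n))

  ∂^-E·-≥ : ∀ i d {X} → ∂ X ≃ 𝟘 → ∂^ i (E (i ℕ.+ d) · X) ≃ E d · X
  ∂^-E·-≥ zero    d ∂X≃𝟘 = ≃.refl
  ∂^-E·-≥ (suc i) d ∂X≃𝟘 = ≃.trans (∂^-cong i (∂-E·-suc (i ℕ.+ d) ∂X≃𝟘)) (∂^-E·-≥ i d ∂X≃𝟘)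

  ∂^-E·-< : ∀ l d {X} → ∂ X ≃ 𝟘 → ∂^ (suc (l ℕ.+ d)) (E l · X) ≃ 𝟘
  ∂^-E·-< zero    d {X} ∂X≃𝟘 = ≃.trans (∂^-cong d (∂-E·-zero {X} ∂X≃𝟘)) (∂^-𝟘 d)
  ∂^-E·-< (suc l) d ∂X≃𝟘 = ≃.trans (∂^-cong (suc (l ℕ.+ d)) (∂-E·-suc l ∂X≃𝟘)) (∂^-E·-< l d ∂X≃𝟘)

  E-0-· : ∀ F → E 0 · F ≃ F
  E-0-· F = ≃.trans (·-congʳ {G = F} (≃.trans (•-cong invFact-0 (≃.refl {𝟙})) (1•-identity 𝟙))) (·-identityˡ F)

  homogeneous-pow : ∀ e n → Homogeneous n (pow e n)
  homogeneous-pow e n eq = trans (∫-pow e n _) (trans (*-congˡ (eq _ (degree-replicate n))) (sym (∫-pow e n _)))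

  -- Left multiplication by S♯ₙ acts on Symₙ as Σ (-1)ⁱ S₁ⁱ/i! ∂ⁱ.
  taylor : ∀ b m (Q : ℕ → Sym) {X} → ∂ X ≃ 𝟘 → ∀ φ →
    ∫ (splits (b ℕ.+ m)) (λ (i , _) → ∫ (Q i · ∂^ i (E b · X)) φ) ≈
    ∫ (splits b) (λ (i , j) → ∫ (Q i · (E j · X)) φ)
  taylor zero    zero    Q ∂X≃𝟘 φ = trans (splits-0 _) (sym (splits-0 _))
  -- E 0 · X already lies in ker ∂, so every term with i > 0 vanishes.
  taylor zero    (suc m) Q {X} ∂X≃𝟘 φ = trans (splits-suc m _) (trans
    (+-congˡ (trans (∫-cong (splits m) λ (i , _) → trans
      (at (≃.trans (·-congˡ {Q (suc i)} (≃.trans (∂^-cong i (∂-E·-zero {X} ∂X≃𝟘)) (∂^-𝟘 i))) (·-zeroʳ (Q (suc i)))) φ)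
      (∫-[] φ)) (∫-0 (splits m))))
    (trans (+-identityʳ _) (sym (splits-0 _))))
  -- Lowering b by one shifts the left factors, which is why Q is an arbitrary sequence.
  taylor (suc b) m Q {X} ∂X≃𝟘 φ = trans (splits-suc (b ℕ.+ m) _) (trans
    (+-congˡ (trans
      (∫-cong (splits (b ℕ.+ m)) λ (i , _) → at (·-congˡ {Q (suc i)} (∂^-cong i (∂-E·-suc b ∂X≃𝟘))) φ)
      (taylor b m (λ i → Q (suc i)) ∂X≃𝟘 φ)))
    (sym (splits-suc b _)))

  replicate-++ : ∀ i j → List.replicate i 0 ++ List.replicate j 0 ≡ List.replicate (i ℕ.+ j) 0
  replicate-++ zero    j = ≡.refl
  replicate-++ (suc i) j = ≡.cong (0 ∷_) (replicate-++ i j)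

  -- All terms are multiples of S₁ᵇ X. The scalar collected in front is the coefficient of xᵇ in
  -- exp(-x) exp(x): 1 for b = 0, and 0 otherwise.
  S♯-⋆ : ∀ b {m X} → Homogeneous m X → ∂ X ≃ 𝟘 → ∀ φ →
    ∫ (S♯ (b ℕ.+ m) ⋆ (E b · X)) φ ≈ ∫ (splits b) (λ (i , j) → e⁻ i * e⁺ j) * ∫ X (λ x → φ (List.replicate b 0 ++ x))
  S♯-⋆ b {m} {X} hom ∂X≃𝟘 φ = begin
    ∫ (S♯ (b ℕ.+ m) ⋆ H) φ
      ≈⟨ trans (∫-⋆ (S♯ (b ℕ.+ m)) H φ) (∫-S♯ (b ℕ.+ m) _) ⟩
    ∫ (splits (b ℕ.+ m)) (λ (i , j) → ∫ (pow e⁻ i · S j) λ u → ∫ H λ v → ∫ (u ⊛ v) φ)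
      -- Each S₁ extracted on the left becomes a ∂ on H. What remains is S j ⋆ ∂^ i H, and S j is
      -- the unit in the degree j of ∂^ i H.
      ≈⟨ splits-cong (b ℕ.+ m) (λ i j i+j≡b+m → trans (sym (∫-⋆ (pow e⁻ i · S j) H φ)) (at (≃.trans
           (pow·-⋆ e⁻ i (S j) H)
           (·-congˡ {pow e⁻ i} (S-⋆ (homogeneous-∂^ i {j} {H} (≡.subst (λ d → Homogeneous d H) (≡.sym i+j≡b+m) homH))))) φ)) ⟩
    ∫ (splits (b ℕ.+ m)) (λ (i , _) → ∫ (pow e⁻ i · ∂^ i H) φ)
      ≈⟨ taylor b m (pow e⁻) ∂X≃𝟘 φ ⟩
    ∫ (splits b) (λ (i , j) → ∫ (pow e⁻ i · (E j · X)) φ)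
      ≈⟨ splits-cong b (λ i j i+j≡b → begin
           ∫ (pow e⁻ i · (E j · X)) φ
             ≈⟨ trans (∫-· (pow e⁻ i) (E j · X) φ) (∫-pow e⁻ i _) ⟩
           e⁻ i * ∫ (E j · X) (λ w → φ (List.replicate i 0 ++ w))
             ≈⟨ *-congˡ (trans (∫-· (E j) X _) (∫-pow e⁺ j _)) ⟩
           e⁻ i * (e⁺ j * ∫ X (λ x → φ (List.replicate i 0 ++ (List.replicate j 0 ++ x))))
             ≈⟨ trans (sym (*-assoc _ _ _)) (*-congˡ (∫-cong X λ x → reflexive (≡.cong φ (≡.trans
                  (≡.sym (List.++-assoc (List.replicate i 0) (List.replicate j 0) x))
                  (≡.cong (_++ x) (≡.trans (replicate-++ i j) (≡.cong (λ k → List.replicate k 0) i+j≡b))))))) ⟩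
           (e⁻ i * e⁺ j) * ∫ X (λ x → φ (List.replicate b 0 ++ x)) ∎) ⟩
    ∫ (splits b) (λ (i , j) → (e⁻ i * e⁺ j) * ∫ X (λ x → φ (List.replicate b 0 ++ x)))
      ≈⟨ ∫-*ʳ (splits b) _ _ ⟩
    ∫ (splits b) (λ (i , j) → e⁻ i * e⁺ j) * ∫ X (λ x → φ (List.replicate b 0 ++ x)) ∎
    where
    open ≈-Reasoning
    H = E b · X
    homH : Homogeneous (b ℕ.+ m) H
    homH = homogeneous-· {F = E b} {X} (homogeneous-pow e⁺ b) hom

  S♯-⋆-fix : ∀ {m X} → Homogeneous m X → ∂ X ≃ 𝟘 → S♯ m ⋆ X ≃ X
  S♯-⋆-fix {m} {X} hom ∂X≃𝟘 = ≃.trans (⋆-congˡ {S♯ m} (≃.sym (E-0-· X))) (by-∫ λ φ →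
    trans (S♯-⋆ 0 hom ∂X≃𝟘 φ) (trans (*-congʳ (trans (splits-0 _) (trans
      (*-cong (IsExponential.e-0 e⁻-exponential) (IsExponential.e-0 e⁺-exponential)) (*-identityˡ 1#))))
    (*-identityˡ _)))

  S♯-⋆-kill : ∀ b {m X} → Homogeneous m X → ∂ X ≃ 𝟘 → S♯ (suc b ℕ.+ m) ⋆ (E (suc b) · X) ≃ 𝟘
  S♯-⋆-kill b hom ∂X≃𝟘 = by-∫ λ φ → trans (S♯-⋆ (suc b) hom ∂X≃𝟘 φ) (trans
    (*-congʳ (exponential-inverse cancellative e⁻-exponential e⁺-exponential (-‿inverseˡ 1#) b))
    (trans (zeroˡ _) (sym (∫-[] φ))))

  -- Written as F ⋆ S♯ m, the left factor lets S♯ m act on ρ G, which it fixes since ∂ (ρ G) = 0.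
  ρ-⋆ : ∀ {m F G} → Homogeneous m F → Homogeneous m G → ρ F ⋆ ρ G ≃ ρ (F ⋆ G)
  ρ-⋆ {m} {F} {G} homF homG = begin
    ρ F ⋆ ρ G              ≈⟨ ⋆-congʳ {G = ρ G} (⋆-S♯ homF) ⟨
    (F ⋆ S♯ m) ⋆ ρ G       ≈⟨ ⋆-assoc F (S♯ m) (ρ G) ⟩
    F ⋆ (S♯ m ⋆ ρ G)       ≈⟨ ⋆-congˡ {F} (S♯-⋆-fix (homogeneous-ρ {F = G} homG) (∂-ρ G)) ⟩
    F ⋆ ρ G                ≈⟨ ⋆-congˡ {F} (⋆-S♯ homG) ⟨
    F ⋆ (G ⋆ S♯ m)         ≈⟨ ⋆-assoc F G (S♯ m) ⟨
    (F ⋆ G) ⋆ S♯ m         ≈⟨ ⋆-S♯ (homogeneous-⋆ {F = F} G homF) ⟩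
    ρ (F ⋆ G)              ∎
    where open ≃-Reasoning

  Eρ-⋆-≡ : ∀ i {m F G} → Homogeneous m F → Homogeneous m G → (E i · ρ F) ⋆ (E i · ρ G) ≃ E i · ρ (F ⋆ G)
  Eρ-⋆-≡ i {m} {F} {G} homF homG = begin
    (E i · ρ F) ⋆ (E i · ρ G)              ≈⟨ pow·-⋆ e⁺ i (ρ F) (E i · ρ G) ⟩
    E i · (ρ F ⋆ ∂^ i (E i · ρ G))         ≈⟨ ·-congˡ {E i} (⋆-congˡ {ρ F} (≃.trans
                                                (≡.subst (λ k → ∂^ i (E k · ρ G) ≃ E 0 · ρ G) (ℕ.+-identityʳ i) (∂^-E·-≥ i 0 (∂-ρ G)))
                                                (E-0-· (ρ G)))) ⟩
    E i · (ρ F ⋆ ρ G)                      ≈⟨ ·-congˡ {E i} (ρ-⋆ homF homG) ⟩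
    E i · ρ (F ⋆ G)                        ∎
    where open ≃-Reasoning

  -- More than l applications of ∂ exhaust the divided power E l.
  Eρ-⋆-> : ∀ l d F G → (E (suc (l ℕ.+ d)) · ρ F) ⋆ (E l · ρ G) ≃ 𝟘
  Eρ-⋆-> l d F G = begin
    (E i · ρ F) ⋆ (E l · ρ G)              ≈⟨ pow·-⋆ e⁺ i (ρ F) (E l · ρ G) ⟩
    E i · (ρ F ⋆ ∂^ i (E l · ρ G))         ≈⟨ ·-congˡ {E i} (⋆-congˡ {ρ F} (∂^-E·-< l d (∂-ρ G))) ⟩
    E i · (ρ F ⋆ 𝟘)                        ≈⟨ ≃.trans (·-congˡ {E i} (⋆-zeroʳ (ρ F))) (·-zeroʳ (E i)) ⟩
    𝟘                                      ∎
    where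
    open ≃-Reasoning
    i = suc (l ℕ.+ d)

  -- Here ∂ does not suffice: ∂^ i leaves E (suc d) · ρ G. The factor S♯ concealed in ρ F
  -- annihilates it.
  Eρ-⋆-< : ∀ i d {p F G} → Homogeneous (suc d ℕ.+ p) F → Homogeneous p G →
           (E i · ρ F) ⋆ (E (i ℕ.+ suc d) · ρ G) ≃ 𝟘
  Eρ-⋆-< i d {p} {F} {G} homF homG = begin
    (E i · ρ F) ⋆ (E (i ℕ.+ suc d) · ρ G)             ≈⟨ pow·-⋆ e⁺ i (ρ F) (E (i ℕ.+ suc d) · ρ G) ⟩
    E i · (ρ F ⋆ ∂^ i (E (i ℕ.+ suc d) · ρ G))        ≈⟨ ·-congˡ {E i} (⋆-cong (≃.sym (⋆-S♯ homF)) (∂^-E·-≥ i (suc d) (∂-ρ G))) ⟩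
    E i · ((F ⋆ S♯ (suc d ℕ.+ p)) ⋆ (E (suc d) · ρ G)) ≈⟨ ·-congˡ {E i} (⋆-assoc F (S♯ (suc d ℕ.+ p)) (E (suc d) · ρ G)) ⟩
    E i · (F ⋆ (S♯ (suc d ℕ.+ p) ⋆ (E (suc d) · ρ G))) ≈⟨ ·-congˡ {E i} (⋆-congˡ {F} (S♯-⋆-kill d (homogeneous-ρ {F = G} homG) (∂-ρ G))) ⟩
    E i · (F ⋆ 𝟘)                                     ≈⟨ ≃.trans (·-congˡ {E i} (⋆-zeroʳ F)) (·-zeroʳ (E i)) ⟩
    𝟘                                                 ∎
    where open ≃-Reasoning

  Eρ-⋆-≢ : ∀ i l {n F G} → i ≢ l → i ℕ.≤ n → l ℕ.≤ n → Homogeneous (n ∸ i) F → Homogeneous (n ∸ l) G →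
           (E i · ρ F) ⋆ (E l · ρ G) ≃ 𝟘
  Eρ-⋆-≢ i l {n} {F} {G} i≢l i≤n l≤n homF homG with ℕ.compare i l
  ... | ℕ.equal _     = ⊥-elim (i≢l ≡.refl)
  ... | ℕ.greater _ d = Eρ-⋆-> l d F G
  ... | ℕ.less _ d    = ≡.subst (λ k → (E i · ρ F) ⋆ (E k · ρ G) ≃ 𝟘) (ℕ.+-suc i d)
    (Eρ-⋆-< i d {n ∸ l} {F} {G} (≡.subst (λ k → Homogeneous k F) n∸i≡ homF) homG)
    where
    n∸i≡ : n ∸ i ≡ suc d ℕ.+ (n ∸ l)
    n∸i≡ = ℕ.+-cancelˡ-≡ i _ _ (≡.trans (ℕ.m+[n∸m]≡n i≤n) (≡.sym (≡.trans
      (≡.sym (ℕ.+-assoc i (suc d) (n ∸ l))) (≡.trans (≡.cong (ℕ._+ (n ∸ l)) (ℕ.+-suc i d)) (ℕ.m+[n∸m]≡n l≤n)))))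

  -- Subspaces and finite sums

  -- Bundled because preimages and fixed points of linear maps form subspaces; claims about a whole
  -- `Sum` then reduce to its individual members.
  record IsLinear (T : Sym → Sym) : Set (c ⊔ ℓ₁) where
    field
      cong   : ∀ {F G} → F ≃ G → T F ≃ T G
      𝟘-homo : T 𝟘 ≃ 𝟘
      ⊕-homo : ∀ F G → T (F ⊕ G) ≃ T F ⊕ T G
      •-homo : ∀ a F → T (a • F) ≃ a • T F

  ⋆ʳ-linear : ∀ G → IsLinear (_⋆ G)
  ⋆ʳ-linear G = record
    { cong = ⋆-congʳ {G = G} ; 𝟘-homo = ⋆-zeroˡ G ; ⊕-homo = ⋆-distribʳ G ; •-homo = λ a F → •-⋆ˡ a F G }

  ⋆ˡ-linear : ∀ F → IsLinear (F ⋆_)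
  ⋆ˡ-linear F = record
    { cong = ⋆-congˡ {F} ; 𝟘-homo = ⋆-zeroʳ F ; ⊕-homo = ⋆-distribˡ F ; •-homo = λ a G → •-⋆ʳ a F G }

  ∂-linear : IsLinear ∂
  ∂-linear = record
    { cong = ∂-cong ; 𝟘-homo = ≃.refl ; ⊕-homo = ∂-⊕
    ; •-homo = λ a F → by-∫ λ φ → trans (∫-∂ (a • F) φ) (trans (∫-• a F _)
        (sym (trans (∫-• a (∂ F) φ) (*-congˡ (∫-∂ F φ)))))
    }

  ·ρ-linear : ∀ X → IsLinear (λ G → X · ρ G)
  ·ρ-linear X = record
    { cong   = λ F≃G → ·-congˡ {X} (ρ-cong F≃G)
    ; 𝟘-homo = ·-zeroʳ X
    ; ⊕-homo = λ F G → ≃.trans (·-congˡ {X} (by-∫ λ φ → trans (∫-ρ (F ⊕ G) φ) (trans (∫-⊕ F G _)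
        (sym (trans (∫-⊕ (ρ F) (ρ G) φ) (+-cong (∫-ρ F φ) (∫-ρ G φ)))))))
        (·-distribˡ X (ρ F) (ρ G))
    ; •-homo = λ a F → ≃.trans (·-congˡ {X} (by-∫ λ φ → trans (∫-ρ (a • F) φ) (trans (∫-• a F _)
        (sym (trans (∫-• a (ρ F) φ) (*-congˡ (∫-ρ F φ)))))))
        (•-·ʳ a X (ρ F))
    }

  Image : ∀ (T : Sym → Sym) n → Pred Sym (c ⊔ ℓ₁)
  Image T n F = ∃ λ G → Homogeneous n G × F ≃ T G

  image-isSubspace : ∀ {T} → IsLinear T → ∀ n → IsSubspace (Image T n)
  image-isSubspace {T} lin n = record
    { resp     = λ { {F} {F′} F≋F′ (G , hom , F≃TG) → G , hom , ≃.trans (≃.sym (≋⇒≃ {F} {F′} F≋F′)) F≃TG }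
    ; 𝟘-closed = 𝟘 , homogeneous-𝟘 , ≃.sym 𝟘-homo
    ; ⊕-closed = λ { (G , homG , F≃) (G′ , homG′ , F′≃) →
        G ⊕ G′ , homogeneous-⊕ {F = G} {G′} homG homG′ , ≃.trans (⊕-cong F≃ F′≃) (≃.sym (⊕-homo G G′)) }
    ; •-closed = λ { a (G , hom , F≃) →
        a • G , homogeneous-• a {F = G} hom , ≃.trans (•-cong refl F≃) (≃.sym (•-homo a G)) }
    }
    where open IsLinear lin

  resp-≃ : ∀ {p} {U : Pred Sym p} {F G} → IsSubspace U → F ≃ G → F ∈ U → G ∈ U
  resp-≃ sub F≃G F∈ = IsSubspace.resp sub (≃⇒≋ F≃G) F∈

  preimage-isSubspace : ∀ {T p} {U : Pred Sym p} → IsLinear T → IsSubspace U → IsSubspace (λ F → T F ∈ U)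
  preimage-isSubspace {T} lin sub = record
    { resp     = λ {F} {G} F≋G → resp-≃ sub (cong (≋⇒≃ {F} {G} F≋G))
    ; 𝟘-closed = resp-≃ sub (≃.sym 𝟘-homo) U.𝟘-closed
    ; ⊕-closed = λ {F} {G} F∈ G∈ → resp-≃ sub (≃.sym (⊕-homo F G)) (U.⊕-closed F∈ G∈)
    ; •-closed = λ a {F} F∈ → resp-≃ sub (≃.sym (•-homo a F)) (U.•-closed a F∈)
    }
    where
    open IsLinear lin
    module U = IsSubspace sub

  fixed-isSubspace : ∀ {T} → IsLinear T → IsSubspace (λ F → T F ≃ F)
  fixed-isSubspace {T} lin = record
    { resp     = λ {F} {G} F≋G TF≃F →
        ≃.trans (cong (≃.sym (≋⇒≃ {F} {G} F≋G))) (≃.trans TF≃F (≋⇒≃ {F} {G} F≋G))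
    ; 𝟘-closed = 𝟘-homo
    ; ⊕-closed = λ {F} {G} TF≃F TG≃G → ≃.trans (⊕-homo F G) (⊕-cong TF≃F TG≃G)
    ; •-closed = λ a {F} TF≃F → ≃.trans (•-homo a F) (•-cong refl TF≃F)
    }
    where open IsLinear lin

  homogeneous-isSubspace : ∀ n → IsSubspace (Homogeneous n)
  homogeneous-isSubspace n = record
    { resp     = λ {F} {G} F≋G hom → homogeneous-resp (≋⇒≃ {F} {G} F≋G) hom
    ; 𝟘-closed = homogeneous-𝟘
    ; ⊕-closed = λ {F} {G} homF homG → homogeneous-⊕ {F = F} {G} homF homG
    ; •-closed = λ a {F} hom → homogeneous-• a {F = F} hom
    }

  subspace-≐ : ∀ {p q} {U : Pred Sym p} {V : Pred Sym q} → U ⊆ V → V ⊆ U → IsSubspace U → IsSubspace V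
  subspace-≐ U⊆V V⊆U sub = record
    { resp     = λ F≋G F∈ → U⊆V (resp F≋G (V⊆U F∈))
    ; 𝟘-closed = U⊆V 𝟘-closed
    ; ⊕-closed = λ F∈ G∈ → U⊆V (⊕-closed (V⊆U F∈) (V⊆U G∈))
    ; •-closed = λ a F∈ → U⊆V (•-closed a (V⊆U F∈))
    }
    where open IsSubspace sub

  sum-cong : ∀ {m} {g h : Fin m → Sym} → (∀ j → g j ≃ h j) → sum g ≃ sum h
  sum-cong {zero}  g≃h = ≃.refl
  sum-cong {suc m} g≃h = ⊕-cong (g≃h zero) (sum-cong λ j → g≃h (suc j))

  sum-homo : ∀ {T} → IsLinear T → ∀ {m} (g : Fin m → Sym) → T (sum g) ≃ sum (λ j → T (g j))
  sum-homo {T} lin {zero}  g = IsLinear.𝟘-homo lin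
  sum-homo {T} lin {suc m} g = ≃.trans (IsLinear.⊕-homo lin (g zero) (sum λ j → g (suc j)))
    (⊕-cong (≃.refl {T (g zero)}) (sum-homo lin λ j → g (suc j)))

  sum-𝟘 : ∀ {m} (g : Fin m → Sym) → (∀ j → g j ≃ 𝟘) → sum g ≃ 𝟘
  sum-𝟘 {zero}  g g≃𝟘 = ≃.refl
  sum-𝟘 {suc m} g g≃𝟘 = ⊕-cong (g≃𝟘 zero) (sum-𝟘 (λ j → g (suc j)) λ j → g≃𝟘 (suc j))

  sum-single : ∀ {m} (g : Fin m → Sym) j {F} → g j ≃ F → (∀ i → i ≢ j → g i ≃ 𝟘) → sum g ≃ F
  sum-single g zero    {F} gj≃F rest = ≃.trans
    (⊕-cong gj≃F (sum-𝟘 (λ i → g (suc i)) λ i → rest (suc i) λ ())) (⊕-identityʳ F)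
  sum-single g (suc j)     gj≃F rest = ⊕-cong (rest zero λ ())
    (sum-single (λ i → g (suc i)) j gj≃F λ i i≢j → rest (suc i) λ 1+i≡1+j → i≢j (Fin.suc-injective 1+i≡1+j))

  sum-closed : ∀ {p} {U : Pred Sym p} → IsSubspace U → ∀ {m} (g : Fin m → Sym) → (∀ j → g j ∈ U) → sum g ∈ U
  sum-closed sub {zero}  g g∈ = IsSubspace.𝟘-closed sub
  sum-closed sub {suc m} g g∈ =
    IsSubspace.⊕-closed sub (g∈ zero) (sum-closed sub (λ j → g (suc j)) λ j → g∈ (suc j))

  sum-⊕ : ∀ {m} (g h : Fin m → Sym) → sum g ⊕ sum h ≃ sum (λ j → g j ⊕ h j)
  sum-⊕ {zero}  g h = ≃.refl
  sum-⊕ {suc m} g h = by-∫ λ φ → begin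
    ∫ ((g zero ⊕ sum g′) ⊕ (h zero ⊕ sum h′)) φ
      ≈⟨ trans (∫-⊕ (g zero ⊕ sum g′) _ φ) (+-cong (∫-⊕ (g zero) (sum g′) φ) (∫-⊕ (h zero) (sum h′) φ)) ⟩
    (∫ (g zero) φ + ∫ (sum g′) φ) + (∫ (h zero) φ + ∫ (sum h′) φ)
      ≈⟨ +-interchange _ _ _ _ ⟩
    (∫ (g zero) φ + ∫ (h zero) φ) + (∫ (sum g′) φ + ∫ (sum h′) φ)
      ≈⟨ +-cong (∫-⊕ (g zero) (h zero) φ) (trans (sym (at (sum-⊕ g′ h′) φ)) (∫-⊕ (sum g′) (sum h′) φ)) ⟨
    ∫ (g zero ⊕ h zero) φ + ∫ (sum λ j → g′ j ⊕ h′ j) φ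
      ≈⟨ ∫-⊕ (g zero ⊕ h zero) _ φ ⟨
    ∫ (sum λ j → g j ⊕ h j) φ ∎
    where
    open ≈-Reasoning
    open CommutativeSemigroupProperties +-commutativeSemigroup using () renaming (interchange to +-interchange)
    g′ h′ : Fin m → Sym
    g′ j = g (suc j)
    h′ j = h (suc j)

  •-linear : ∀ a → IsLinear (a •_)
  •-linear a = record
    { cong   = •-cong refl
    ; 𝟘-homo = ≃.refl
    ; ⊕-homo = •-⊕ a
    ; •-homo = λ b F → by-∫ λ φ → trans (∫-• a (b • F) φ) (trans (*-congˡ (∫-• b F φ)) (trans (x∙yz≈y∙xz _ _ _)
        (sym (trans (∫-• b (a • F) φ) (*-congˡ (∫-• a F φ))))))
    }

  Sum-isSubspace : ∀ {p m} {V : Fin m → Pred Sym p} → (∀ j → IsSubspace (V j)) → IsSubspace (Sum V)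
  Sum-isSubspace {V = V} sub = record
    { resp     = λ { F≋F′ (g , g∈ , F≋) → g , g∈ , λ w → trans (sym (F≋F′ w)) (F≋ w) }
    ; 𝟘-closed = g₀ , (λ j → IsSubspace.𝟘-closed (sub j)) , ≃⇒≋ (≃.sym (sum-𝟘 g₀ λ _ → ≃.refl))
    ; ⊕-closed = λ { {F} {F′} (g , g∈ , F≋) (g′ , g′∈ , F′≋) →
        (λ j → g j ⊕ g′ j) , (λ j → IsSubspace.⊕-closed (sub j) (g∈ j) (g′∈ j)) ,
        ≃⇒≋ (≃.trans (⊕-cong (≋⇒≃ {F} {sum g} F≋) (≋⇒≃ {F′} {sum g′} F′≋)) (sum-⊕ g g′)) }
    ; •-closed = λ { a {F} (g , g∈ , F≋) →
        (λ j → a • g j) , (λ j → IsSubspace.•-closed (sub j) a (g∈ j)) ,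
        ≃⇒≋ (≃.trans (•-cong refl (≋⇒≃ {F} {sum g} F≋)) (sum-homo (•-linear a) g)) }
    }
    where
    g₀ : Fin _ → Sym
    g₀ _ = 𝟘

  Sum-⊆ : ∀ {p q m} {V : Fin m → Pred Sym p} {U : Pred Sym q} → IsSubspace U → (∀ j → V j ⊆ U) → Sum V ⊆ U
  Sum-⊆ sub V⊆U (g , g∈ , F≋) =
    IsSubspace.resp sub (λ w → sym (F≋ w)) (sum-closed sub g λ j → V⊆U j (g∈ j))

  Sum-⊇ : ∀ {p m} {V : Fin m → Pred Sym p} → (∀ j → IsSubspace (V j)) → ∀ j → V j ⊆ Sum V
  Sum-⊇ {V = V} sub j {F} F∈ = g , g∈ , ≃⇒≋ (≃.sym (sum-single g j g-j g-rest))
    where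
    g : Fin _ → Sym
    g i = if does (i Fin.≟ j) then F else 𝟘
    g∈ : ∀ i → g i ∈ V i
    g∈ i with i Fin.≟ j
    ... | yes ≡.refl = F∈
    ... | no  _      = IsSubspace.𝟘-closed (sub i)
    g-j : g j ≃ F
    g-j with j Fin.≟ j
    ... | yes _   = ≃.refl
    ... | no  j≢j = ⊥-elim (j≢j ≡.refl)
    g-rest : ∀ i → i ≢ j → g i ≃ 𝟘
    g-rest i i≢j with i Fin.≟ j
    ... | yes i≡j = ⊥-elim (i≢j i≡j)
    ... | no  _   = ≃.refl

  Sum-mono : ∀ {p q m} {V : Fin m → Pred Sym p} {W : Fin m → Pred Sym q} → (∀ j → V j ⊆ W j) → Sum V ⊆ Sum W
  Sum-mono V⊆W (g , g∈ , F≋) = g , (λ j → V⊆W j (g∈ j)) , F≋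

  splits-closed : ∀ {p} {U : Pred Sym p} → IsSubspace U → ∀ n (f : ℕ × ℕ → Sym) →
                  (∀ a b → a ℕ.+ b ≡ n → f (a , b) ∈ U) → (splits n >>= f) ∈ U
  splits-closed sub zero    f f∈ = resp-≃ sub
    (by-∫ λ φ → sym (trans (∫->>= (splits 0) f φ) (splits-0 _))) (f∈ 0 0 ≡.refl)
  splits-closed sub (suc n) f f∈ = resp-≃ sub
    (by-∫ λ φ → trans (∫-⊕ (f (0 , suc n)) _ φ) (trans (+-congˡ (∫->>= (splits n) _ φ))
      (sym (trans (∫->>= (splits (suc n)) f φ) (splits-suc n _)))))
    (IsSubspace.⊕-closed sub (f∈ 0 (suc n) ≡.refl)
      (splits-closed sub n (λ (a , b) → f (suc a , b)) λ a b a+b≡n → f∈ (suc a) b (≡.cong suc a+b≡n)))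

  -- The decomposition of D n k into the Eⱼ D⁰ₙ₋ⱼ

  -- With X = S these are the summands that define D; with X = E they are the summands on which ⋆ is
  -- diagonal.
  Pieces : (ℕ → Sym) → (n k : ℕ) → Fin (suc (k ⊓ n)) → Pred Sym (c ⊔ ℓ₁)
  Pieces X n k j = Image (λ G → X (toℕ j) · ρ G) (n ∸ toℕ j)

  Pieces-isSubspace : ∀ X n k j → IsSubspace (Pieces X n k j)
  Pieces-isSubspace X n k j = image-isSubspace (·ρ-linear (X (toℕ j))) (n ∸ toℕ j)

  ·ρ∈Pieces : ∀ X n k {a G} → a ℕ.≤ k ⊓ n → Homogeneous (n ∸ a) G → X a · ρ G ∈ Sum (Pieces X n k)
  ·ρ∈Pieces X n k {a} {G} a≤ hom = Sum-⊇ (Pieces-isSubspace X n k) (fromℕ< (ℕ.s≤s a≤))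
    (≡.subst (λ b → X a · ρ G ∈ Image (λ G → X b · ρ G) (n ∸ b)) (≡.sym (Fin.toℕ-fromℕ< (ℕ.s≤s a≤)))
      (G , hom , ≃.refl))

  D⁰⇒Image : ∀ {n F} → F ∈ D⁰ n → F ∈ Image ρ n
  D⁰⇒Image {n} {F} (G , G∈ , F≋) = G , hom , ≃.trans (≋⇒≃ {F} {G ⋆ S♯ n} F≋) (⋆-S♯ hom)
    where
    hom : Homogeneous n G
    hom = Sym[]⇒homogeneous {F = G} G∈

  summand⊆Pieces : ∀ n k j → summand n k j ⊆ Pieces S n k j
  summand⊆Pieces n k j {F} (f , f∈ , F≋) with D⁰⇒Image {F = f} f∈
  ... | G , hom , f≃ = G , hom , ≃.trans (≋⇒≃ {F} {S (toℕ j) · f} F≋) (·-congˡ {S (toℕ j)} f≃)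

  Pieces⊆summand : ∀ n k j → Pieces S n k j ⊆ summand n k j
  Pieces⊆summand n k j {F} (G , hom , F≃) =
    ρ G , (G , homogeneous⇒Sym[] {F = G} hom , ≃⇒≋ (≃.sym (⋆-S♯ hom))) , ≃⇒≋ F≃

  summand-isSubspace : ∀ n k j → IsSubspace (summand n k j)
  summand-isSubspace n k j =
    subspace-≐ (Pieces⊆summand n k j) (summand⊆Pieces n k j) (Pieces-isSubspace S n k j)

  -- Inverts the definition of S♯: as series, exp(S₁) · (exp(-S₁) · S) = S. Coassociativity merges
  -- the two powers of S₁, and the merged coefficient C z vanishes for z > 0.
  S-E-S♯ : ∀ n φ → ∫ (S n) φ ≈ ∫ (splits n) (λ (a , b) → ∫ (E a · S♯ b) φ)
  S-E-S♯ n φ = sym (begin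
    ∫ (splits n) (λ (a , b) → ∫ (E a · S♯ b) φ)
      ≈⟨ ∫-cong (splits n) (λ (a , b) → begin
         ∫ (E a · S♯ b) φ
           ≈⟨ trans (∫-· (E a) (S♯ b) φ) (trans (∫-pow e⁺ a _) (*-congˡ (∫-S♯ b _))) ⟩
         e⁺ a * ∫ (splits b) (λ (p , q) → ∫ (pow e⁻ p · S q) λ w → φ (0^ a ++ w))
           ≈⟨ ∫-*ˡ (splits b) _ _ ⟨
         ∫ (splits b) (λ (p , q) → e⁺ a * ∫ (pow e⁻ p · S q) λ w → φ (0^ a ++ w))
           ≈⟨ ∫-cong (splits b) (λ (p , q) → trans (*-congˡ (trans (∫-· (pow e⁻ p) (S q) _)
                (trans (∫-pow e⁻ p _) (*-congˡ (∫-S q _))))) (sym (*-assoc _ _ _))) ⟩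
         ∫ (splits b) (λ (p , q) → (e⁺ a * e⁻ p) * φ (0^ a ++ (0^ p ++ (q ▹ [])))) ∎) ⟩
    ∫ (splits n) (λ (a , b) → ∫ (splits b) λ (p , q) → (e⁺ a * e⁻ p) * φ (0^ a ++ (0^ p ++ (q ▹ []))))
      ≈⟨ splits-coassoc n (λ a p q → (e⁺ a * e⁻ p) * φ (0^ a ++ (0^ p ++ (q ▹ [])))) ⟨
    ∫ (splits n) (λ (z , q) → ∫ (splits z) λ (a , p) → (e⁺ a * e⁻ p) * φ (0^ a ++ (0^ p ++ (q ▹ []))))
      ≈⟨ ∫-cong (splits n) (λ (z , q) → trans
           (splits-cong z λ a p a+p≡z → *-congˡ (reflexive (≡.cong φ (≡.trans
             (≡.sym (List.++-assoc (0^ a) (0^ p) (q ▹ [])))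
             (≡.cong (_++ q ▹ []) (≡.trans (replicate-++ a p) (≡.cong 0^ a+p≡z)))))))
           (∫-*ʳ (splits z) _ _)) ⟩
    ∫ (splits n) (λ (z , q) → C z * φ (0^ z ++ (q ▹ [])))
      ≈⟨ collapse n ⟩
    φ (n ▹ [])
      ≈⟨ ∫-S n φ ⟨
    ∫ (S n) φ ∎)
    where
    open ≈-Reasoning
    0^ : ℕ → Word
    0^ a = List.replicate a 0
    C : ℕ → Carrier
    C z = ∫ (splits z) λ (a , p) → e⁺ a * e⁻ p
    C-0 : C 0 ≈ 1#
    C-0 = trans (splits-0 _) (trans
      (*-cong (IsExponential.e-0 e⁺-exponential) (IsExponential.e-0 e⁻-exponential)) (*-identityˡ 1#))
    C-suc : ∀ z → C (suc z) ≈ 0#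
    C-suc = exponential-inverse cancellative e⁺-exponential e⁻-exponential (-‿inverseʳ 1#)
    collapse : ∀ n → ∫ (splits n) (λ (z , q) → C z * φ (0^ z ++ (q ▹ []))) ≈ φ (n ▹ [])
    collapse zero    = trans (splits-0 _) (trans (*-congʳ C-0) (*-identityˡ _))
    collapse (suc n) = trans (splits-suc n _) (trans
      (+-cong (trans (*-congʳ C-0) (*-identityˡ _))
        (trans (∫-cong (splits n) λ (z , q) → trans (*-congʳ (C-suc z)) (zeroˡ _)) (∫-0 (splits n))))
      (+-identityʳ _))

  -- The triangular change of summands: absorbing S♯ b into ρ keeps every term in some Eₐ D⁰ with a
  -- at most n.
  ∫-Sρ : ∀ n G φ → ∫ (S n · ρ G) φ ≈ ∫ (splits n) (λ (a , b) → ∫ (E a · ρ (S b · G)) φ)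
  ∫-Sρ n G φ = begin
    ∫ (S n · ρ G) φ
      ≈⟨ trans (∫-· (S n) (ρ G) φ) (S-E-S♯ n _) ⟩
    ∫ (splits n) (λ (a , b) → ∫ (E a · S♯ b) λ u → ∫ (ρ G) λ v → φ (u ++ v))
      ≈⟨ ∫-cong (splits n) (λ (a , b) → trans (sym (∫-· (E a · S♯ b) (ρ G) φ))
           (at (≃.trans (·-assoc (E a) (S♯ b) (ρ G)) (·-congˡ {E a} (S♯-·-ρ b G))) φ)) ⟩
    ∫ (splits n) (λ (a , b) → ∫ (E a · ρ (S b · G)) φ) ∎
    where open ≈-Reasoning

  ∸-split : ∀ a b {j n} → a ℕ.+ b ≡ j → j ℕ.≤ n → b ℕ.+ (n ∸ j) ≡ n ∸ a
  ∸-split a b {n = n} ≡.refl a+b≤n = ℕ.+-cancelˡ-≡ a _ _ (≡.trans (≡.sym (ℕ.+-assoc a b _)) (≡.trans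
    (ℕ.m+[n∸m]≡n a+b≤n) (≡.sym (ℕ.m+[n∸m]≡n (ℕ.≤-trans (ℕ.m≤m+n a b) a+b≤n)))))

  homogeneous-S· : ∀ a b {j n} G → a ℕ.+ b ≡ j → j ℕ.≤ n → Homogeneous (n ∸ j) G → Homogeneous (n ∸ a) (S b · G)
  homogeneous-S· a b G a+b≡j j≤n hom =
    ≡.subst (λ d → Homogeneous d (S b · G)) (∸-split a b a+b≡j j≤n) (homogeneous-· {F = S b} {G} (homogeneous-S b) hom)

  ker∂-independent : ∀ {m} (f : Fin m → Sym) → (∀ j → ∂ (f j) ≃ 𝟘) →
                     sum (λ j → S (toℕ j) · f j) ≃ 𝟘 → ∀ j → f j ≃ 𝟘
  ker∂-independent {suc m} f ∂f≃𝟘 sum≃𝟘 = λ { zero → f₀≃𝟘 ; (suc j) → f₊≃𝟘 j }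
    where
    open ≃-Reasoning
    f₊≃𝟘 : ∀ j → f (suc j) ≃ 𝟘
    f₊≃𝟘 = ker∂-independent (λ j → f (suc j)) (λ j → ∂f≃𝟘 (suc j)) (begin
      sum (λ j → S (toℕ j) · f (suc j))
        ≈⟨ sum-cong (λ j → ≃.trans (∂-·-const (S (suc (toℕ j))) {f (suc j)} (∂f≃𝟘 (suc j)))
             (·-congʳ {G = f (suc j)} (∂-S-suc (toℕ j)))) ⟨
      sum (λ j → ∂ (S (suc (toℕ j)) · f (suc j)))
        -- ∂ S₀ = 0 removes the first summand, so the derivative is a sum of the same form for the
        -- shifted family.
        ≈⟨ ⊕-cong (≃.trans (∂-·-const (S 0) {f zero} (∂f≃𝟘 zero)) (·-congʳ {G = f zero} ∂-S-0))
             (≃.refl {sum λ j → ∂ (S (suc (toℕ j)) · f (suc j))}) ⟨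
      sum (λ j → ∂ (S (toℕ j) · f j))
        ≈⟨ sum-homo ∂-linear (λ j → S (toℕ j) · f j) ⟨
      ∂ (sum λ j → S (toℕ j) · f j)
        ≈⟨ ∂-cong sum≃𝟘 ⟩
      𝟘 ∎)
    f₀≃𝟘 : f zero ≃ 𝟘
    f₀≃𝟘 = begin
      f zero                                             ≈⟨ ≃.trans (⊕-identityʳ (𝟙 · f zero)) (·-identityˡ (f zero)) ⟨
      𝟙 · f zero ⊕ 𝟘                                     ≈⟨ ⊕-cong (≃.refl {𝟙 · f zero}) (sum-𝟘 (λ j → S (suc (toℕ j)) · f (suc j)) λ j →
                                                              ≃.trans (·-congˡ {S (suc (toℕ j))} (f₊≃𝟘 j)) (·-zeroʳ (S (suc (toℕ j))))) ⟨
      sum (λ j → S (toℕ j) · f j)                        ≈⟨ sum≃𝟘 ⟩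
      𝟘                                                  ∎

  -- The spaces D n k: stability, neutral element, directness

  module _ (n k : ℕ) where

    private
      Dᴱ : Pred Sym (c ⊔ ℓ₁)
      Dᴱ = Sum (Pieces E n k)

      ≤n : ∀ {a} → a ℕ.≤ k ⊓ n → a ℕ.≤ n
      ≤n a≤ = ℕ.≤-trans a≤ (ℕ.m⊓n≤n k n)

      j≤ : (j : Fin (suc (k ⊓ n))) → toℕ j ℕ.≤ k ⊓ n
      j≤ j = ℕ.s≤s⁻¹ (Fin.toℕ<n j)

    D-isSubspace : IsSubspace (D n k)
    D-isSubspace = Sum-isSubspace (summand-isSubspace n k)

    Dᴱ-isSubspace : IsSubspace Dᴱ
    Dᴱ-isSubspace = Sum-isSubspace (Pieces-isSubspace E n k)

    D⊆Dᴱ : D n k ⊆ Dᴱ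
    D⊆Dᴱ {F} F∈D = Sum-⊆ {V = summand n k} Dᴱ-isSubspace
      (λ j {F} F∈ → Sρ∈Dᴱ j {F} (summand⊆Pieces n k j {F} F∈)) {F} F∈D
      where
      Sρ∈Dᴱ : ∀ j → Pieces S n k j ⊆ Dᴱ
      Sρ∈Dᴱ j {F} (G , hom , F≃) = resp-≃ Dᴱ-isSubspace
        (≃.sym (≃.trans F≃ (by-∫ λ φ → trans (∫-Sρ (toℕ j) G φ) (sym (∫->>= (splits (toℕ j)) _ φ)))))
        (splits-closed Dᴱ-isSubspace (toℕ j) (λ (a , b) → E a · ρ (S b · G)) λ a b a+b≡j →
          ·ρ∈Pieces E n k (ℕ.≤-trans (ℕ.m+n≤o⇒m≤o a (ℕ.≤-reflexive a+b≡j)) (j≤ j))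
            (homogeneous-S· a b G a+b≡j (≤n (j≤ j)) hom))

    -- Solves the triangular relation for its leading term: Eₐ ρ G is Sₐ ρ G minus terms with
    -- smaller index. G varies in the induction because those terms involve S_b G with b > 0.
    Eρ∈D : ∀ a {G} → a ℕ.≤ k ⊓ n → Homogeneous (n ∸ a) G → E a · ρ G ∈ D n k
    Eρ∈D = <-rec _ step
      where
      Sρ∈D : ∀ {a G} → a ℕ.≤ k ⊓ n → Homogeneous (n ∸ a) G → S a · ρ G ∈ D n k
      Sρ∈D {a} {G} a≤ hom = Sum-mono (Pieces⊆summand n k) {S a · ρ G} (·ρ∈Pieces S n k {a} {G} a≤ hom)
      open IsSubspace D-isSubspace
      step : ∀ a → (∀ {b} → b ℕ.< a → ∀ {G} → b ℕ.≤ k ⊓ n → Homogeneous (n ∸ b) G → E b · ρ G ∈ D n k) →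
             ∀ {G} → a ℕ.≤ k ⊓ n → Homogeneous (n ∸ a) G → E a · ρ G ∈ D n k
      step zero    rec {G} a≤ hom = resp-≃ D-isSubspace
        (≃.trans (·-identityˡ (ρ G)) (≃.sym (E-0-· (ρ G)))) (Sρ∈D a≤ hom)
      step (suc a) rec {G} a≤ hom = resp-≃ D-isSubspace (by-∫ split)
        (⊕-closed {S (suc a) · ρ G} (Sρ∈D a≤ hom) (•-closed (- 1#) {splits a >>= lower} (splits-closed D-isSubspace a lower lower∈)))
        where
        open ≈-Reasoning
        lower : ℕ × ℕ → Sym
        lower (x , y) = E x · ρ (S (suc y) · G)
        lower∈ : ∀ x y → x ℕ.+ y ≡ a → lower (x , y) ∈ D n k
        lower∈ x y x+y≡a = rec (ℕ.s≤s x≤a) (ℕ.≤-trans x≤a (ℕ.≤-trans (ℕ.n≤1+n a) a≤))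
          (homogeneous-S· x (suc y) G (≡.trans (ℕ.+-suc x y) (≡.cong suc x+y≡a)) (≤n a≤) hom)
          where
          x≤a : x ℕ.≤ a
          x≤a = ℕ.m+n≤o⇒m≤o x (ℕ.≤-reflexive x+y≡a)
        split : ∀ φ → ∫ (S (suc a) · ρ G ⊕ (- 1#) • (splits a >>= lower)) φ ≈ ∫ (E (suc a) · ρ G) φ
        split φ = begin
          ∫ (S (suc a) · ρ G ⊕ (- 1#) • (splits a >>= lower)) φ
            -- `splits-sucʳ` isolates the splitting with second part 0, the leading term; the
            -- remaining ones are exactly those subtracted.
            ≈⟨ trans (∫-⊕ (S (suc a) · ρ G) _ φ) (+-cong (trans (∫-Sρ (suc a) G φ) (splits-sucʳ a _))
                 (trans (∫-• (- 1#) (splits a >>= lower) φ) (trans (-1*x≈-x _) (-‿cong (∫->>= (splits a) lower φ))))) ⟩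
          (L + ∫ (E (suc a) · ρ (S 0 · G)) φ) + - L
            ≈⟨ trans (+-comm _ _) (trans (sym (+-assoc _ _ _)) (trans (+-congʳ (-‿inverseˡ L)) (+-identityˡ _))) ⟩
          ∫ (E (suc a) · ρ (S 0 · G)) φ
            ≈⟨ at (·-congˡ {E (suc a)} (ρ-cong (·-identityˡ G))) φ ⟩
          ∫ (E (suc a) · ρ G) φ ∎
          where L = ∫ (splits a) (λ x → ∫ (lower x) φ)

    Dᴱ⊆D : Dᴱ ⊆ D n k
    Dᴱ⊆D {F} F∈Dᴱ = Sum-⊆ {V = Pieces E n k} D-isSubspace
      (λ { j (G , hom , F≃) → resp-≃ D-isSubspace (≃.sym F≃) (Eρ∈D (toℕ j) (j≤ j) hom) }) {F} F∈Dᴱ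

    D-homogeneous : D n k ⊆ Homogeneous n
    D-homogeneous {F} F∈D = Sum-⊆ {V = Pieces S n k} (homogeneous-isSubspace n) piece {F}
      (Sum-mono (summand⊆Pieces n k) {F} F∈D)
      where
      piece : ∀ j → Pieces S n k j ⊆ Homogeneous n
      piece j (G , hom , F≃) = homogeneous-resp (≃.sym F≃) (≡.subst (λ d → Homogeneous d (S (toℕ j) · ρ G))
        (ℕ.m+[n∸m]≡n (≤n (j≤ j)))
        (homogeneous-· {F = S (toℕ j)} {ρ G} (homogeneous-S (toℕ j)) (homogeneous-ρ {F = G} hom)))

    Dᴱ-⋆-closed : ⋆-Stable Dᴱ
    -- One factor at a time is reduced to a single piece, the other being held fixed in the linear
    -- map.
    Dᴱ-⋆-closed {F} {G} F∈ G∈ = Sum-⊆ (preimage-isSubspace (⋆ʳ-linear G) Dᴱ-isSubspace)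
      (λ i {F} F∈ → Sum-⊆ (preimage-isSubspace (⋆ˡ-linear F) Dᴱ-isSubspace)
        (λ l {G} G∈ → piece i l {F} {G} F∈ G∈) {G} G∈) {F} F∈
      where
      piece : ∀ i l {F G} → F ∈ Pieces E n k i → G ∈ Pieces E n k l → F ⋆ G ∈ Dᴱ
      piece i l (A , homA , F≃) (B , homB , G≃) with i Fin.≟ l
      ... | yes ≡.refl = Sum-⊇ (Pieces-isSubspace E n k) i
        (A ⋆ B , homogeneous-⋆ {F = A} B homA , ≃.trans (⋆-cong F≃ G≃) (Eρ-⋆-≡ (toℕ i) homA homB))
      ... | no  i≢l    = resp-≃ Dᴱ-isSubspace
        (≃.sym (≃.trans (⋆-cong F≃ G≃)
          (Eρ-⋆-≢ (toℕ i) (toℕ l) (λ eq → i≢l (Fin.toℕ-injective eq)) (≤n (j≤ i)) (≤n (j≤ l)) homA homB)))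
        (IsSubspace.𝟘-closed Dᴱ-isSubspace)

    D-⋆-closed : ⋆-Stable (D n k)
    D-⋆-closed {F} {G} F∈ G∈ = Dᴱ⊆D {F ⋆ G} (Dᴱ-⋆-closed {F} {G} (D⊆Dᴱ {F} F∈) (D⊆Dᴱ {G} G∈))

    private
      Pᵢ : Fin (suc (k ⊓ n)) → Sym
      Pᵢ i = E (toℕ i) · S♯ (n ∸ toℕ i)

      Pᵢ≃ : ∀ i → Pᵢ i ≃ E (toℕ i) · ρ (S (n ∸ toℕ i))
      Pᵢ≃ i = ·-congˡ {E (toℕ i)} (≃.sym (ρ-S (n ∸ toℕ i)))

    P∈D : P n k ∈ D n k
    P∈D = Dᴱ⊆D {P n k} (Pᵢ , (λ i → S (n ∸ toℕ i) , homogeneous-S (n ∸ toℕ i) , Pᵢ≃ i) , λ w → refl)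

    P-identityˡ : ∀ {F} → F ∈ D n k → P n k ⋆ F ≃ F
    P-identityˡ {F} F∈ = Sum-⊆ (fixed-isSubspace (⋆ˡ-linear (P n k))) piece {F} (D⊆Dᴱ {F} F∈)
      where
      piece : ∀ l {F} → F ∈ Pieces E n k l → P n k ⋆ F ≃ F
      -- Only the summand of P with index l acts on piece l. It yields ρ (S (n ∸ l) ⋆ G), and S (n ∸
      -- l) is a left unit in that degree.
      piece l {F} (G , hom , F≃) = ≃.trans (sum-homo (⋆ʳ-linear F) Pᵢ) (sum-single (λ i → Pᵢ i ⋆ F) l
        (≃.trans (⋆-cong (Pᵢ≃ l) F≃) (≃.trans (Eρ-⋆-≡ (toℕ l) (homogeneous-S (n ∸ toℕ l)) hom)
          (≃.trans (·-congˡ {E (toℕ l)} (ρ-cong (S-⋆ hom))) (≃.sym F≃))))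
        λ i i≢l → ≃.trans (⋆-cong (Pᵢ≃ i) F≃) (Eρ-⋆-≢ (toℕ i) (toℕ l) (λ eq → i≢l (Fin.toℕ-injective eq))
          (≤n (j≤ i)) (≤n (j≤ l)) (homogeneous-S (n ∸ toℕ i)) hom))

    P-identityʳ : ∀ {F} → F ∈ D n k → F ⋆ P n k ≃ F
    P-identityʳ {F} F∈ = Sum-⊆ (fixed-isSubspace (⋆ʳ-linear (P n k))) piece {F} (D⊆Dᴱ {F} F∈)
      where
      piece : ∀ l {F} → F ∈ Pieces E n k l → F ⋆ P n k ≃ F
      -- Again only index l contributes; the unit now stands on the right, so `⋆-S` takes the place
      -- of `S-⋆`.
      piece l {F} (G , hom , F≃) = ≃.trans (sum-homo (⋆ˡ-linear F) Pᵢ) (sum-single (λ i → F ⋆ Pᵢ i) l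
        (≃.trans (⋆-cong F≃ (Pᵢ≃ l)) (≃.trans (Eρ-⋆-≡ (toℕ l) hom (homogeneous-S (n ∸ toℕ l)))
          (≃.trans (·-congˡ {E (toℕ l)} (ρ-cong (⋆-S hom))) (≃.sym F≃))))
        λ i i≢l → ≃.trans (⋆-cong F≃ (Pᵢ≃ i)) (Eρ-⋆-≢ (toℕ l) (toℕ i) (λ eq → i≢l (≡.sym (Fin.toℕ-injective eq)))
          (≤n (j≤ l)) (≤n (j≤ i)) hom (homogeneous-S (n ∸ toℕ i))))

    D-isUnitalAlgebra : IsUnitalAlgebra (D n k) (P n k)
    D-isUnitalAlgebra = record
      { isSubspace = D-isSubspace
      ; ⋆-closed   = λ {F} {G} → D-⋆-closed {F} {G}
      ; ⋆-cong     = λ {F} {F′} {G} {G′} _ _ _ _ F≋F′ G≋G′ →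
          ≃⇒≋ (⋆-cong (≋⇒≃ {F} {F′} F≋F′) (≋⇒≃ {G} {G′} G≋G′))
      ; ⋆-assoc    = λ {F} {G} {H} _ _ _ → ≃⇒≋ (⋆-assoc F G H)
      ; distribˡ   = λ {F} {G} {H} _ _ _ → ≃⇒≋ (⋆-distribˡ F G H)
      ; distribʳ   = λ {F} {G} {H} _ _ _ → ≃⇒≋ (⋆-distribʳ F G H)
      ; •-⋆ˡ       = λ a {F} {G} _ _ → ≃⇒≋ (•-⋆ˡ a F G)
      ; •-⋆ʳ       = λ a {F} {G} _ _ → ≃⇒≋ (•-⋆ʳ a F G)
      ; e∈U        = P∈D
      ; identityˡ  = λ {F} F∈ → ≃⇒≋ (P-identityˡ {F} F∈)
      ; identityʳ  = λ {F} F∈ → ≃⇒≋ (P-identityʳ {F} F∈)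
      }

    summand-independent : Independent (summand n k)
    summand-independent g g∈ sum≋𝟘 j = ≃⇒≋ (≃.trans (g≃ j) (≃.trans (·-congˡ {S (toℕ j)} (f≃𝟘 j)) (·-zeroʳ (S (toℕ j)))))
      where
      f : Fin (suc (k ⊓ n)) → Sym
      f j = proj₁ (g∈ j)
      g≃ : ∀ j → g j ≃ S (toℕ j) · f j
      g≃ j = ≋⇒≃ {g j} {S (toℕ j) · f j} (proj₂ (proj₂ (g∈ j)))
      ∂f≃𝟘 : ∀ j → ∂ (f j) ≃ 𝟘
      ∂f≃𝟘 j with D⁰⇒Image {F = f j} (proj₁ (proj₂ (g∈ j)))
      ... | G , _ , f≃ρG = ≃.trans (∂-cong f≃ρG) (∂-ρ G)
      f≃𝟘 : ∀ j → f j ≃ 𝟘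
      f≃𝟘 = ker∂-independent f ∂f≃𝟘 (≃.trans (≃.sym (sum-cong g≃)) (≋⇒≃ {sum g} {𝟘} sum≋𝟘))

theorem2p9 : ∀ {c ℓ₁ ℓ₂} (K : HeytingField c ℓ₁ ℓ₂) (char0 : CharZero K) →
    let open NSym K char0 in
    ∀ (n k : ℕ) →
    Independent (summand n k) ×
    (D n k ⊆ Sym[ n ]) ×
    ⋆-Stable (D n k) ×
    IsUnitalAlgebra (D n k) (P n k)
theorem2p9 K char0 n k =
  summand-independent n k ,
  (λ {F} F∈ → homogeneous⇒Sym[] {F = F} (D-homogeneous n k {F} F∈)) ,
  (λ {F} {G} → D-⋆-closed n k {F} {G}) ,
  D-isUnitalAlgebra n k
  where open SymmetricFunctions K char0
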